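{- There is a family of Boolean functions $F \colon \{ -1,1\}^n \to \{ -1,1\}$ such that $\widetilde{\deg}(F) \ge C(F)^{2-o(1)}$, where $o(1)$ denotes a quantity tending to $0$ as $n \to \infty$.
   Context: $\widetilde{\deg}(F)$ is the least degree of a real polynomial $p$ with $|p(x) - F(x)| \le 1/3$ for all $x \in \{ -1,1\}^n$. For $x \in \{ -1,1\}^n$, a set $S \subseteq [n]$ is a certificate for $F$ at $x$ if every $y \in \{ -1,1\}^n$ with $y_i = x_i$ for all $i \in S$ satisfies $F(y) = F(x)$; $C(F,x)$ is the minimum size of a certificate for $F$ at $x$, and the certificate complexity is $C(F) = \max_{x} C(F,x)$.
   Formalization: The approximating polynomials are taken with rational rather than real coefficients (and multilinear); the least degree is unchanged, since a finite system of rational linear inequalities solvable over the reals is solvable over the rationals. -}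

module Defs where

open import Data.Bool using (Bool; true; false; if_then_else_)
open import Data.Nat as ℕ using (ℕ; suc; _≤_; _<_; _^_; _*_; _∸_)
open import Data.Fin using (Fin)
open import Data.Fin.Subset using (Subset; _∈_; ∣_∣; Side; inside; outside)
open import Data.Vec using (Vec; lookup; tabulate)
import Data.Vec
open import Data.List using (List; map; foldr)
open import Data.List.Relation.Unary.All using (All)
open import Data.Product using (Σ; ∃; _×_; _,_; proj₁; proj₂)
open import Data.Integer using (+_; -[1+_])
open import Data.Rational as ℚ using (ℚ; 1ℚ; -_; _/_)
open import Relation.Binary.PropositionalEquality using (_≡_)
open import Relation.Nullary using (¬_)

-- Points of the Boolean cube {-1,1}^n, encoded by Bool:
-- true represents +1 and false represents -1.
Cube : ℕ → Set
Cube n = Vec Bool n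

-- Boolean functions F : {-1,1}^n → {-1,1} (same encoding of outputs).
BoolFn : ℕ → Set
BoolFn n = Cube n → Bool

val : Bool → ℚ
val true  = 1ℚ
val false = -1ℚ where -1ℚ = - 1ℚ

IsCertificate : ∀ {n} → BoolFn n → Cube n → Subset n → Set
IsCertificate {n} F x S =
  (y : Cube n) → (∀ (i : Fin n) → i ∈ S → lookup y i ≡ lookup x i) → F y ≡ F x

CertComplexityAt : ∀ {n} → BoolFn n → Cube n → ℕ → Set
CertComplexityAt F x c =
  (Σ _ λ S → IsCertificate F x S × ∣ S ∣ ≡ c)
  × (∀ S → IsCertificate F x S → c ≤ ∣ S ∣)

CertComplexity : ∀ {n} → BoolFn n → ℕ → Set
CertComplexity {n} F c =
  (∀ (x : Cube n) → Σ ℕ λ cx → CertComplexityAt F x cx × cx ≤ c)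
  × (Σ (Cube n) λ x → CertComplexityAt F x c)

-- a polynomial is a finite list of monomials c · ∏_{i ∈ S} x_i
Poly : ℕ → Set
Poly n = List (ℚ × Subset n)

χ : ∀ {n} → Subset n → Cube n → ℚ
χ {n} S x = Data.Vec.foldr _ ℚ._*_ 1ℚ
  (tabulate λ i → if lookup S' i then val (lookup x i) else 1ℚ)
  where
  isIn : Side → Bool
  isIn inside = true
  isIn outside = false
  S' : Vec Bool n
  S' = Data.Vec.map isIn S

eval : ∀ {n} → Poly n → Cube n → ℚ
eval p x = foldr ℚ._+_ ℚ.0ℚ (map (λ m → proj₁ m ℚ.* χ (proj₂ m) x) p)

DegreeAtMost : ∀ {n} → ℕ → Poly n → Set
DegreeAtMost d p = All (λ m → ∣ proj₂ m ∣ ≤ d) p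

Approximates : ∀ {n} → Poly n → BoolFn n → Set
Approximates {n} p F = (x : Cube n) → ℚ.∣ eval p x ℚ.- val (F x) ∣ ℚ.≤ (+ 1 / 3)

ApproxDegAtMost : ∀ {n} → BoolFn n → ℕ → Set
ApproxDegAtMost {n} F d = Σ (Poly n) λ p → DegreeAtMost d p × Approximates p F

{-# OPTIONS --safe #-}
module Submission where

open import Defs

-- f has approximate degree at least d as soon as two signed measures of mass 1, nearly concentrated on f⁻¹(true)
-- and f⁻¹(false), agree on all products of functions of fewer than d coordinates.  If the bits of a point drawn
-- from such a pair are replaced by independent points of a pair for g, the degrees multiply: a coordinate of the
-- composition whose factor has low degree integrates to a constant.
--
-- Amplification: compose f with AND of copies of OR, where each OR is represented by a multiplicity s_v ∈ ℕ.  There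
-- are two probability measures on 0, …, 4K² that agree on polynomials of degree below K, the first without mass at 0
-- and the second with constant mass at 0, both of bounded mean.  The multiplicities enter through a list of N random
-- slots, each holding the name of v with probability proportional to s_v; products over e slots then have as mean
-- a polynomial of degree e in s, so the degree of f is multiplied by K.  That Σ s_v exceeds the capacity has
-- exponentially small probability, and there the list is replaced by a signed extrapolation from smaller
-- multiplicities.  As bounded means keep N close to the arity of f, I rounds lead to degree K^I on K^(I+3) bits, with
-- certificates of size K for the value true; dual-rail encoding of the slots keeps f monotone.
--
-- Finally f is composed with its dual-rail version g, all of whose inputs have certificates with few zeros.  A zero
-- bit of its input is certified by a whole block, a one by K bits: certificates have size about K^(I+4), while the
-- degree is K^(2I).

-- Each pair of measures is a dual witness, and one number controls it: the integral of 1 + [f ≠ b]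
-- against the absolute value of `μ b`. It bounds total variation and misplaced mass together. Under
-- composition it picks up one factor per block, so it must stay closer to 1 than the reciprocal of
-- the arity. This is why the OR gadget, which errs with constant probability for the value false,
-- is repeated under an AND. Agreement below the degree is exact throughout. Large multiplicities
-- therefore cannot just be discarded: their replacement has to yield the same polynomials, hence
-- the extrapolation. Its norm is exponential in the degree and is paid for by a capacity with an
-- even smaller tail. The range 4K² of the multiplicities enters the capacity only through this
-- tail, as a summand of order K² times the new degree, while the arity is multiplied by the bounded
-- mean. So the surplus K² in the arity does not accumulate over the rounds. The value true has
-- narrow certificates because one slot witnesses an OR. The value false has none, and the last
-- composition repairs this at the cost of a few factors K, negligible against K^I for large I.

module HardPairs where

  open import Data.Bool using (Bool; true; false; not; _∧_; _∨_; _xor_; if_then_else_)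
  import Data.Bool as Bool
  open import Data.Bool.Properties using (∨-zeroʳ; ∧-zeroʳ)
  open import Data.Fin using (Fin; zero; suc; _↑ˡ_; _↑ʳ_; splitAt; inject≤)
  import Data.Fin.Properties as Fin
  open import Data.Fin.Subset using (Subset; Side; inside; outside; _∈_; ⁅_⁆; _∪_) renaming (∣_∣ to card; ⊥ to ∅)
  open import Data.Fin.Subset.Properties using (anySubset?; _∈?_; ∣⊥∣≡0; ∣⁅x⁆∣≡1; x∈⁅x⁆; p⊆p∪q; q⊆p∪q)
  open import Data.Integer using () renaming (+_ to int)
  open import Data.List as List using (List; []; _∷_; _++_)
  import Data.List.Properties as List
  open import Data.List.Relation.Unary.All as All using (All; []; _∷_)
  import Data.List.Relation.Unary.All.Properties as All
  open import Data.Nat as ℕ using (ℕ; zero; suc) renaming (∣_-_∣ to dist)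
  open import Data.Nat.Induction using (<-wellFounded)
  import Data.Nat.Properties as ℕ
  open import Data.Nat.Solver as ℕSolver using ()
  open import Data.Product using (Σ; _×_; _,_; proj₁; proj₂)
  open import Data.Rational hiding (NonZero)
  open import Data.Rational.Properties
  open import Data.Rational.Solver
  open import Data.Sum using (_⊎_; inj₁; inj₂)
  open import Data.Unit using (⊤; tt)
  open import Data.Vec as Vec using (Vec; []; _∷_; lookup; tabulate; replicate; concat; here; there; _[_]≔_)
  import Data.Vec.Properties as Vec
  open import Function using (_∘_)
  open import Induction.WellFounded using (Acc; acc)
  open import Relation.Binary.PropositionalEquality
  open import Relation.Nullary using (¬_; Dec; yes; no; contradiction; ¬?)
  open import Relation.Nullary.Decidable using (toWitness; toWitnessFalse; _→-dec_; _×-dec_; decidable-stable)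
  open +-*-Solver using (solve; _:=_; _:+_; _:*_; _:-_; :-_; con)
  open ℕSolver.+-*-Solver using ()
    renaming (solve to solveℕ; con to conℕ; _:+_ to _⊕_; _:*_ to _⊗_; _:=_ to _⊜_)

  private variable
    X Y : Set
    n e e′ w w′ : ℕ

  -- Rational arithmetic: naturals, powers, reciprocals.

  ι : ℕ → ℚ
  ι zero    = 0ℚ
  ι (suc n) = 1ℚ + ι n

  infixr 8 _^^_
  _^^_ : ℚ → ℕ → ℚ
  x ^^ zero  = 1ℚ
  x ^^ suc n = x * x ^^ n

  0≤1 : 0ℚ ≤ 1ℚ
  0≤1 = nonNegative⁻¹ 1ℚ

  ≤-step : ∀ {a b r} → 0ℚ ≤ r → a + r ≡ b → a ≤ b
  ≤-step {a} {b} {r} 0≤r eq =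
    subst₂ _≤_ (+-identityʳ a) eq (+-monoʳ-≤ a 0≤r)

  0≤+ : ∀ {a b} → 0ℚ ≤ a → 0ℚ ≤ b → 0ℚ ≤ a + b
  0≤+ {a} {b} p q = +-mono-≤ p q

  *-monoʳ : ∀ {a b c} → 0ℚ ≤ c → a ≤ b → a * c ≤ b * c
  *-monoʳ {c = c} 0≤c a≤b = *-monoʳ-≤-nonNeg c {{nonNegative 0≤c}} a≤b

  *-monoˡ : ∀ {a b c} → 0ℚ ≤ c → a ≤ b → c * a ≤ c * b
  *-monoˡ {c = c} 0≤c a≤b = *-monoˡ-≤-nonNeg c {{nonNegative 0≤c}} a≤b

  0≤* : ∀ {a b} → 0ℚ ≤ a → 0ℚ ≤ b → 0ℚ ≤ a * b
  0≤* {a} {b} p q = subst (_≤ a * b) (*-zeroʳ a) (*-monoˡ p q)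

  *-mono : ∀ {a b c d} → 0ℚ ≤ a → a ≤ b → 0ℚ ≤ c → c ≤ d → a * c ≤ b * d
  *-mono 0≤a a≤b 0≤c c≤d = ≤-trans (*-monoʳ 0≤c a≤b) (*-monoˡ (≤-trans 0≤a a≤b) c≤d)

  p≤q⇒0≤q-p : ∀ {p q} → p ≤ q → 0ℚ ≤ q - p
  p≤q⇒0≤q-p {p} {q} p≤q = subst (_≤ q - p) (+-inverseʳ p) (+-monoˡ-≤ (- p) p≤q)

  0≤q-p⇒p≤q : ∀ {p q} → 0ℚ ≤ q - p → p ≤ q
  0≤q-p⇒p≤q {p} {q} h = ≤-step h (solve 2 (λ p q → p :+ (q :- p) := q) refl p q)

  p≤q+p : ∀ {p q} → 0ℚ ≤ q → p ≤ q + p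
  p≤q+p {p} {q} h = ≤-step h (+-comm p q)

  p≤p+q : ∀ {p q} → 0ℚ ≤ q → p ≤ p + q
  p≤p+q {p} {q} h = ≤-step h refl

  p≤∣p∣ : ∀ p → p ≤ ∣ p ∣
  p≤∣p∣ p with ∣p∣≡p∨∣p∣≡-p p
  ... | inj₁ eq = ≤-reflexive (sym eq)
  ... | inj₂ eq with ≤-total 0ℚ p
  ...   | inj₁ 0≤p = ≤-reflexive (sym (0≤p⇒∣p∣≡p 0≤p))
  ...   | inj₂ p≤0 = ≤-trans p≤0 (0≤∣p∣ p)

  -p≤∣p∣ : ∀ p → - p ≤ ∣ p ∣
  -p≤∣p∣ p = subst (- p ≤_) (∣-p∣≡∣p∣ p) (p≤∣p∣ (- p))

  ι-+ : ∀ m n → ι (m ℕ.+ n) ≡ ι m + ι n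
  ι-+ zero    n = sym (+-identityˡ (ι n))
  ι-+ (suc m) n = trans (cong (1ℚ +_) (ι-+ m n)) (sym (+-assoc 1ℚ (ι m) (ι n)))

  ι-* : ∀ m n → ι (m ℕ.* n) ≡ ι m * ι n
  ι-* zero    n = sym (*-zeroˡ (ι n))
  ι-* (suc m) n = trans (ι-+ n (m ℕ.* n)) (trans (cong (ι n +_) (ι-* m n))
    (solve 2 (λ m n → n :+ m :* n := (con 1ℚ :+ m) :* n) refl (ι m) (ι n)))

  ι-^ : ∀ m n → ι (m ℕ.^ n) ≡ ι m ^^ n
  ι-^ m zero    = +-identityʳ 1ℚ
  ι-^ m (suc n) = trans (ι-* m (m ℕ.^ n)) (cong (ι m *_) (ι-^ m n))

  0≤ι : ∀ n → 0ℚ ≤ ι n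
  0≤ι zero    = ≤-refl
  0≤ι (suc n) = 0≤+ 0≤1 (0≤ι n)

  ι-mono : ∀ {m n} → m ℕ.≤ n → ι m ≤ ι n
  ι-mono {n = n} ℕ.z≤n = 0≤ι n
  ι-mono (ℕ.s≤s p) = +-monoʳ-≤ 1ℚ (ι-mono p)

  1≤ι : ∀ n → 1ℚ ≤ ι (suc n)
  1≤ι n = p≤p+q (0≤ι n)

  ι-suc-pos : ∀ n → Positive (ι (suc n))
  ι-suc-pos n = positive (<-≤-trans (positive⁻¹ 1ℚ) (1≤ι n))

  inv : ℕ → ℚ
  -- A default value; with it `0≤inv` holds without hypotheses.
  inv zero    = 0ℚ
  inv (suc n) = (1/ ι (suc n)) {{pos⇒nonZero (ι (suc n)) {{ι-suc-pos n}}}}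

  ι*inv : ∀ n .{{_ : ℕ.NonZero n}} → ι n * inv n ≡ 1ℚ
  ι*inv (suc n) = *-inverseʳ (ι (suc n)) {{pos⇒nonZero (ι (suc n)) {{ι-suc-pos n}}}}

  0≤inv : ∀ n → 0ℚ ≤ inv n
  0≤inv zero    = ≤-refl
  0≤inv (suc n) = <⇒≤ (positive⁻¹ _ {{1/pos⇒pos (ι (suc n)) {{ι-suc-pos n}}}})

  inv-≤ : ∀ n .{{_ : ℕ.NonZero n}} {x y} → x ≤ ι n * y → x * inv n ≤ y
  inv-≤ n {x} {y} h = subst (x * inv n ≤_) eq (*-monoʳ (0≤inv n) h)
    where
    eq : ι n * y * inv n ≡ y
    eq = trans (solve 3 (λ a x b → a :* x :* b := a :* b :* x) refl (ι n) y (inv n))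
         (trans (cong (_* y) (ι*inv n)) (*-identityˡ y))

  0≤^^ : ∀ {x} n → 0ℚ ≤ x → 0ℚ ≤ x ^^ n
  0≤^^ zero    0≤x = 0≤1
  0≤^^ (suc n) 0≤x = 0≤* 0≤x (0≤^^ n 0≤x)

  ^^-mono : ∀ {x y} n → 0ℚ ≤ x → x ≤ y → x ^^ n ≤ y ^^ n
  ^^-mono zero    0≤x x≤y = ≤-refl
  ^^-mono (suc n) 0≤x x≤y = *-mono 0≤x x≤y (0≤^^ n 0≤x) (^^-mono n 0≤x x≤y)

  ^^-+ : ∀ x m n → x ^^ (m ℕ.+ n) ≡ x ^^ m * x ^^ n
  ^^-+ x zero    n = sym (*-identityˡ (x ^^ n))
  ^^-+ x (suc m) n = trans (cong (x *_) (^^-+ x m n)) (sym (*-assoc x (x ^^ m) (x ^^ n)))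

  ^^-*-distrib : ∀ x y n → (x * y) ^^ n ≡ x ^^ n * y ^^ n
  ^^-*-distrib x y zero    = refl
  ^^-*-distrib x y (suc n) = trans (cong (x * y *_) (^^-*-distrib x y n))
    (solve 4 (λ x y a b → x :* y :* (a :* b) := x :* a :* (y :* b)) refl x y (x ^^ n) (y ^^ n))

  1^^ : ∀ n → 1ℚ ^^ n ≡ 1ℚ
  1^^ zero    = refl
  1^^ (suc n) = trans (*-identityˡ (1ℚ ^^ n)) (1^^ n)

  ^^-* : ∀ x m n → x ^^ (m ℕ.* n) ≡ (x ^^ n) ^^ m
  ^^-* x zero    n = refl
  ^^-* x (suc m) n = trans (^^-+ x n (m ℕ.* n)) (cong (x ^^ n *_) (^^-* x m n))

  1≤^^ : ∀ {x} n → 1ℚ ≤ x → 1ℚ ≤ x ^^ n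
  1≤^^ {x} n 1≤x = subst (_≤ x ^^ n) (1^^ n) (^^-mono n 0≤1 1≤x)

  ^^-monoʳ : ∀ {x m n} → 1ℚ ≤ x → m ℕ.≤ n → x ^^ m ≤ x ^^ n
  ^^-monoʳ {n = n} 1≤x ℕ.z≤n = 1≤^^ n 1≤x
  ^^-monoʳ 1≤x (ℕ.s≤s p) = *-monoˡ (≤-trans 0≤1 1≤x) (^^-monoʳ 1≤x p)

  bernoulli : ∀ n {x} → 0ℚ ≤ x → 1ℚ + ι n * x ≤ (1ℚ + x) ^^ n
  bernoulli zero    {x} 0≤x = ≤-reflexive (trans (cong (1ℚ +_) (*-zeroˡ x)) (+-identityʳ 1ℚ))
  bernoulli (suc n) {x} 0≤x = ≤-trans
    (≤-step (0≤* (0≤* (0≤ι n) 0≤x) 0≤x)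
      (solve 2 (λ n x → con 1ℚ :+ (con 1ℚ :+ n) :* x :+ n :* x :* x
                      := (con 1ℚ :+ x) :* (con 1ℚ :+ n :* x)) refl (ι n) x))
    (*-monoˡ (0≤+ 0≤1 0≤x) (bernoulli n 0≤x))

  0≤½ : 0ℚ ≤ ½
  0≤½ = nonNegative⁻¹ ½

  2^½ : ∀ n → ι (2 ℕ.^ n) * ½ ^^ n ≡ 1ℚ
  2^½ n = trans (cong (_* ½ ^^ n) (ι-^ 2 n)) (trans (sym (^^-*-distrib (ι 2) ½ n)) (1^^ n))

  -- For x close to 1 - 1/k and y = 1/k: Bernoulli gives (1 + y)^k ≥ 2.
  decay : ∀ k x y → 0ℚ ≤ x → 0ℚ ≤ y → x * (1ℚ + y) ≤ 1ℚ → 1ℚ ≤ ι k * y → x ^^ k ≤ ½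
  decay k x y 0≤x 0≤y xy≤1 1≤ky = subst (_≤ ½) (*-identityʳ (x ^^ k)) (≤-trans (≤-reflexive double) (≤-trans (*-monoʳ 0≤½ h) (≤-reflexive (*-identityˡ ½))))
    where
    double : x ^^ k * 1ℚ ≡ x ^^ k * (1ℚ + 1ℚ) * ½
    double = sym (*-assoc (x ^^ k) (1ℚ + 1ℚ) ½)
    h : x ^^ k * (1ℚ + 1ℚ) ≤ 1ℚ
    h = ≤-trans (*-monoˡ (0≤^^ k 0≤x) (≤-trans (+-monoʳ-≤ 1ℚ 1≤ky) (bernoulli k 0≤y)))
        (≤-trans (≤-reflexive (sym (^^-*-distrib x (1ℚ + y) k)))
          (subst ((x * (1ℚ + y)) ^^ k ≤_) (1^^ k) (^^-mono k (0≤* 0≤x (0≤+ 0≤1 0≤y)) xy≤1)))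

  -- Signed measures, their integrals and products.

  -- A finitely supported signed measure, as a list of weighted points.
  Meas : Set → Set
  Meas X = List (ℚ × X)

  ∫ : Meas X → (X → ℚ) → ℚ
  ∫ []            f = 0ℚ
  ∫ ((w , x) ∷ μ) f = w * f x + ∫ μ f

  abs : Meas X → Meas X
  abs []            = []
  abs ((w , x) ∷ μ) = (∣ w ∣ , x) ∷ abs μ

  scale : ℚ → Meas X → Meas X
  scale c []            = []
  scale c ((w , x) ∷ μ) = (c * w , x) ∷ scale c μ

  δ : X → Meas X
  δ x = (1ℚ , x) ∷ []

  bind : Meas X → (X → Meas Y) → Meas Y
  bind []            k = []
  bind ((w , x) ∷ μ) k = scale w (k x) ++ bind μ k

  pmap : (X → Y) → Meas X → Meas Y
  pmap f []            = []
  pmap f ((w , x) ∷ μ) = (w , f x) ∷ pmap f μ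

  prod : ∀ {n} → (X → Meas Y) → Vec X n → Meas (Vec Y n)
  prod κ []       = δ []
  prod κ (x ∷ xs) = bind (κ x) (λ y → pmap (y ∷_) (prod κ xs))

  Pos : Meas X → Set
  Pos = All (λ p → 0ℚ ≤ proj₁ p)

  Supp : (X → Set) → Meas X → Set
  Supp P = All (P ∘ proj₂)

  ∫-++ : ∀ (μ ν : Meas X) f → ∫ (μ ++ ν) f ≡ ∫ μ f + ∫ ν f
  ∫-++ []            ν f = sym (+-identityˡ _)
  ∫-++ ((w , x) ∷ μ) ν f = trans (cong (w * f x +_) (∫-++ μ ν f)) (sym (+-assoc (w * f x) _ _))

  ∫-scale : ∀ c (μ : Meas X) f → ∫ (scale c μ) f ≡ c * ∫ μ f
  ∫-scale c []            f = sym (*-zeroʳ c)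
  ∫-scale c ((w , x) ∷ μ) f = trans (cong (c * w * f x +_) (∫-scale c μ f))
    (solve 4 (λ c w y m → c :* w :* y :+ c :* m := c :* (w :* y :+ m)) refl c w (f x) (∫ μ f))

  ∫-δ : ∀ (x : X) f → ∫ (δ x) f ≡ f x
  ∫-δ x f = trans (+-identityʳ _) (*-identityˡ (f x))

  ∫-bind : ∀ (μ : Meas X) (k : X → Meas Y) f → ∫ (bind μ k) f ≡ ∫ μ (λ x → ∫ (k x) f)
  ∫-bind []            k f = refl
  ∫-bind ((w , x) ∷ μ) k f = trans (∫-++ (scale w (k x)) (bind μ k) f)
    (cong₂ _+_ (∫-scale w (k x) f) (∫-bind μ k f))

  ∫-pmap : ∀ (h : X → Y) μ f → ∫ (pmap h μ) f ≡ ∫ μ (f ∘ h)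
  ∫-pmap h []            f = refl
  ∫-pmap h ((w , x) ∷ μ) f = cong (w * f (h x) +_) (∫-pmap h μ f)

  ∫-cong : ∀ (μ : Meas X) {f g} → (∀ x → f x ≡ g x) → ∫ μ f ≡ ∫ μ g
  ∫-cong []            eq = refl
  ∫-cong ((w , x) ∷ μ) eq = cong₂ _+_ (cong (w *_) (eq x)) (∫-cong μ eq)

  ∫-congS : ∀ {P : X → Set} (μ : Meas X) {f g} → Supp P μ → (∀ x → P x → f x ≡ g x) → ∫ μ f ≡ ∫ μ g
  ∫-congS []            []       eq = refl
  ∫-congS ((w , x) ∷ μ) (p ∷ ps) eq = cong₂ _+_ (cong (w *_) (eq x p)) (∫-congS μ ps eq)

  ∫-+ : ∀ (μ : Meas X) f g → ∫ μ (λ x → f x + g x) ≡ ∫ μ f + ∫ μ g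
  ∫-+ []            f g = refl
  ∫-+ ((w , x) ∷ μ) f g = trans (cong (w * (f x + g x) +_) (∫-+ μ f g))
    (solve 5 (λ w a b m n → w :* (a :+ b) :+ (m :+ n) := w :* a :+ m :+ (w :* b :+ n)) refl
      w (f x) (g x) (∫ μ f) (∫ μ g))

  ∫-*ˡ : ∀ (μ : Meas X) c f → ∫ μ (λ x → c * f x) ≡ c * ∫ μ f
  ∫-*ˡ []            c f = sym (*-zeroʳ c)
  ∫-*ˡ ((w , x) ∷ μ) c f = trans (cong (w * (c * f x) +_) (∫-*ˡ μ c f))
    (solve 4 (λ w c a m → w :* (c :* a) :+ c :* m := c :* (w :* a :+ m)) refl w c (f x) (∫ μ f))

  ∫-*ʳ : ∀ (μ : Meas X) c f → ∫ μ (λ x → f x * c) ≡ ∫ μ f * c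
  ∫-*ʳ μ c f = trans (∫-cong μ (λ x → *-comm (f x) c)) (trans (∫-*ˡ μ c f) (*-comm c _))

  ∫-0 : ∀ (μ : Meas X) → ∫ μ (λ _ → 0ℚ) ≡ 0ℚ
  ∫-0 μ = trans (∫-*ˡ μ 0ℚ (λ _ → 0ℚ)) (*-zeroˡ (∫ μ (λ _ → 0ℚ)))

  ∫-const : ∀ (μ : Meas X) c → ∫ μ (λ _ → c) ≡ c * ∫ μ (λ _ → 1ℚ)
  ∫-const μ c = trans (∫-cong μ (λ _ → sym (*-identityʳ c))) (∫-*ˡ μ c (λ _ → 1ℚ))

  ∫-mono : ∀ {μ : Meas X} {f g} → Pos μ → (∀ x → f x ≤ g x) → ∫ μ f ≤ ∫ μ g
  ∫-mono []       h = ≤-refl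
  ∫-mono (p ∷ ps) h = +-mono-≤ (*-monoˡ p (h _)) (∫-mono ps h)

  ∫-monoS : ∀ {P : X → Set} {μ : Meas X} {f g} → Pos μ → Supp P μ → (∀ x → P x → f x ≤ g x) →
    ∫ μ f ≤ ∫ μ g
  ∫-monoS []       []       h = ≤-refl
  ∫-monoS (p ∷ ps) (s ∷ ss) h = +-mono-≤ (*-monoˡ p (h _ s)) (∫-monoS ps ss h)

  0≤∫ : ∀ {μ : Meas X} {f} → Pos μ → (∀ x → 0ℚ ≤ f x) → 0ℚ ≤ ∫ μ f
  0≤∫ {μ = μ} {f} p h = subst (_≤ ∫ μ f) (∫-0 μ) (∫-mono p h)

  abs-pos : ∀ (μ : Meas X) → Pos (abs μ)
  abs-pos []            = []
  abs-pos ((w , x) ∷ μ) = 0≤∣p∣ w ∷ abs-pos μ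

  abs-id : ∀ {μ : Meas X} → Pos μ → abs μ ≡ μ
  abs-id []       = refl
  abs-id {μ = (w , x) ∷ μ} (p ∷ ps) = cong₂ (λ a b → (a , x) ∷ b) (0≤p⇒∣p∣≡p p) (abs-id ps)

  abs-++ : ∀ (μ ν : Meas X) → abs (μ ++ ν) ≡ abs μ ++ abs ν
  abs-++ []            ν = refl
  abs-++ ((w , x) ∷ μ) ν = cong (_ ∷_) (abs-++ μ ν)

  abs-scale : ∀ c (μ : Meas X) → abs (scale c μ) ≡ scale ∣ c ∣ (abs μ)
  abs-scale c []            = refl
  abs-scale c ((w , x) ∷ μ) = cong₂ (λ a b → (a , x) ∷ b) (∣p*q∣≡∣p∣*∣q∣ c w) (abs-scale c μ)

  abs-bind : ∀ (μ : Meas X) (k : X → Meas Y) → abs (bind μ k) ≡ bind (abs μ) (abs ∘ k)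
  abs-bind []            k = refl
  abs-bind ((w , x) ∷ μ) k = trans (abs-++ (scale w (k x)) (bind μ k))
    (cong₂ _++_ (abs-scale w (k x)) (abs-bind μ k))

  abs-pmap : ∀ (h : X → Y) μ → abs (pmap h μ) ≡ pmap h (abs μ)
  abs-pmap h []            = refl
  abs-pmap h ((w , x) ∷ μ) = cong (_ ∷_) (abs-pmap h μ)

  ∫-abs-++ : ∀ (μ ν : Meas X) f → ∫ (abs (μ ++ ν)) f ≡ ∫ (abs μ) f + ∫ (abs ν) f
  ∫-abs-++ μ ν f = trans (cong (λ m → ∫ m f) (abs-++ μ ν)) (∫-++ (abs μ) (abs ν) f)

  ∫-abs-pmap : ∀ (h : X → Y) μ f → ∫ (abs (pmap h μ)) f ≡ ∫ (abs μ) (f ∘ h)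
  ∫-abs-pmap h μ f = trans (cong (λ m → ∫ m f) (abs-pmap h μ)) (∫-pmap h (abs μ) f)

  ∫-abs-bind : ∀ (μ : Meas X) (k : X → Meas Y) f → ∫ (abs (bind μ k)) f ≡ ∫ (abs μ) (λ x → ∫ (abs (k x)) f)
  ∫-abs-bind μ k f = trans (cong (λ m → ∫ m f) (abs-bind μ k)) (∫-bind (abs μ) (abs ∘ k) f)

  pmap-supp : ∀ {P : Y → Set} (h : X → Y) {μ} → Supp (P ∘ h) μ → Supp P (pmap h μ)
  pmap-supp h []       = []
  pmap-supp h (p ∷ ps) = p ∷ pmap-supp h ps

  pmap-pos : ∀ (h : X → Y) {μ} → Pos μ → Pos (pmap h μ)
  pmap-pos h []       = []
  pmap-pos h (p ∷ ps) = p ∷ pmap-pos h ps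

  scale-supp : ∀ {P : X → Set} c {μ : Meas X} → Supp P μ → Supp P (scale c μ)
  scale-supp c []       = []
  scale-supp c (p ∷ ps) = p ∷ scale-supp c ps

  scale-pos : ∀ {c} {μ : Meas X} → 0ℚ ≤ c → Pos μ → Pos (scale c μ)
  scale-pos 0≤c []       = []
  scale-pos 0≤c (p ∷ ps) = 0≤* 0≤c p ∷ scale-pos 0≤c ps

  bind-supp : ∀ {P : X → Set} {Q : Y → Set} {μ : Meas X} {k : X → Meas Y} →
    Supp P μ → (∀ x → P x → Supp Q (k x)) → Supp Q (bind μ k)
  bind-supp []       h = []
  bind-supp {μ = (w , _) ∷ _} (p ∷ ps) h = All.++⁺ (scale-supp w (h _ p)) (bind-supp ps h)

  bind-pos : ∀ {μ : Meas X} {k : X → Meas Y} → Pos μ → (∀ x → Pos (k x)) → Pos (bind μ k)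
  bind-pos []       h = []
  bind-pos (p ∷ ps) h = All.++⁺ (scale-pos p (h _)) (bind-pos ps h)

  abs-supp : ∀ {P : X → Set} {μ : Meas X} → Supp P μ → Supp P (abs μ)
  abs-supp []       = []
  abs-supp (p ∷ ps) = p ∷ abs-supp ps

  supp-univ : ∀ {P : X → Set} → (∀ x → P x) → (μ : Meas X) → Supp P μ
  supp-univ h []            = []
  supp-univ h ((w , x) ∷ μ) = h x ∷ supp-univ h μ

  ∣∫∣≤ : ∀ (μ : Meas X) f → ∣ ∫ μ f ∣ ≤ ∫ (abs μ) (λ x → ∣ f x ∣)
  ∣∫∣≤ []            f = ≤-refl
  ∣∫∣≤ ((w , x) ∷ μ) f = ≤-trans (∣p+q∣≤∣p∣+∣q∣ (w * f x) (∫ μ f))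
    (+-mono-≤ (≤-reflexive (∣p*q∣≡∣p∣*∣q∣ w (f x))) (∣∫∣≤ μ f))

  ∫-prod-∷ : ∀ {n} (κ : X → Meas Y) x (xs : Vec X n) f →
    ∫ (prod κ (x ∷ xs)) f ≡ ∫ (κ x) (λ y → ∫ (prod κ xs) (λ ys → f (y ∷ ys)))
  ∫-prod-∷ κ x xs f = trans (∫-bind (κ x) _ f) (∫-cong (κ x) (λ y → ∫-pmap (y ∷_) (prod κ xs) f))

  ∫-prod-split : ∀ {n} (κ : X → Meas Y) x (xs : Vec X n) f g →
    ∫ (prod κ (x ∷ xs)) (λ ys → f (Vec.head ys) * g (Vec.tail ys)) ≡ ∫ (κ x) f * ∫ (prod κ xs) g
  ∫-prod-split κ x xs f g = trans (∫-prod-∷ κ x xs _)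
    (trans (∫-cong (κ x) (λ y → ∫-*ˡ (prod κ xs) (f y) g)) (∫-*ʳ (κ x) _ f))

  prod-abs : ∀ {n} (κ : X → Meas Y) (xs : Vec X n) → abs (prod κ xs) ≡ prod (abs ∘ κ) xs
  prod-abs κ []       = refl
  prod-abs κ (x ∷ xs) = trans (abs-bind (κ x) _) (bind-cong (abs (κ x)) (λ y →
    trans (abs-pmap (y ∷_) (prod κ xs)) (cong (pmap (y ∷_)) (prod-abs κ xs))))
    where
    bind-cong : ∀ {X Y : Set} (μ : Meas X) {k l : X → Meas Y} → (∀ x → k x ≡ l x) → bind μ k ≡ bind μ l
    bind-cong []            h = refl
    bind-cong ((w , x) ∷ μ) h = cong₂ (λ a b → scale w a ++ b) (h x) (bind-cong μ h)

  prod-pos : ∀ {n} {κ : X → Meas Y} → (∀ x → Pos (κ x)) → (xs : Vec X n) → Pos (prod κ xs)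
  prod-pos h []       = 0≤1 ∷ []
  prod-pos h (x ∷ xs) = bind-pos (h x) (λ y → pmap-pos (y ∷_) (prod-pos h xs))

  vprod : ∀ {n} → (X → ℚ) → Vec X n → ℚ
  vprod f []       = 1ℚ
  vprod f (x ∷ xs) = f x * vprod f xs

  ∫-prod-vprod : ∀ {n} (κ : X → Meas Y) (xs : Vec X n) f →
    ∫ (prod κ xs) (vprod f) ≡ vprod (λ x → ∫ (κ x) f) xs
  ∫-prod-vprod κ []       f = refl
  ∫-prod-vprod κ (x ∷ xs) f = trans (∫-cong (prod κ (x ∷ xs)) (λ { (y ∷ ys) → refl }))
    (trans (∫-prod-split κ x xs f (vprod f)) (cong (∫ (κ x) f *_) (∫-prod-vprod κ xs f)))

  0≤vprod : ∀ {n} {f : X → ℚ} → (∀ x → 0ℚ ≤ f x) → (xs : Vec X n) → 0ℚ ≤ vprod f xs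
  0≤vprod h []       = 0≤1
  0≤vprod h (x ∷ xs) = 0≤* (h x) (0≤vprod h xs)

  vprod-≤ : ∀ {n c} {f : X → ℚ} → (∀ x → 0ℚ ≤ f x) → (∀ x → f x ≤ c) → (xs : Vec X n) → vprod f xs ≤ c ^^ n
  vprod-≤ h u []       = ≤-refl
  vprod-≤ h u (x ∷ xs) = *-mono (h x) (u x) (0≤vprod h xs) (vprod-≤ h u xs)

  vprod-1 : ∀ {n} {f : X → ℚ} → (∀ x → f x ≡ 1ℚ) → (xs : Vec X n) → vprod f xs ≡ 1ℚ
  vprod-1 h []       = refl
  vprod-1 h (x ∷ xs) = cong₂ _*_ (h x) (vprod-1 h xs)

  1≡vprod : ∀ {n} (xs : Vec X n) → 1ℚ ≡ vprod (λ _ → 1ℚ) xs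
  1≡vprod xs = sym (vprod-1 (λ _ → refl) xs)

  ∫-prod-1 : ∀ {n} {κ : X → Meas Y} → (∀ x → ∫ (κ x) (λ _ → 1ℚ) ≡ 1ℚ) → (xs : Vec X n) →
    ∫ (prod κ xs) (λ _ → 1ℚ) ≡ 1ℚ
  ∫-prod-1 {κ = κ} h xs = trans (∫-cong (prod κ xs) 1≡vprod)
    (trans (∫-prod-vprod κ xs (λ _ → 1ℚ)) (vprod-1 h xs))

  ∫-bind-1 : ∀ {μ : Meas X} {k : X → Meas Y} → ∫ μ (λ _ → 1ℚ) ≡ 1ℚ → (∀ x → ∫ (k x) (λ _ → 1ℚ) ≡ 1ℚ) →
    ∫ (bind μ k) (λ _ → 1ℚ) ≡ 1ℚ
  ∫-bind-1 {μ = μ} {k} h hk = trans (∫-bind μ k _) (trans (∫-cong μ hk) h)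

  ∫-pmap-1 : ∀ (h : X → Y) {μ} → ∫ μ (λ _ → 1ℚ) ≡ 1ℚ → ∫ (pmap h μ) (λ _ → 1ℚ) ≡ 1ℚ
  ∫-pmap-1 h {μ} e = trans (∫-pmap h μ _) e

  𝟙 : Bool → ℚ
  𝟙 true  = 1ℚ
  𝟙 false = 0ℚ

  0≤𝟙 : ∀ b → 0ℚ ≤ 𝟙 b
  0≤𝟙 true  = 0≤1
  0≤𝟙 false = ≤-refl

  𝟙≤1 : ∀ b → 𝟙 b ≤ 1ℚ
  𝟙≤1 true  = ≤-refl
  𝟙≤1 false = 0≤1

  -- Test functions, their degree, and measures that agree on them.

  -- Tst e consists of codes for test functions of degree e.
  record Space : Set₁ where
    field
      Pt : Set
      Tst : ℕ → Set
      ev : Tst e → Pt → ℚ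
  open Space

  -- The degree counts coordinates: an arbitrary function of one coordinate is charged 1, however
  -- large X is.
  data AtomT (X : Set) : ℕ → Set where
    one : AtomT X 0
    fn  : (X → ℚ) → AtomT X 1

  atom : Set → Space
  atom X .Pt = X
  atom X .Tst = AtomT X
  atom X .ev one    x = 1ℚ
  atom X .ev (fn f) x = f x

  infixr 5 _∷ₜ_
  data PowT (S : Space) : ℕ → ℕ → Set where
    []   : PowT S 0 0
    _∷ₜ_ : Tst S e → PowT S n e′ → PowT S (suc n) (e ℕ.+ e′)

  evP : (S : Space) → PowT S n e → Vec (Pt S) n → ℚ
  evP S []        _        = 1ℚ
  evP S (t ∷ₜ ts) (x ∷ xs) = ev S t x * evP S ts xs

  Pow : Space → ℕ → Space
  Pow S n .Pt = Vec (Pt S) n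
  Pow S n .Tst = PowT S n
  Pow S n .ev = evP S

  bits : ℕ → Space
  bits = Pow (atom Bool)

  Match : (S : Space) → ℕ → (Bool → Meas (Pt S)) → Set
  Match S d μ = ∀ {e} → e ℕ.< d → (t : Tst S e) → ∫ (μ true) (ev S t) ≡ ∫ (μ false) (ev S t)

  match-any : ∀ {S d} {μ : Bool → Meas (Pt S)} → Match S d μ → e ℕ.< d → (t : Tst S e) →
    ∀ b → ∫ (μ b) (ev S t) ≡ ∫ (μ true) (ev S t)
  match-any m lt t true  = refl
  match-any m lt t false = sym (m lt t)

  ∫-prod-ev : (S : Space) (κ : X → Meas (Pt S)) (t : Tst S e) (ts : PowT S n e′) → ∀ z zs →
    ∫ (prod κ (z ∷ zs)) (evP S (t ∷ₜ ts)) ≡ ∫ (κ z) (ev S t) * ∫ (prod κ zs) (evP S ts)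
  ∫-prod-ev S κ t ts z zs = trans (∫-cong (prod κ (z ∷ zs)) (λ { (y ∷ ys) → refl }))
    (∫-prod-split κ z zs (ev S t) (evP S ts))

  -- Averaging each coordinate over matching measures kills every factor of degree below D,
  -- so the degree drops by a factor of D.
  collapse : ∀ (S : Space) D (κ : Bool → Meas (Pt S)) → Match S D κ → (t : PowT S n e) →
    Σ ℕ λ e′ → Σ (PowT (atom Bool) n e′) λ t′ → Σ ℚ λ c →
      e′ ℕ.* D ℕ.≤ e × (∀ z → ∫ (prod κ z) (evP S t) ≡ c * evP (atom Bool) t′ z)
  collapse S D κ m [] = 0 , [] , 1ℚ , ℕ.z≤n , λ { [] → refl }
  collapse S D κ m (_∷ₜ_ {e = e₁} t ts) with collapse S D κ m ts | e₁ ℕ.<? D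
  ... | e′ , t′ , c , le , h | yes lt =
    e′ , one ∷ₜ t′ , ∫ (κ true) (ev S t) * c , ℕ.≤-trans le (ℕ.m≤n+m _ e₁) , λ { (b ∷ z) →
      trans (∫-prod-ev S κ t ts b z) (trans (cong₂ _*_ (match-any {S = S} {μ = κ} m lt t b) (h z))
        (solve 3 (λ a c x → a :* (c :* x) := a :* c :* (con 1ℚ :* x)) refl
          (∫ (κ true) (ev S t)) c (evP (atom Bool) t′ z))) }
  ... | e′ , t′ , c , le , h | no nlt =
    suc e′ , fn (λ b → ∫ (κ b) (ev S t)) ∷ₜ t′ , c , ℕ.+-mono-≤ (ℕ.≮⇒≥ nlt) le , λ { (b ∷ z) →
      trans (∫-prod-ev S κ t ts b z) (trans (cong (∫ (κ b) (ev S t) *_) (h z))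
        (solve 3 (λ a c x → a :* (c :* x) := c :* (a :* x)) refl
          (∫ (κ b) (ev S t)) c (evP (atom Bool) t′ z))) }

  match-compose : ∀ (S : Space) {n} d D {ν : Bool → Meas (Vec Bool n)} {κ : Bool → Meas (Pt S)} →
    Match (bits n) d ν → Match S D κ → Match (Pow S n) (d ℕ.* D) (λ b → bind (ν b) (prod κ))
  match-compose S d D {ν} {κ} mν mκ lt t with collapse S D κ mκ t
  ... | e′ , t′ , c , le , h = trans (eq true) (trans (cong (c *_)
      (mν (ℕ.*-cancelʳ-< D e′ d (ℕ.≤-<-trans le lt)) t′)) (sym (eq false)))
    where
    eq : ∀ b → ∫ (bind (ν b) (prod κ)) (evP S t) ≡ c * ∫ (ν b) (evP (atom Bool) t′)
    eq b = trans (∫-bind (ν b) (prod κ) _) (trans (∫-cong (ν b) h) (∫-*ˡ (ν b) c _))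

  splitT : ∀ (S : Space) m {n} (t : PowT S (m ℕ.+ n) e) →
    Σ ℕ λ e₁ → Σ ℕ λ e₂ → Σ (PowT S m e₁) λ t₁ → Σ (PowT S n e₂) λ t₂ →
      e₁ ℕ.+ e₂ ≡ e × (∀ x y → evP S t (x Vec.++ y) ≡ evP S t₁ x * evP S t₂ y)
  splitT S zero    t = 0 , _ , [] , t , refl , λ { [] y → sym (*-identityˡ _) }
  splitT S (suc m) (_∷ₜ_ {e = e₀} t ts) with splitT S m ts
  ... | e₁ , e₂ , t₁ , t₂ , refl , h = e₀ ℕ.+ e₁ , e₂ , t ∷ₜ t₁ , t₂ , ℕ.+-assoc e₀ e₁ e₂ ,
    λ { (a ∷ x) y → trans (cong (ev S t a *_) (h x y)) (sym (*-assoc (ev S t a) _ _)) }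

  flattenT : ∀ (S : Space) b {n} (t : PowT S (n ℕ.* b) e) →
    Σ (PowT (Pow S b) n e) λ t′ → ∀ x → evP S t (concat x) ≡ evP (Pow S b) t′ x
  flattenT S b {zero}  [] = [] , λ { [] → refl }
  flattenT S b {suc n} t with splitT S b {n ℕ.* b} t
  ... | e₁ , e₂ , t₁ , t₂ , refl , h with flattenT S b {n} t₂
  ...   | t₂′ , h₂ = t₁ ∷ₜ t₂′ , λ { (x ∷ xs) → trans (h x (concat xs)) (cong (evP S t₁ x *_) (h₂ xs)) }

  PullsBack : (S T : Space) → (Pt S → Pt T) → Set
  PullsBack S T h = ∀ {e} (t : Tst T e) → Σ ℕ λ e′ → Σ (Tst S e′) λ t′ →
    e′ ℕ.≤ e × (∀ x → ev T t (h x) ≡ ev S t′ x)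

  match-pmap : ∀ {S T d} {h : Pt S → Pt T} {μ} → PullsBack S T h → Match S d μ →
    Match T d (pmap h ∘ μ)
  match-pmap {S} {T} {h = h} {μ} pb m lt t with pb t
  ... | e′ , t′ , le , eq = trans (ex true) (trans (m (ℕ.≤-<-trans le lt) t′) (sym (ex false)))
    where
    ex : ∀ b → ∫ (pmap h (μ b)) (ev T t) ≡ ∫ (μ b) (ev S t′)
    ex b = trans (∫-pmap h (μ b) _) (∫-cong (μ b) eq)

  pb-∘ : ∀ {S T U} {g : Pt T → Pt U} {h : Pt S → Pt T} → PullsBack S T h → PullsBack T U g →
    PullsBack S U (g ∘ h)
  pb-∘ ph pg t with pg t
  ... | e₁ , t₁ , le₁ , eq₁ with ph t₁
  ...   | e₂ , t₂ , le₂ , eq₂ = e₂ , t₂ , ℕ.≤-trans le₂ le₁ , λ x → trans (eq₁ _) (eq₂ x)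

  pb-concat : ∀ (S : Space) b {n} → PullsBack (Pow (Pow S b) n) (Pow S (n ℕ.* b)) concat
  pb-concat S b {n} t with flattenT S b {n} t
  ... | t′ , h = _ , t′ , ℕ.≤-refl , h

  pb-map : ∀ {S T} {h : Pt S → Pt T} {n} → PullsBack S T h → PullsBack (Pow S n) (Pow T n) (Vec.map h)
  pb-map pb []        = 0 , [] , ℕ.z≤n , λ { [] → refl }
  pb-map {S} {T} {h} pb (t ∷ₜ ts) with pb t | pb-map {S} {T} {h} pb ts
  ... | e₁ , t₁ , le₁ , eq₁ | e₂ , t₂ , le₂ , eq₂ =
    e₁ ℕ.+ e₂ , t₁ ∷ₜ t₂ , ℕ.+-mono-≤ le₁ le₂ , λ { (x ∷ xs) → cong₂ _*_ (eq₁ x) (eq₂ xs) }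

  test₀ : (t : PowT (atom X) n 0) → ∀ x → evP (atom X) t x ≡ 1ℚ
  test₀ t = go t refl
    where
    -- An index e₁ + e₂ does not unify with 0, so the degree is kept variable and equated to 0.
    go : (t : PowT (atom X) n e) → e ≡ 0 → ∀ x → evP (atom X) t x ≡ 1ℚ
    go []          _  []       = refl
    go (one ∷ₜ ts) eq (x ∷ xs) = trans (*-identityˡ _) (go ts eq xs)

  -- A test of degree 0 is constantly 1 and any other becomes one function of the single atom, of
  -- degree 1. Hence copying a bit, or spelling out a slot in bits, raises no degree.
  pb-atom : (h : Y → Vec X n) → PullsBack (atom Y) (Pow (atom X) n) h
  pb-atom h {zero}  t = 0 , one , ℕ.z≤n , λ y → test₀ t (h y)
  pb-atom {X = X} h {suc e} t = 1 , fn (λ y → evP (atom X) t (h y)) , ℕ.s≤s ℕ.z≤n , λ y → refl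

  -- `χ` keeps its membership test in a local definition, so the equation is stated for every `isIn`
  -- with the right two values.
  χ-test : (S : Subset n) → Σ (PowT (atom Bool) n (card S)) λ t →
    ∀ (isIn : Side → Bool) → isIn inside ≡ true → isIn outside ≡ false → ∀ x →
      Vec.foldr (λ _ → ℚ) _*_ 1ℚ (tabulate λ i → if lookup (Vec.map isIn S) i then val (lookup x i) else 1ℚ)
        ≡ evP (atom Bool) t x
  χ-test []          = [] , λ { isIn p q [] → refl }
  χ-test (true ∷ S)  with χ-test S
  ... | t , h = fn val ∷ₜ t , λ { isIn p q (b ∷ x) →
    cong₂ _*_ (cong (λ c → if c then val b else 1ℚ) p) (h isIn p q x) }
  χ-test (false ∷ S) with χ-test S
  ... | t , h = one ∷ₜ t , λ { isIn p q (b ∷ x) →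
    cong₂ _*_ (cong (λ c → if c then val b else 1ℚ) q) (h isIn p q x) }

  match-eval : ∀ {d k} {μ : Bool → Meas (Cube n)} → Match (bits n) d μ → k ℕ.< d → (p : Poly n) →
    DegreeAtMost k p → ∫ (μ true) (eval p) ≡ ∫ (μ false) (eval p)
  match-eval {μ = μ} m lt []            []       = trans (∫-0 (μ true)) (sym (∫-0 (μ false)))
  match-eval {μ = μ} m lt ((c , S) ∷ p) (q ∷ qs) with χ-test S
  ... | t , h = trans (ex true) (trans (cong₂ _+_ (cong (c *_) (m (ℕ.≤-<-trans q lt) t))
      (match-eval {μ = μ} m lt p qs)) (sym (ex false)))
    where
    ex : ∀ b → ∫ (μ b) (eval ((c , S) ∷ p)) ≡ c * ∫ (μ b) (evP (atom Bool) t) + ∫ (μ b) (eval p)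
    ex b = trans (∫-+ (μ b) _ (eval p)) (cong (_+ ∫ (μ b) (eval p))
      (trans (∫-*ˡ (μ b) c (χ S)) (cong (c *_) (∫-cong (μ b) (λ x → h _ refl refl x)))))

  -- Finite differences and binomial coefficients.

  Σ< : ℕ → (ℕ → ℚ) → ℚ
  Σ< zero    f = 0ℚ
  Σ< (suc n) f = f n + Σ< n f

  Σ<-cong : ∀ n {f g : ℕ → ℚ} → (∀ i → f i ≡ g i) → Σ< n f ≡ Σ< n g
  Σ<-cong zero    h = refl
  Σ<-cong (suc n) h = cong₂ _+_ (h n) (Σ<-cong n h)

  Σ<-+ : ∀ n (f g : ℕ → ℚ) → Σ< n (λ i → f i + g i) ≡ Σ< n f + Σ< n g
  Σ<-+ zero    f g = refl
  Σ<-+ (suc n) f g = trans (cong (f n + g n +_) (Σ<-+ n f g))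
    (solve 4 (λ a b c d → a :+ b :+ (c :+ d) := a :+ c :+ (b :+ d)) refl (f n) (g n) (Σ< n f) (Σ< n g))

  Σ<-* : ∀ n c (f : ℕ → ℚ) → Σ< n (λ i → c * f i) ≡ c * Σ< n f
  Σ<-* zero    c f = sym (*-zeroʳ c)
  Σ<-* (suc n) c f = trans (cong (c * f n +_) (Σ<-* n c f)) (sym (*-distribˡ-+ c (f n) (Σ< n f)))

  Σ<-mono : ∀ n {f g : ℕ → ℚ} → (∀ i → i ℕ.< n → f i ≤ g i) → Σ< n f ≤ Σ< n g
  Σ<-mono zero    h = ≤-refl
  Σ<-mono (suc n) h = +-mono-≤ (h n ℕ.≤-refl) (Σ<-mono n (λ i lt → h i (ℕ.m<n⇒m<1+n lt)))

  Σ<-abs : ∀ n (f : ℕ → ℚ) → ∣ Σ< n f ∣ ≤ Σ< n (λ i → ∣ f i ∣)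
  Σ<-abs zero    f = ≤-refl
  Σ<-abs (suc n) f = ≤-trans (∣p+q∣≤∣p∣+∣q∣ (f n) (Σ< n f)) (+-monoʳ-≤ ∣ f n ∣ (Σ<-abs n f))

  Δ : (ℕ → ℚ) → ℕ → ℚ
  Δ q i = q (suc i) - q i

  -- Degree at most d means that the d-th difference is constant, which is the form used both by
  -- alternating binomial sums and by Newton's formula.
  PolyDeg : ℕ → (ℕ → ℚ) → Set
  PolyDeg zero    q = ∀ i → q i ≡ q 0
  PolyDeg (suc d) q = PolyDeg d (Δ q)

  pd-cong : ∀ d {p q : ℕ → ℚ} → (∀ i → p i ≡ q i) → PolyDeg d p → PolyDeg d q
  pd-cong zero    h p i = trans (sym (h i)) (trans (p i) (h 0))
  pd-cong (suc d) h p = pd-cong d (λ i → cong₂ _-_ (h (suc i)) (h i)) p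

  pd-+ : ∀ d {p q : ℕ → ℚ} → PolyDeg d p → PolyDeg d q → PolyDeg d (λ i → p i + q i)
  pd-+ zero    hp hq i = cong₂ _+_ (hp i) (hq i)
  pd-+ (suc d) {p} {q} hp hq = pd-cong d
    (λ i → solve 4 (λ a b c e → (a :- b) :+ (c :- e) := (a :+ c) :- (b :+ e)) refl
      (p (suc i)) (p i) (q (suc i)) (q i)) (pd-+ d hp hq)

  pd-* : ∀ d c {p : ℕ → ℚ} → PolyDeg d p → PolyDeg d (λ i → c * p i)
  pd-* zero    c hp i = cong (c *_) (hp i)
  pd-* (suc d) c {p} hp = pd-cong d
    (λ i → solve 3 (λ c a b → c :* (a :- b) := c :* a :- c :* b) refl c (p (suc i)) (p i)) (pd-* d c hp)

  pd-const : ∀ d c → PolyDeg d (λ _ → c)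
  pd-const zero    c i = refl
  pd-const (suc d) c = pd-cong d (λ _ → sym (+-inverseʳ c)) (pd-const d 0ℚ)

  pd-suc : ∀ d {p : ℕ → ℚ} → PolyDeg d p → PolyDeg (suc d) p
  pd-suc zero    {p} h i = trans (cong₂ _-_ (h (suc i)) (h i)) (sym (cong (_- p 0) (h 1)))
  pd-suc (suc d) h = pd-suc d h

  -- The product rule Δ((a + b i) p) = (a + b + b i) Δp + b p reduces the degree of p.
  pd-affine : ∀ d a b {p : ℕ → ℚ} → PolyDeg d p → PolyDeg (suc d) (λ i → (a + b * ι i) * p i)
  pd-affine zero    a b {p} h i = trans (ex i) (sym (ex 0))
    where
    ex : ∀ i → (a + b * ι (suc i)) * p (suc i) - (a + b * ι i) * p i ≡ b * p 0
    ex i = trans (cong₂ (λ x y → (a + b * ι (suc i)) * x - (a + b * ι i) * y) (h (suc i)) (h i))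
      (solve 4 (λ a b i p → (a :+ b :* (con 1ℚ :+ i)) :* p :- (a :+ b :* i) :* p := b :* p) refl a b (ι i) (p 0))
  pd-affine (suc d) a b {p} h = pd-cong (suc d)
    (λ i → solve 5 (λ a b i p q → (a :+ b :+ b :* i) :* (p :- q) :+ b :* q
        := (a :+ b :* (con 1ℚ :+ i)) :* p :- (a :+ b :* i) :* q) refl a b (ι i) (p (suc i)) (p i))
    (pd-+ (suc d) {λ i → (a + b + b * ι i) * Δ p i} {λ i → b * p i}
      (pd-affine d (a + b) b h) (pd-* (suc d) b {p} h))

  bin : ℕ → ℕ → ℕ
  bin n       zero    = 1
  bin zero    (suc k) = 0
  bin (suc n) (suc k) = bin n k ℕ.+ bin n (suc k)

  bin-> : ∀ {n k} → n ℕ.< k → bin n k ≡ 0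
  bin-> {zero}  (ℕ.s≤s _) = refl
  bin-> {suc n} (ℕ.s≤s p) = cong₂ ℕ._+_ (bin-> p) (bin-> (ℕ.m<n⇒m<1+n p))

  -- (k+1) C(n,k+1) = (n-k) C(n,k), free of subtraction. It makes a row rise before its middle and
  -- fall after it.
  bin-ratio : ∀ n k → suc k ℕ.* bin n (suc k) ℕ.+ k ℕ.* bin n k ≡ n ℕ.* bin n k
  bin-ratio zero    zero    = refl
  bin-ratio zero    (suc k) = cong₂ ℕ._+_ (ℕ.*-zeroʳ k) (ℕ.*-zeroʳ k)
  bin-ratio (suc n) zero    = trans (cong (λ x → x ℕ.+ 0 ℕ.+ 0) refl)
    (trans (solveℕ 1 (λ b → conℕ 1 ⊕ b ⊕ conℕ 0 ⊕ conℕ 0 ⊜ conℕ 1 ⊕ (b ⊕ conℕ 0 ⊕ conℕ 0)) refl (bin n 1))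
      (cong suc (bin-ratio n zero)))
  bin-ratio (suc n) (suc j) = begin
    (2 ℕ.+ j) ℕ.* (b₁ ℕ.+ b₂) ℕ.+ (1 ℕ.+ j) ℕ.* (b₀ ℕ.+ b₁)
      ≡⟨ solveℕ 4 (λ j b₀ b₁ b₂ → (conℕ 2 ⊕ j) ⊗ (b₁ ⊕ b₂) ⊕ (conℕ 1 ⊕ j) ⊗ (b₀ ⊕ b₁)
          ⊜ ((conℕ 2 ⊕ j) ⊗ b₂ ⊕ (conℕ 1 ⊕ j) ⊗ b₁) ⊕ ((conℕ 1 ⊕ j) ⊗ b₁ ⊕ j ⊗ b₀) ⊕ b₁ ⊕ b₀)
          refl j b₀ b₁ b₂ ⟩
    ((2 ℕ.+ j) ℕ.* b₂ ℕ.+ (1 ℕ.+ j) ℕ.* b₁) ℕ.+ ((1 ℕ.+ j) ℕ.* b₁ ℕ.+ j ℕ.* b₀) ℕ.+ b₁ ℕ.+ b₀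
      ≡⟨ cong₂ (λ x y → x ℕ.+ y ℕ.+ b₁ ℕ.+ b₀) (bin-ratio n (suc j)) (bin-ratio n j) ⟩
    n ℕ.* b₁ ℕ.+ n ℕ.* b₀ ℕ.+ b₁ ℕ.+ b₀
      ≡⟨ solveℕ 3 (λ n b₀ b₁ → n ⊗ b₁ ⊕ n ⊗ b₀ ⊕ b₁ ⊕ b₀ ⊜ (conℕ 1 ⊕ n) ⊗ (b₀ ⊕ b₁)) refl n b₀ b₁ ⟩
    suc n ℕ.* (b₀ ℕ.+ b₁) ∎
    where
    open ≡-Reasoning
    b₀ = bin n j
    b₁ = bin n (suc j)
    b₂ = bin n (suc (suc j))

  bin-up : ∀ n k → suc (k ℕ.+ k) ℕ.≤ n → bin n k ℕ.≤ bin n (suc k)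
  bin-up n k h = ℕ.*-cancelˡ-≤ (suc k) (ℕ.+-cancelʳ-≤ (k ℕ.* bin n k) _ _ (begin
    suc k ℕ.* bin n k ℕ.+ k ℕ.* bin n k ≡⟨ ℕ.*-distribʳ-+ (bin n k) (suc k) k ⟨
    suc (k ℕ.+ k) ℕ.* bin n k           ≤⟨ ℕ.*-monoˡ-≤ (bin n k) h ⟩
    n ℕ.* bin n k                       ≡⟨ bin-ratio n k ⟨
    suc k ℕ.* bin n (suc k) ℕ.+ k ℕ.* bin n k ∎))
    where open ℕ.≤-Reasoning

  bin-down : ∀ n k → n ℕ.≤ suc (k ℕ.+ k) → bin n (suc k) ℕ.≤ bin n k
  bin-down n k h = ℕ.*-cancelˡ-≤ (suc k) (ℕ.+-cancelʳ-≤ (k ℕ.* bin n k) _ _ (begin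
    suc k ℕ.* bin n (suc k) ℕ.+ k ℕ.* bin n k ≡⟨ bin-ratio n k ⟩
    n ℕ.* bin n k                       ≤⟨ ℕ.*-monoˡ-≤ (bin n k) h ⟩
    suc (k ℕ.+ k) ℕ.* bin n k           ≡⟨ ℕ.*-distribʳ-+ (bin n k) (suc k) k ⟩
    suc k ℕ.* bin n k ℕ.+ k ℕ.* bin n k ∎))
    where open ℕ.≤-Reasoning

  bin-≤-mid : ∀ K d i → i ℕ.+ d ≡ K → bin (K ℕ.+ K) i ℕ.≤ bin (K ℕ.+ K) K
  bin-≤-mid K zero    i eq rewrite sym eq | ℕ.+-identityʳ i = ℕ.≤-refl
  bin-≤-mid K (suc d) i eq = ℕ.≤-trans
    (bin-up (K ℕ.+ K) i (ℕ.≤-trans (ℕ.+-monoˡ-≤ i i<K) (ℕ.+-monoʳ-≤ K (ℕ.<⇒≤ i<K))))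
    (bin-≤-mid K d (suc i) (trans (sym (ℕ.+-suc i d)) eq))
    where
    i<K : i ℕ.< K
    i<K = subst (i ℕ.<_) eq (subst (i ℕ.<_) (sym (ℕ.+-suc i d)) (ℕ.s≤s (ℕ.m≤m+n i d)))

  bin-mid-≥ : ∀ K d → bin (K ℕ.+ K) (d ℕ.+ K) ℕ.≤ bin (K ℕ.+ K) K
  bin-mid-≥ K zero    = ℕ.≤-refl
  bin-mid-≥ K (suc d) = ℕ.≤-trans
    (bin-down (K ℕ.+ K) (d ℕ.+ K) (ℕ.m≤n⇒m≤1+n (ℕ.+-mono-≤ (ℕ.m≤n+m K d) (ℕ.m≤n+m K d))))
    (bin-mid-≥ K d)

  bin-central : ∀ K i → bin (K ℕ.+ K) i ℕ.≤ bin (K ℕ.+ K) K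
  bin-central K i with ℕ.≤-total i K
  ... | inj₁ i≤K = bin-≤-mid K (K ℕ.∸ i) i (ℕ.m+[n∸m]≡n i≤K)
  ... | inj₂ K≤i = subst (λ x → bin (K ℕ.+ K) x ℕ.≤ bin (K ℕ.+ K) K) (ℕ.m∸n+n≡m K≤i)
    (bin-mid-≥ K (i ℕ.∸ K))

  bin-pos : ∀ {n k} → k ℕ.≤ n → 1 ℕ.≤ bin n k
  bin-pos {n}     {zero}  p = ℕ.≤-refl
  bin-pos {suc n} {suc k} (ℕ.s≤s p) = ℕ.≤-trans (bin-pos p) (ℕ.m≤m+n _ _)

  sg : ℕ → ℚ
  sg n = (- 1ℚ) ^^ n

  ∣sg∣ : ∀ n → ∣ sg n ∣ ≡ 1ℚ
  ∣sg∣ zero    = refl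
  ∣sg∣ (suc n) = trans (∣p*q∣≡∣p∣*∣q∣ (- 1ℚ) (sg n)) (trans (cong (1ℚ *_) (∣sg∣ n)) (*-identityˡ 1ℚ))

  sg-double : ∀ n → sg (n ℕ.+ n) ≡ 1ℚ
  sg-double n = trans (^^-+ (- 1ℚ) n n) (go n)
    where
    go : ∀ n → sg n * sg n ≡ 1ℚ
    go zero    = refl
    go (suc n) = trans (solve 1 (λ x → (:- con 1ℚ :* x) :* (:- con 1ℚ :* x) := x :* x) refl (sg n)) (go n)

  -- Up to sign the n-th finite difference of q at 0, as soon as n < N.
  alt : ℕ → ℕ → (ℕ → ℚ) → ℚ
  alt N n q = Σ< N (λ i → sg i * ι (bin n i) * q i)

  alt-pascal : ∀ N n q → alt (suc N) (suc n) q ≡ alt (suc N) n q - alt N n (λ i → q (suc i))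
  alt-pascal zero    n q = solve 1 (λ x → con 1ℚ :* (con 1ℚ :+ con 0ℚ) :* x :+ con 0ℚ
    := con 1ℚ :* (con 1ℚ :+ con 0ℚ) :* x :+ con 0ℚ :- con 0ℚ) refl (q 0)
  alt-pascal (suc N) n q = trans (cong₂ (λ x y → - 1ℚ * s * x * p + y) (ι-+ (bin n N) (bin n (suc N))) (alt-pascal N n q))
    (solve 6 (λ s a b p m k → :- con 1ℚ :* s :* (a :+ b) :* p :+ (m :- k)
       := (:- con 1ℚ :* s :* b :* p :+ m) :- (s :* a :* p :+ k)) refl
       s (ι (bin n N)) (ι (bin n (suc N))) p (alt (suc N) n q) (alt N n (λ i → q (suc i))))
    where
    s = sg N
    p = q (suc N)

  alt-extra : ∀ {N n} q → n ℕ.< N → alt (suc N) n q ≡ alt N n q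
  alt-extra {N} {n} q lt = trans (cong (λ b → sg N * ι b * q N + alt N n q) (bin-> lt))
    (solve 3 (λ s x m → s :* con 0ℚ :* x :+ m := m) refl (sg N) (q N) (alt N n q))

  -- By Pascal's rule, going down one row of the triangle amounts to one difference of q; n < N
  -- guarantees that the cut-off at N loses no term.
  alt-Δ : ∀ {N n} q → n ℕ.< N → alt (suc N) (suc n) q ≡ - alt N n (Δ q)
  alt-Δ {N} {n} q lt = trans (alt-pascal N n q) (trans (cong (_- alt N n (λ i → q (suc i))) (alt-extra q lt))
    (trans (solve 2 (λ a b → a :- b := :- con 1ℚ :* b :+ a) refl (alt N n q) (alt N n (λ i → q (suc i))))
    (trans (cong (_+ alt N n q) (sym (Σ<-* N (- 1ℚ) _)))
    (trans (sym (Σ<-+ N _ _))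
    (trans (Σ<-cong N (λ i → solve 4 (λ s b x y → :- con 1ℚ :* (s :* b :* x) :+ s :* b :* y
        := :- con 1ℚ :* (s :* b :* (x :- y))) refl (sg i) (ι (bin n i)) (q (suc i)) (q i)))
    (trans (Σ<-* N (- 1ℚ) _)
    (solve 1 (λ x → :- con 1ℚ :* x := :- x) refl (alt N n (Δ q)))))))))

  alt-zero : ∀ {d n} N {q} → d ℕ.< n → n ℕ.< N → PolyDeg d q → alt N n q ≡ 0ℚ
  alt-zero {zero} {suc n} (suc N) {q} lt (ℕ.s≤s lt′) h = trans (alt-Δ q lt′)
    (cong -_ (trans (Σ<-cong N (λ i → trans (cong (sg i * ι (bin n i) *_)
      (trans (cong (_- q i) (trans (h (suc i)) (sym (h i)))) (+-inverseʳ (q i))))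
      (trans (*-zeroʳ (sg i * ι (bin n i))) (sym (*-zeroˡ 0ℚ)))))
      (trans (Σ<-* N 0ℚ (λ _ → 0ℚ)) (*-zeroˡ (Σ< N (λ _ → 0ℚ))))))
  alt-zero {suc d} {suc n} (suc N) {q} (ℕ.s≤s lt) (ℕ.s≤s lt′) h =
    trans (alt-Δ q lt′) (cong -_ (alt-zero N lt lt′ h))

  -- The pair of measures for OR, on multiplicities.

  rate : Space
  rate .Space.Pt = ℕ
  -- Here the degree is algebraic: the only test of degree e is the monomial s^e.
  rate .Space.Tst _ = ⊤
  rate .Space.ev {e} _ s = ι s ^^ e

  pos? : ℕ → Bool
  pos? zero    = false
  pos? (suc _) = true

  -- 1/8, the reciprocal of the bound `mass≤8`, so that `rest` is nonnegative.
  η : ℚ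
  η = ½ * (½ * ½)

  0≤η : 0ℚ ≤ η
  0≤η = nonNegative⁻¹ η

  -- Squares of even numbers: a polynomial of degree e in the node has degree 2e in j, the nodes
  -- avoid 1 and 2, and 4j² - 1 = (2j-1)(2j+1) makes the reciprocals telescope.
  node : ℕ → ℕ
  node j = 4 ℕ.* (j ℕ.* j)

  -- 1 / (4j² - 1) and 1 / (4j² - 2)
  recip₁ : ℕ → ℚ
  recip₁ zero    = - 1ℚ
  recip₁ (suc j) = inv (suc (j ℕ.+ j)) * inv (3 ℕ.+ (j ℕ.+ j))

  recip₂ : ℕ → ℚ
  recip₂ zero    = - ½
  recip₂ (suc j) = inv (2 ℕ.+ (4 ℕ.* (j ℕ.* j) ℕ.+ 8 ℕ.* j))

  recip₁-inv : ∀ j → (ι (node j) - 1ℚ) * recip₁ j ≡ 1ℚ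
  recip₁-inv zero    = refl
  recip₁-inv (suc j) = trans (cong (λ u → (u - 1ℚ) * (x * y)) (trans (cong ι eU) (trans (ι-+ 1 (a ℕ.* b))
      (cong₂ _+_ (+-identityʳ 1ℚ) (ι-* a b)))))
    (trans (solve 4 (λ a b x y → (con 1ℚ :+ a :* b :- con 1ℚ) :* (x :* y) := (a :* x) :* (b :* y)) refl (ι a) (ι b) x y)
    (trans (cong₂ _*_ (ι*inv a) (ι*inv b)) refl))
    where
    a = suc (j ℕ.+ j)
    b = 3 ℕ.+ (j ℕ.+ j)
    x = inv a
    y = inv b
    eU : node (suc j) ≡ 1 ℕ.+ a ℕ.* b
    eU = solveℕ 1 (λ j → conℕ 4 ⊗ ((conℕ 1 ⊕ j) ⊗ (conℕ 1 ⊕ j))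
      ⊜ conℕ 1 ⊕ (conℕ 1 ⊕ (j ⊕ j)) ⊗ (conℕ 3 ⊕ (j ⊕ j))) refl j

  recip₂-inv : ∀ j → (ι (node j) - ι 2) * recip₂ j ≡ 1ℚ
  recip₂-inv zero    = refl
  recip₂-inv (suc j) = trans (cong (λ u → (u - ι 2) * inv b) (trans (cong ι eU) (ι-+ 2 b)))
    (trans (cong (_* inv b) (solve 2 (λ c b → c :+ b :- c := b) refl (ι 2) (ι b))) (ι*inv b))
    where
    b = 2 ℕ.+ (4 ℕ.* (j ℕ.* j) ℕ.+ 8 ℕ.* j)
    eU : node (suc j) ≡ 2 ℕ.+ b
    eU = solveℕ 1 (λ j → conℕ 4 ⊗ ((conℕ 1 ⊕ j) ⊗ (conℕ 1 ⊕ j))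
      ⊜ conℕ 2 ⊕ (conℕ 2 ⊕ (conℕ 4 ⊗ (j ⊗ j) ⊕ conℕ 8 ⊗ j))) refl j

  -- 1 / (2 (2j+1)), the sum of 1 / (4i² - 1) over all i > j.
  tele : ℕ → ℚ
  tele j = ½ * inv (suc (j ℕ.+ j))

  0≤tele : ∀ j → 0ℚ ≤ tele j
  0≤tele j = 0≤* 0≤½ (0≤inv (suc (j ℕ.+ j)))

  recip₁-telescope : ∀ j → ∣ recip₁ (suc j) ∣ + tele (suc j) ≡ tele j
  recip₁-telescope j = trans (cong₂ _+_ (0≤p⇒∣p∣≡p (0≤* (0≤inv a) (0≤inv b))) (cong (λ k → ½ * inv (suc (suc k))) (ℕ.+-suc j j)))
    (trans (cong₂ _+_ (solve 2 (λ x y → x :* y := con ½ :* (con 1ℚ :* x :* y :+ con 1ℚ :* y :* x)) refl x y)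
       (cong (½ *_) (sym (*-identityˡ y))))
    (trans (cong (λ p → ½ * (1ℚ * x * y + 1ℚ * y * x) + ½ * (p * y)) (sym (ι*inv a)))
    (trans (solve 3 (λ a x y → con ½ :* (con 1ℚ :* x :* y :+ con 1ℚ :* y :* x) :+ con ½ :* (a :* x :* y)
         := con ½ :* (((con 1ℚ :+ (con 1ℚ :+ a)) :* y) :* x)) refl (ι a) x y)
    (trans (cong (λ p → ½ * (p * x)) (ι*inv b)) (cong (½ *_) (*-identityˡ x))))))
    where
    a = suc (j ℕ.+ j)
    b = 3 ℕ.+ (j ℕ.+ j)
    x = inv a
    y = inv b

  0≤recip₂ : ∀ j → 0ℚ ≤ recip₂ (suc j)
  0≤recip₂ j = 0≤inv (2 ℕ.+ (4 ℕ.* (j ℕ.* j) ℕ.+ 8 ℕ.* j))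

  inv≤1 : ∀ n → inv (suc n) ≤ 1ℚ
  inv≤1 n = ≤-trans (subst (_≤ ι (suc n) * inv (suc n)) (*-identityˡ _) (*-monoʳ (0≤inv (suc n)) (1≤ι n)))
    (≤-reflexive (ι*inv (suc n)))

  ∣recip₂∣≤1 : ∀ j → ∣ recip₂ j ∣ ≤ 1ℚ
  ∣recip₂∣≤1 zero    = toWitness {a? = ½ ≤? 1ℚ} _
  ∣recip₂∣≤1 (suc j) = subst (_≤ 1ℚ) (sym (0≤p⇒∣p∣≡p (0≤recip₂ j))) (inv≤1 (1 ℕ.+ (4 ℕ.* (j ℕ.* j) ℕ.+ 8 ℕ.* j)))

  -- For u the node, a = `recip₁ j` and b = `recip₂ j`, the equations (u-1) a = 1 = (u-2) b give b =
  -- (1 + b) a, and b is at most 1 in absolute value.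
  ∣recip₂∣≤2∣recip₁∣ : ∀ j → ∣ recip₂ j ∣ ≤ ι 2 * ∣ recip₁ j ∣
  ∣recip₂∣≤2∣recip₁∣ j = begin
    ∣ recip₂ j ∣ ≡⟨ cong ∣_∣ eq ⟩
    ∣ (1ℚ + recip₂ j) * recip₁ j ∣ ≡⟨ ∣p*q∣≡∣p∣*∣q∣ (1ℚ + recip₂ j) (recip₁ j) ⟩
    ∣ 1ℚ + recip₂ j ∣ * ∣ recip₁ j ∣
      ≤⟨ *-monoʳ (0≤∣p∣ (recip₁ j)) (≤-trans (∣p+q∣≤∣p∣+∣q∣ 1ℚ (recip₂ j)) (+-monoʳ-≤ 1ℚ (∣recip₂∣≤1 j))) ⟩
    ι 2 * ∣ recip₁ j ∣ ∎
    where
    open ≤-Reasoning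
    u = ι (node j)
    eq : recip₂ j ≡ (1ℚ + recip₂ j) * recip₁ j
    eq = trans (sym (trans (cong (_* recip₂ j) (recip₁-inv j)) (*-identityˡ (recip₂ j))))
      (trans (solve 3 (λ u a b → (u :- con 1ℚ) :* a :* b := ((u :- con (ι 2)) :* b :+ b) :* a) refl u (recip₁ j) (recip₂ j))
      (cong (λ p → (p + recip₂ j) * recip₁ j) (recip₂-inv j)))

  -- In the same notation u b = 1 + 2b. This estimate keeps the mean bounded although the nodes grow
  -- like K².
  node∣recip₁₂∣≤3∣recip₁∣ : ∀ j → ι (node j) * ∣ recip₁ j * recip₂ j ∣ ≤ ι 3 * ∣ recip₁ j ∣
  node∣recip₁₂∣≤3∣recip₁∣ j = begin
    u * ∣ recip₁ j * recip₂ j ∣ ≡⟨ cong₂ _*_ (sym (0≤p⇒∣p∣≡p (0≤ι (node j)))) (∣p*q∣≡∣p∣*∣q∣ (recip₁ j) (recip₂ j)) ⟩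
    ∣ u ∣ * (∣ recip₁ j ∣ * ∣ recip₂ j ∣)
      ≡⟨ solve 3 (λ u a b → u :* (a :* b) := u :* b :* a) refl (∣ u ∣) (∣ recip₁ j ∣) (∣ recip₂ j ∣) ⟩
    ∣ u ∣ * ∣ recip₂ j ∣ * ∣ recip₁ j ∣
      ≡⟨ cong (_* ∣ recip₁ j ∣) (trans (sym (∣p*q∣≡∣p∣*∣q∣ u (recip₂ j))) (cong ∣_∣ eq)) ⟩
    ∣ 1ℚ + ι 2 * recip₂ j ∣ * ∣ recip₁ j ∣ ≤⟨ *-monoʳ (0≤∣p∣ (recip₁ j)) (≤-trans (∣p+q∣≤∣p∣+∣q∣ 1ℚ (ι 2 * recip₂ j))
       (+-monoʳ-≤ 1ℚ (≤-trans (≤-reflexive (∣p*q∣≡∣p∣*∣q∣ (ι 2) (recip₂ j))) (*-monoˡ (0≤ι 2) (∣recip₂∣≤1 j))))) ⟩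
    (1ℚ + ι 2 * 1ℚ) * ∣ recip₁ j ∣ ∎
    where
    open ≤-Reasoning
    u = ι (node j)
    eq : u * recip₂ j ≡ 1ℚ + ι 2 * recip₂ j
    eq = trans (solve 2 (λ u b → u :* b := (u :- con (ι 2)) :* b :+ con (ι 2) :* b) refl u (recip₂ j))
      (cong (_+ ι 2 * recip₂ j) (recip₂-inv j))

  table : ℕ → (ℕ → ℚ) → (ℕ → ℕ) → Meas ℕ
  table zero    w v = []
  table (suc n) w v = (w n , v n) ∷ table n w v

  ∫-table : ∀ n w v (g : ℕ → ℚ) → ∫ (table n w v) g ≡ Σ< n (λ i → w i * g (v i))
  ∫-table zero    w v g = refl
  ∫-table (suc n) w v g = cong (w n * g (v n) +_) (∫-table n w v g)

  abs-table : ∀ n w v → abs (table n w v) ≡ table n (∣_∣ ∘ w) v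
  abs-table zero    w v = refl
  abs-table (suc n) w v = cong ((∣ w n ∣ , v n) ∷_) (abs-table n w v)

  table-supp : ∀ {P : ℕ → Set} n w v → (∀ i → i ℕ.< n → P (v i)) → Supp P (table n w v)
  table-supp zero    w v h = []
  table-supp (suc n) w v h = h n ℕ.≤-refl ∷ table-supp n w v (λ i lt → h i (ℕ.m<n⇒m<1+n lt))

  E₀ : ℕ → ℚ
  E₀ zero    = 1ℚ
  E₀ (suc _) = 0ℚ

  dist-≤ : ∀ {i K} → i ℕ.< K → Σ ℕ λ d → dist i K ≡ suc d
  dist-≤ {i} {K} lt = K ℕ.∸ suc i , trans (ℕ.m≤n⇒∣m-n∣≡n∸m (ℕ.<⇒≤ lt)) (ℕ.+-∸-assoc 1 {K} {suc i} lt)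

  dist-+ : ∀ n K → dist (n ℕ.+ K) K ≡ n
  dist-+ n K = trans (ℕ.∣-∣-comm (n ℕ.+ K) K) (trans (cong (dist K) (ℕ.+-comm n K)) (ℕ.∣m-m+n∣≡n K n))

  Σ-E₀-low : ∀ K m (c : ℕ → ℚ) → m ℕ.≤ K → Σ< m (λ i → E₀ (dist i K) * c i) ≡ 0ℚ
  Σ-E₀-low K zero    c le = refl
  Σ-E₀-low K (suc m) c le = trans (cong₂ _+_ (trans (cong (λ x → E₀ x * c m) (proj₂ (dist-≤ le))) (*-zeroˡ (c m)))
    (Σ-E₀-low K m c (ℕ.<⇒≤ le))) refl

  Σ-E₀ : ∀ K n (c : ℕ → ℚ) → Σ< (suc n ℕ.+ K) (λ i → E₀ (dist i K) * c i) ≡ c K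
  Σ-E₀ K zero c = trans (cong₂ (λ x y → E₀ x * c K + y) (ℕ.∣n-n∣≡0 K) (Σ-E₀-low K K c ℕ.≤-refl))
    (solve 1 (λ x → con 1ℚ :* x :+ con 0ℚ := x) refl (c K))
  Σ-E₀ K (suc n) c = trans (cong₂ (λ x y → E₀ x * c (suc n ℕ.+ K) + y) (dist-+ (suc n) K) (Σ-E₀ K n c))
    (solve 2 (λ x y → con 0ℚ :* x :+ y := y) refl (c (suc n ℕ.+ K)) (c K))

  Σ∣recip₁∣-low : ∀ K n m → m ℕ.+ n ≡ K → Σ< n (λ i → ∣ recip₁ (dist i K) ∣) ≤ tele m
  Σ∣recip₁∣-low K zero    m eq = 0≤tele m
  Σ∣recip₁∣-low K (suc n) m refl = begin
    ∣ recip₁ (dist n (m ℕ.+ suc n)) ∣ + Σ< n _ ≤⟨ +-mono-≤ (≤-reflexive (cong (λ x → ∣ recip₁ x ∣)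
       (trans (cong (λ x → dist n x) (ℕ.+-suc m n)) (trans (ℕ.∣-∣-comm n (suc m ℕ.+ n)) (dist-+ (suc m) n)))))
       (Σ∣recip₁∣-low K n (suc m) (sym (ℕ.+-suc m n))) ⟩
    ∣ recip₁ (suc m) ∣ + tele (suc m) ≡⟨ recip₁-telescope m ⟩
    tele m ∎
    where open ≤-Reasoning

  Σ∣recip₁∣-high : ∀ K n → Σ< (suc n ℕ.+ K) (λ i → ∣ recip₁ (dist i K) ∣) + tele n ≤ ι 2
  Σ∣recip₁∣-high K zero = begin
    ∣ recip₁ (dist K K) ∣ + Σ< K _ + tele 0
      ≤⟨ +-monoˡ-≤ (tele 0) (+-mono-≤ (≤-reflexive (cong (λ x → ∣ recip₁ x ∣) (ℕ.∣n-n∣≡0 K)))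
      (Σ∣recip₁∣-low K K 0 refl)) ⟩
    1ℚ + tele 0 + tele 0 ≡⟨⟩
    ι 2 ∎
    where open ≤-Reasoning
  Σ∣recip₁∣-high K (suc n) = begin
    ∣ recip₁ (dist (suc n ℕ.+ K) K) ∣ + S + tele (suc n)
      ≡⟨ cong (λ x → ∣ recip₁ x ∣ + S + tele (suc n)) (dist-+ (suc n) K) ⟩
    ∣ recip₁ (suc n) ∣ + S + tele (suc n)
      ≡⟨ solve 3 (λ a b c → a :+ b :+ c := b :+ (a :+ c)) refl (∣ recip₁ (suc n) ∣) S (tele (suc n)) ⟩
    S + (∣ recip₁ (suc n) ∣ + tele (suc n)) ≡⟨ cong (S +_) (recip₁-telescope n) ⟩
    S + tele n ≤⟨ Σ∣recip₁∣-high K n ⟩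
    ι 2 ∎
    where
    open ≤-Reasoning
    S = Σ< (suc n ℕ.+ K) (λ i → ∣ recip₁ (dist i K) ∣)

  -- The centre i = K contributes 1, and each side at most `tele 0` = 1/2.
  Σ∣recip₁∣ : ∀ K n → Σ< (suc n ℕ.+ K) (λ i → ∣ recip₁ (dist i K) ∣) ≤ ι 2
  Σ∣recip₁∣ K n = ≤-trans (p≤p+q (0≤tele n)) (Σ∣recip₁∣-high K n)

  ι-dist² : ∀ i K → ι (dist i K ℕ.* dist i K) ≡ (ι i - ι K) * (ι i - ι K)
  ι-dist² i K with ℕ.≤-total i K
  ... | inj₁ i≤K = trans (cong (λ x → ι (x ℕ.* x)) (ℕ.m≤n⇒∣m-n∣≡n∸m i≤K)) (trans (ι-* d d)
        (trans (solve 2 (λ d i → d :* d := (i :- (d :+ i)) :* (i :- (d :+ i))) refl (ι d) (ι i))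
          (cong (λ x → (ι i - x) * (ι i - x)) (trans (sym (ι-+ d i)) (cong ι (ℕ.m∸n+n≡m i≤K))))))
    where d = K ℕ.∸ i
  ... | inj₂ K≤i = trans (cong (λ x → ι (x ℕ.* x)) (trans (ℕ.∣-∣-comm i K) (ℕ.m≤n⇒∣m-n∣≡n∸m K≤i))) (trans (ι-* d d)
        (trans (solve 2 (λ d i → d :* d := ((d :+ i) :- i) :* ((d :+ i) :- i)) refl (ι d) (ι K))
          (cong (λ x → (x - ι K) * (x - ι K)) (trans (sym (ι-+ d K)) (cong ι (ℕ.m∸n+n≡m K≤i))))))
    where d = i ℕ.∸ K

  -- Two signed measures on ℕ that agree on polynomials of degree below K, live on 0, …, 4K² and have
  -- bounded mean; their difference is η times
  --   Σ_j (-1)^j C(2K,K+j)/C(2K,K) · δ(4j²) / ((4j²-1)(4j²-2)),   -K ≤ j ≤ K,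
  -- corrected at the nodes 1 and 2 so that (s-1)(s-2) may be divided out of the test polynomial.
  module OrGadget (K : ℕ) .{{_ : ℕ.NonZero K}} (N : ℕ) (N≡ : N ≡ suc K ℕ.+ K) where

    j : ℕ → ℕ
    j i = dist i K

    mid : ℕ
    mid = bin (K ℕ.+ K) K

    instance
      mid-nz : ℕ.NonZero mid
      mid-nz = ℕ.>-nonZero (bin-pos (ℕ.m≤m+n K K))

    -- (-1)^(i+K) C(2K,i) / C(2K,K), where the index i stands for j = i - K. The normalisation by
    -- the largest coefficient bounds every weight by 1 and makes the central one 1.
    sc : ℕ → ℚ
    sc i = sg K * inv mid * (sg i * ι (bin (K ℕ.+ K) i))

    ∣sc∣≤1 : ∀ i → ∣ sc i ∣ ≤ 1ℚ
    ∣sc∣≤1 i = begin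
      ∣ sg K * inv mid * (sg i * ι b) ∣
        ≡⟨ trans (∣p*q∣≡∣p∣*∣q∣ (sg K * inv mid) (sg i * ι b)) (cong₂ _*_ (∣p*q∣≡∣p∣*∣q∣ (sg K) (inv mid)) (∣p*q∣≡∣p∣*∣q∣ (sg i) (ι b))) ⟩
      ∣ sg K ∣ * ∣ inv mid ∣ * (∣ sg i ∣ * ∣ ι b ∣)
        ≡⟨ cong₂ _*_ (cong₂ _*_ (∣sg∣ K) (0≤p⇒∣p∣≡p (0≤inv mid))) (cong₂ _*_ (∣sg∣ i) (0≤p⇒∣p∣≡p (0≤ι b))) ⟩
      1ℚ * inv mid * (1ℚ * ι b)
        ≡⟨ solve 2 (λ x b → con 1ℚ :* x :* (con 1ℚ :* b) := b :* x) refl (inv mid) (ι b) ⟩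
      ι b * inv mid ≤⟨ inv-≤ mid (≤-trans (ι-mono (bin-central K i)) (≤-reflexive (sym (*-identityʳ (ι mid))))) ⟩
      1ℚ ∎
      where
      open ≤-Reasoning
      b = bin (K ℕ.+ K) i

    sc-mid : sc K ≡ 1ℚ
    sc-mid = trans (solve 3 (λ s x b → s :* x :* (s :* b) := s :* s :* (b :* x)) refl (sg K) (inv mid) (ι mid))
      (trans (cong₂ _*_ (trans (sym (^^-+ (- 1ℚ) K K)) (sg-double K)) (ι*inv mid)) refl)

    u : ℕ → ℚ
    u i = ι (node (j i))

    -- The quotient of x^e by (x-1)(x-2); the remainder in `q-spec` is the linear interpolant of x^e
    -- at the nodes 1 and 2.
    q : ℕ → ℚ → ℚ
    q zero    x = 0ℚ
    q (suc e) x = x * q e x + (ι 2 ^^ e - 1ℚ)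

    q-spec : ∀ e x → x ^^ e ≡ (x - 1ℚ) * (x - ι 2) * q e x + (ι 2 - x) + (x - 1ℚ) * ι 2 ^^ e
    q-spec zero    x = solve 1 (λ x → con 1ℚ := (x :- con 1ℚ) :* (x :- con (ι 2)) :* con 0ℚ :+ (con (ι 2) :- x)
      :+ (x :- con 1ℚ) :* con 1ℚ) refl x
    q-spec (suc e) x = trans (cong (x *_) (q-spec e x))
      (solve 3 (λ x q t → x :* ((x :- con 1ℚ) :* (x :- con (ι 2)) :* q :+ (con (ι 2) :- x) :+ (x :- con 1ℚ) :* t)
         := (x :- con 1ℚ) :* (x :- con (ι 2)) :* (x :* q :+ (t :- con 1ℚ)) :+ (con (ι 2) :- x)
            :+ (x :- con 1ℚ) :* (con (ι 2) :* t)) refl x (q e x) (ι 2 ^^ e))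

    u-sq : ∀ i → u i ≡ (- (ι 2 * ι K) + ι 2 * ι i) * (- (ι 2 * ι K) + ι 2 * ι i)
    u-sq i = trans (ι-* 4 (j i ℕ.* j i)) (trans (cong (ι 4 *_) (ι-dist² i K))
      (solve 2 (λ i k → con (ι 4) :* ((i :- k) :* (i :- k))
        := (:- (con (ι 2) :* k) :+ con (ι 2) :* i) :* (:- (con (ι 2) :* k) :+ con (ι 2) :* i)) refl (ι i) (ι K)))

    q-deg : ∀ e → PolyDeg (e ℕ.+ e) (λ i → q e (u i))
    q-deg zero    = λ _ → refl
    q-deg (suc e) = subst (λ d → PolyDeg (suc d) (λ i → q (suc e) (u i))) (sym (ℕ.+-suc e e))
      (pd-+ (2 ℕ.+ (e ℕ.+ e)) {λ i → u i * q e (u i)} {λ _ → ι 2 ^^ e - 1ℚ}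
        (pd-cong (2 ℕ.+ (e ℕ.+ e)) {λ i → ℓ i * (ℓ i * q e (u i))} {λ i → u i * q e (u i)}
          (λ i → trans (sym (*-assoc (ℓ i) (ℓ i) _)) (cong (_* q e (u i)) (sym (u-sq i))))
          (pd-affine (suc (e ℕ.+ e)) (- (ι 2 * ι K)) (ι 2) {λ i → ℓ i * q e (u i)}
            (pd-affine (e ℕ.+ e) (- (ι 2 * ι K)) (ι 2) {λ i → q e (u i)} (q-deg e))))
        (pd-const (2 ℕ.+ (e ℕ.+ e)) (ι 2 ^^ e - 1ℚ)))
      where
      ℓ : ℕ → ℚ
      ℓ i = - (ι 2 * ι K) + ι 2 * ι i

    -- As a function of i the quotient has degree at most 2e < 2K, and summation against `sc` is a
    -- multiple of the 2K-th difference.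
    q-annihilated : ∀ {e} → e ℕ.< K → Σ< N (λ i → sc i * q e (u i)) ≡ 0ℚ
    q-annihilated {e} e<K = trans (Σ<-cong N (λ i → *-assoc c (sg i * ι (bin (K ℕ.+ K) i)) (q e (u i))))
      (trans (Σ<-* N c _) (trans (cong (c *_) (alt-zero N (ℕ.+-mono-< e<K e<K) (ℕ.≤-reflexive (sym N≡)) (q-deg e))) (*-zeroʳ c)))
      where c = sg K * inv mid

    -- The remainder contributes -α 1^e - β 2^e to the sum over the nodes; masses α at 1 and β at 2
    -- cancel it.
    α β : ℚ
    α = Σ< N (λ i → sc i * recip₁ (j i))
    β = - Σ< N (λ i → sc i * recip₂ (j i))

    W : ℕ → ℚ
    W zero    = 0ℚ
    W (suc d) = recip₁ (suc d) * recip₂ (suc d)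

    -- The weight at 0 is split off, so its slot in the table gets weight 0 and the dummy node 1.
    V : ℕ → ℕ
    V zero    = 1
    V (suc d) = node (suc d)

    τ : Meas ℕ
    τ = (α , 1) ∷ (β , 2) ∷ table N (λ i → sc i * W (j i)) (λ i → V (j i))

    -- The weight 1/2 at 0 is the central term: (-1) (-1/2) from the two reciprocals at j = 0. It
    -- becomes the constant mass at 0 of the false measure.
    annihilates : ∀ {e} → e ℕ.< K → ½ * ι 0 ^^ e + ∫ τ (λ s → ι s ^^ e) ≡ 0ℚ
    annihilates {e} e<K = begin
      ½ * g 0 + (α * g 1 + (β * g 2 + ∫ (table N _ _) g))
        ≡⟨ cong₂ (λ x y → ½ * g 0 + (α * x + (β * g 2 + y))) g1 (∫-table N _ _ g) ⟩
      ½ * g 0 + (α * 1ℚ + (β * g 2 + T))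
        ≡⟨ solve 5 (λ z a b y t → z :+ (a :* con 1ℚ :+ (b :* y :+ t)) := (z :+ t) :+ a :+ b :* y) refl (½ * g 0) α β (g 2) T ⟩
      (½ * g 0 + T) + α + β * g 2
        ≡⟨ cong (λ x → x + α + β * g 2) split ⟨
      Σ< N (λ i → sc i * (recip₁ (j i) * recip₂ (j i)) * g (node (j i))) + α + β * g 2
        ≡⟨ cong (λ x → x + α + β * g 2) (trans (Σ<-cong N term)
            (trans (Σ<-+ N _ _) (cong₂ _+_ (trans (Σ<-+ N _ _) (cong₂ _+_ (q-annihilated e<K) (Σ<-* N (- 1ℚ) _))) (Σ<-* N (g 2) _)))) ⟩
      0ℚ + - 1ℚ * α + g 2 * b + α + - b * g 2
        ≡⟨ solve 3 (λ a b y → con 0ℚ :+ :- con 1ℚ :* a :+ y :* b :+ a :+ :- b :* y := con 0ℚ) refl α b (g 2) ⟩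
      0ℚ ∎
      where
      open ≡-Reasoning
      g : ℕ → ℚ
      g s = ι s ^^ e
      T = Σ< N (λ i → sc i * W (j i) * g (V (j i)))
      b = Σ< N (λ i → sc i * recip₂ (j i))
      g1 : g 1 ≡ 1ℚ
      g1 = trans (cong (_^^ e) (+-identityʳ 1ℚ)) (1^^ e)
      split-term : ∀ c d → c * (recip₁ d * recip₂ d) * g (node d) ≡ E₀ d * (c * ½ * g 0) + c * W d * g (V d)
      split-term c zero    = solve 3 (λ c x y → c :* con ½ :* x := con 1ℚ :* (c :* con ½ :* x) :+ c :* con 0ℚ :* y) refl c (g 0) (g 1)
      split-term c (suc d) = solve 3 (λ p x y → p :* x := con 0ℚ :* y :+ p :* x) refl (c * W (suc d)) (g (node (suc d))) (c * ½ * g 0)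
      split : Σ< N (λ i → sc i * (recip₁ (j i) * recip₂ (j i)) * g (node (j i))) ≡ ½ * g 0 + T
      split = trans (Σ<-cong N (λ i → split-term (sc i) (j i))) (trans (Σ<-+ N _ _)
        (cong (_+ T) (trans (trans (cong (λ n → Σ< n (λ i → E₀ (j i) * (sc i * ½ * g 0))) N≡) (Σ-E₀ K K (λ i → sc i * ½ * g 0))) (trans (cong (λ c → c * ½ * g 0) sc-mid)
          (solve 1 (λ x → con 1ℚ :* con ½ :* x := con ½ :* x) refl (g 0))))))
      term : ∀ i → sc i * (recip₁ (j i) * recip₂ (j i)) * g (node (j i))
        ≡ sc i * q e (u i) + - 1ℚ * (sc i * recip₁ (j i)) + g 2 * (sc i * recip₂ (j i))
      term i = trans (cong (sc i * (a * b′) *_) (q-spec e x))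
        (trans (solve 6 (λ c a b x q t → c :* (a :* b) :* ((x :- con 1ℚ) :* (x :- con (ι 2)) :* q :+ (con (ι 2) :- x) :+ (x :- con 1ℚ) :* t)
             := c :* q :* ((x :- con 1ℚ) :* a) :* ((x :- con (ι 2)) :* b) :+ :- con 1ℚ :* (c :* a) :* ((x :- con (ι 2)) :* b)
                :+ t :* (c :* b) :* ((x :- con 1ℚ) :* a)) refl (sc i) a b′ x (q e x) (g 2))
        (trans (cong₂ (λ y z → sc i * q e x * y * z + - 1ℚ * (sc i * a) * z + g 2 * (sc i * b′) * y) (recip₁-inv (j i)) (recip₂-inv (j i)))
          (solve 3 (λ x y z → x :* con 1ℚ :* con 1ℚ :+ y :* con 1ℚ :+ z :* con 1ℚ := x :+ y :+ z) refl
            (sc i * q e x) (- 1ℚ * (sc i * a)) (g 2 * (sc i * b′)))))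
        where
        a = recip₁ (j i)
        b′ = recip₂ (j i)
        x = u i

    Σ-sc≤ : ∀ c (f : ℕ → ℚ) → 0ℚ ≤ c → (∀ d → ∣ f d ∣ ≤ c * ∣ recip₁ d ∣) → Σ< N (λ i → ∣ sc i * f (j i) ∣) ≤ c * ι 2
    Σ-sc≤ c f 0≤c h = ≤-trans (Σ<-mono N (λ i _ → ≤-trans (≤-reflexive (∣p*q∣≡∣p∣*∣q∣ (sc i) (f (j i))))
        (≤-trans (*-monoʳ (0≤∣p∣ (f (j i))) (∣sc∣≤1 i)) (≤-trans (≤-reflexive (*-identityˡ _)) (h (j i))))))
      (≤-trans (≤-reflexive (Σ<-* N c _)) (*-monoˡ 0≤c (subst (λ n → Σ< n (λ i → ∣ recip₁ (j i) ∣) ≤ ι 2) (sym N≡) (Σ∣recip₁∣ K K))))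

    ∣α∣≤2 : ∣ α ∣ ≤ ι 2
    ∣α∣≤2 = ≤-trans (Σ<-abs N _) (≤-trans (Σ-sc≤ 1ℚ recip₁ 0≤1 (λ d → ≤-reflexive (sym (*-identityˡ _)))) ≤-refl)

    ∣β∣≤4 : ∣ β ∣ ≤ ι 4
    ∣β∣≤4 = ≤-trans (≤-reflexive (∣-p∣≡∣p∣ (Σ< N (λ i → sc i * recip₂ (j i)))))
      (≤-trans (Σ<-abs N _) (≤-trans (Σ-sc≤ (ι 2) recip₂ (0≤ι 2) ∣recip₂∣≤2∣recip₁∣) ≤-refl))

    ∣W∣≤∣recip₁∣ : ∀ d → ∣ W d ∣ ≤ ∣ recip₁ d ∣
    ∣W∣≤∣recip₁∣ zero    = 0≤∣p∣ (recip₁ 0)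
    ∣W∣≤∣recip₁∣ (suc d) = ≤-trans (≤-reflexive (∣p*q∣≡∣p∣*∣q∣ (recip₁ (suc d)) (recip₂ (suc d))))
      (≤-trans (*-monoˡ (0≤∣p∣ (recip₁ (suc d))) (∣recip₂∣≤1 (suc d))) (≤-reflexive (*-identityʳ _)))

    mass≤8 : ∫ (abs τ) (λ _ → 1ℚ) ≤ ι 8
    mass≤8 = +-mono-≤ (*-monoʳ 0≤1 ∣α∣≤2) (+-mono-≤ (*-monoʳ 0≤1 ∣β∣≤4) (begin
      ∫ (abs (table N _ _)) (λ _ → 1ℚ) ≡⟨ cong (λ μ → ∫ μ (λ _ → 1ℚ)) (abs-table N _ _) ⟩
      ∫ (table N _ _) (λ _ → 1ℚ)       ≡⟨ ∫-table N _ _ _ ⟩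
      Σ< N (λ i → ∣ sc i * W (j i) ∣ * 1ℚ) ≡⟨ Σ<-cong N (λ i → *-identityʳ _) ⟩
      Σ< N (λ i → ∣ sc i * W (j i) ∣)
        ≤⟨ Σ-sc≤ 1ℚ W 0≤1 (λ d → ≤-trans (∣W∣≤∣recip₁∣ d) (≤-reflexive (sym (*-identityˡ _)))) ⟩
      1ℚ * ι 2 ∎))
      where open ≤-Reasoning

    mean≤16 : ∫ (abs τ) ι ≤ ι 16
    mean≤16 = +-mono-≤ (*-monoʳ (0≤ι 1) ∣α∣≤2) (+-mono-≤ (*-monoʳ (0≤ι 2) ∣β∣≤4) (begin
      ∫ (abs (table N _ _)) ι ≡⟨ cong (λ μ → ∫ μ ι) (abs-table N _ _) ⟩
      ∫ (table N _ _) ι       ≡⟨ ∫-table N _ _ _ ⟩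
      Σ< N (λ i → ∣ sc i * W (j i) ∣ * ι (V (j i)))
        ≡⟨ Σ<-cong N (λ i → trans (cong (_* ι (V (j i))) (∣p*q∣≡∣p∣*∣q∣ (sc i) (W (j i))))
          (trans (*-assoc (∣ sc i ∣) (∣ W (j i) ∣) (ι (V (j i)))) (trans (cong (∣ sc i ∣ *_) (sym (WV (j i)))) (sym (∣p*q∣≡∣p∣*∣q∣ (sc i) (WV′ (j i))))))) ⟩
      Σ< N (λ i → ∣ sc i * WV′ (j i) ∣) ≤⟨ Σ-sc≤ (ι 3) WV′ (0≤ι 3) WV≤ ⟩
      ι 3 * ι 2 ∎))
      where
      open ≤-Reasoning
      WV′ : ℕ → ℚ
      WV′ d = W d * ι (V d)
      WV : ∀ d → ∣ WV′ d ∣ ≡ ∣ W d ∣ * ι (V d)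
      WV d = trans (∣p*q∣≡∣p∣*∣q∣ (W d) (ι (V d))) (cong (∣ W d ∣ *_) (0≤p⇒∣p∣≡p (0≤ι (V d))))
      WV≤ : ∀ d → ∣ WV′ d ∣ ≤ ι 3 * ∣ recip₁ d ∣
      WV≤ zero    = 0≤* (0≤ι 3) (0≤∣p∣ (recip₁ 0))
      WV≤ (suc d) = ≤-trans (≤-reflexive (trans (WV (suc d)) (*-comm (∣ W (suc d) ∣) (ι (V (suc d)))))) (node∣recip₁₂∣≤3∣recip₁∣ (suc d))

    -- Twice the positive part: the positive measure |τ| + τ.
    dbl : Meas ℕ → Meas ℕ
    dbl []            = []
    dbl ((w , s) ∷ μ) = (∣ w ∣ + w , s) ∷ dbl μ

    dbl-pos : ∀ μ → Pos (dbl μ)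
    dbl-pos []            = []
    dbl-pos ((w , s) ∷ μ) = subst (_≤ ∣ w ∣ + w) (+-inverseˡ w) (+-monoˡ-≤ w (-p≤∣p∣ w)) ∷ dbl-pos μ

    dbl-supp : ∀ {P : ℕ → Set} {μ} → Supp P μ → Supp P (dbl μ)
    dbl-supp []       = []
    dbl-supp (p ∷ ps) = p ∷ dbl-supp ps

    ∫-dbl : ∀ μ f → ∫ (dbl μ) f ≡ ∫ (abs μ) f + ∫ μ f
    ∫-dbl []            f = refl
    ∫-dbl ((w , s) ∷ μ) f = trans (cong ((∣ w ∣ + w) * f s +_) (∫-dbl μ f))
      (solve 5 (λ a w y m n → (a :+ w) :* y :+ (m :+ n) := a :* y :+ m :+ (w :* y :+ n)) refl
        (∣ w ∣) w (f s) (∫ (abs μ) f) (∫ μ f))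

    rest : ℚ
    rest = 1ℚ - η * ∫ (abs τ) (λ _ → 1ℚ)

    0≤rest : 0ℚ ≤ rest
    0≤rest = p≤q⇒0≤q-p (*-monoˡ 0≤η mass≤8)

    rest≤1 : rest ≤ 1ℚ
    rest≤1 = ≤-step (0≤* 0≤η (0≤∫ (abs-pos τ) (λ _ → 0≤1)))
      (solve 1 (λ x → con 1ℚ :- x :+ x := con 1ℚ) refl (η * ∫ (abs τ) (λ _ → 1ℚ)))

    -- The false measure minus the true one is η (½ δ₀ + τ), which vanishes on degrees below K by
    -- `annihilates`. The common |τ| makes both positive, and `rest` at the point 1 completes the
    -- mass to 1.
    μ : Bool → Meas ℕ
    μ true  = (rest , 1) ∷ scale η (abs τ)
    μ false = (rest , 1) ∷ (½ * η , 0) ∷ scale η (dbl τ)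

    ∫-false : ∀ f → ∫ (μ false) f ≡ rest * f 1 + (½ * η * f 0 + η * (∫ (abs τ) f + ∫ τ f))
    ∫-false f = cong (λ x → rest * f 1 + (½ * η * f 0 + x))
      (trans (∫-scale η (dbl τ) f) (cong (η *_) (∫-dbl τ f)))

    ∫-true : ∀ f → ∫ (μ true) f ≡ rest * f 1 + η * ∫ (abs τ) f
    ∫-true f = cong (rest * f 1 +_) (∫-scale η (abs τ) f)

    μ-pos : ∀ b → Pos (μ b)
    μ-pos true  = 0≤rest ∷ scale-pos 0≤η (abs-pos τ)
    μ-pos false = 0≤rest ∷ 0≤* 0≤½ 0≤η ∷ scale-pos 0≤η (dbl-pos τ)

    μ-match : Match rate K μ
    μ-match {e} lt _ = trans (∫-true g) (sym (trans (∫-false g)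
      (trans (solve 5 (λ r e g0 a t → r :+ (con ½ :* e :* g0 :+ e :* (a :+ t)) := r :+ e :* a :+ e :* (con ½ :* g0 :+ t)) refl
        (rest * g 1) η (g 0) (∫ (abs τ) g) (∫ τ g))
      (trans (cong (λ x → rest * g 1 + η * ∫ (abs τ) g + η * x) (annihilates lt))
        (solve 2 (λ x e → x :+ e :* con 0ℚ := x) refl (rest * g 1 + η * ∫ (abs τ) g) η)))))
      where
      g : ℕ → ℚ
      g s = ι s ^^ e

    μ-1 : ∀ b → ∫ (μ b) (λ _ → 1ℚ) ≡ 1ℚ
    μ-1 true  = trans (∫-true (λ _ → 1ℚ)) (solve 1 (λ x → (con 1ℚ :- x) :* con 1ℚ :+ x := con 1ℚ) refl (η * ∫ (abs τ) (λ _ → 1ℚ)))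
    μ-1 false = trans (sym (μ-match (ℕ.>-nonZero⁻¹ K) tt)) (μ-1 true)

    τ-pos : Supp (λ s → pos? s ≡ true) τ
    τ-pos = refl ∷ refl ∷ table-supp N _ _ (λ i _ → V-pos (j i))
      where
      V-pos : ∀ d → pos? (V d) ≡ true
      V-pos zero    = refl
      V-pos (suc d) = refl

    true-pos : Supp (λ s → pos? s ≡ true) (μ true)
    true-pos = refl ∷ scale-supp η (abs-supp τ-pos)

    false-pos : ∫ (μ false) (𝟙 ∘ pos?) ≡ 1ℚ - ½ * η
    false-pos = begin
      ∫ (μ false) (𝟙 ∘ pos?) ≡⟨⟩
      rest * 1ℚ + (½ * η * 0ℚ + S (𝟙 ∘ pos?)) ≡⟨ cong (λ x → rest * 1ℚ + (½ * η * 0ℚ + x))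
         (∫-congS (scale η (dbl τ)) (scale-supp η (dbl-supp τ-pos)) (λ s e → cong 𝟙 e)) ⟩
      rest * 1ℚ + (½ * η * 0ℚ + S (λ _ → 1ℚ)) ≡⟨ solve 3 (λ r e x → r :* con 1ℚ :+ (con ½ :* e :* con 0ℚ :+ x)
         := (r :* con 1ℚ :+ (con ½ :* e :* con 1ℚ :+ x)) :- con ½ :* e) refl rest η (S (λ _ → 1ℚ)) ⟩
      ∫ (μ false) (λ _ → 1ℚ) - ½ * η ≡⟨ cong (_- ½ * η) (μ-1 false) ⟩
      1ℚ - ½ * η ∎
      where
      open ≡-Reasoning
      S : (ℕ → ℚ) → ℚ
      S = ∫ (scale η (dbl τ))

    -- At most 1 from the mass at 1, and 16/8 from each of |τ| and τ.
    mean≤5 : ∀ b → ∫ (μ b) ι ≤ ι 5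
    mean≤5 true  = ≤-trans (≤-reflexive (∫-true ι)) (≤-trans (+-mono-≤ (*-monoʳ (0≤ι 1) rest≤1) (*-monoˡ 0≤η mean≤16))
      (toWitness {a? = (1ℚ * ι 1 + η * ι 16) ≤? ι 5} _))
    mean≤5 false = ≤-trans (≤-reflexive (∫-false ι)) (≤-trans (+-mono-≤ (*-monoʳ (0≤ι 1) rest≤1)
        (+-monoʳ-≤ (½ * η * 0ℚ) (*-monoˡ 0≤η (+-mono-≤ mean≤16 (≤-trans ∫≤ mean≤16)))))
      (toWitness {a? = (1ℚ * ι 1 + (½ * η * 0ℚ + η * (ι 16 + ι 16))) ≤? ι 5} _))
      where
      ∫≤ : ∫ τ ι ≤ ∫ (abs τ) ι
      ∫≤ = ≤-trans (p≤∣p∣ (∫ τ ι)) (≤-trans (∣∫∣≤ τ ι) (≤-reflexive (∫-cong (abs τ) (λ s → 0≤p⇒∣p∣≡p (0≤ι s)))))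

    bound : ℕ
    bound = 4 ℕ.* (K ℕ.* K)

    μ-bound : ∀ b → Supp (ℕ._≤ bound) (μ b)
    μ-bound = λ { true → 1≤ ∷ scale-supp η (abs-supp τ-bound) ; false → 1≤ ∷ ℕ.z≤n ∷ scale-supp η (dbl-supp τ-bound) }
      where
      1≤K² : 1 ℕ.≤ K ℕ.* K
      1≤K² = ℕ.*-mono-≤ (ℕ.>-nonZero⁻¹ K) (ℕ.>-nonZero⁻¹ K)
      4≤ : 4 ℕ.≤ bound
      4≤ = ℕ.*-monoʳ-≤ 4 1≤K²
      1≤ : 1 ℕ.≤ bound
      1≤ = ℕ.≤-trans (ℕ.s≤s ℕ.z≤n) 4≤
      dist≤ : ∀ i → i ℕ.< N → j i ℕ.≤ K
      dist≤ i lt with ℕ.≤-total i K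
      ... | inj₁ i≤K = ℕ.≤-trans (ℕ.≤-reflexive (ℕ.m≤n⇒∣m-n∣≡n∸m i≤K)) (ℕ.m∸n≤m K i)
      ... | inj₂ K≤i = ℕ.≤-trans (ℕ.≤-reflexive (trans (ℕ.∣-∣-comm i K) (ℕ.m≤n⇒∣m-n∣≡n∸m K≤i)))
        (ℕ.≤-trans (ℕ.∸-monoˡ-≤ K (ℕ.≤-pred (subst (i ℕ.<_) N≡ lt))) (ℕ.≤-reflexive (ℕ.m+n∸n≡m K K)))
      V≤ : ∀ d → d ℕ.≤ K → V d ℕ.≤ bound
      V≤ zero    _ = 1≤
      V≤ (suc d) h = ℕ.*-monoʳ-≤ 4 (ℕ.*-mono-≤ h h)
      τ-bound : Supp (ℕ._≤ bound) τ
      τ-bound = 1≤ ∷ ℕ.≤-trans (ℕ.s≤s (ℕ.s≤s ℕ.z≤n)) 4≤ ∷ table-supp N _ _ (λ i lt → V≤ (j i) (dist≤ i lt))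

  -- Extrapolation by Newton's forward-difference formula

  sumM : ℕ → (ℕ → Meas X) → Meas X
  sumM zero    f = []
  sumM (suc n) f = f n ++ sumM n f

  ΔM : (ℕ → Meas X) → ℕ → Meas X
  ΔM q i = q (suc i) ++ scale (- 1ℚ) (q i)

  -- The value at H of the degree-d polynomial through q 0, …, q d.
  extrap : ℕ → ℕ → (ℕ → Meas X) → Meas X
  extrap H zero    q = q 0
  extrap H (suc d) q = q 0 ++ sumM H (λ i → extrap i d (ΔM q))

  ∫-ΔM : ∀ (q : ℕ → Meas X) i f → ∫ (ΔM q i) f ≡ Δ (λ i → ∫ (q i) f) i
  ∫-ΔM q i f = trans (∫-++ (q (suc i)) _ f) (cong (∫ (q (suc i)) f +_)
    (trans (∫-scale (- 1ℚ) (q i) f) (solve 1 (λ x → :- con 1ℚ :* x := :- x) refl (∫ (q i) f))))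

  extrap-exact : ∀ d (q : ℕ → Meas X) f → PolyDeg d (λ i → ∫ (q i) f) → ∀ H →
    ∫ (extrap H d q) f ≡ ∫ (q H) f
  extrap-exact zero    q f h H = sym (h H)
  extrap-exact (suc d) q f h H = trans (∫-++ (q 0) _ f) (go H)
    where
    go : ∀ H → ∫ (q 0) f + ∫ (sumM H (λ i → extrap i d (ΔM q))) f ≡ ∫ (q H) f
    go zero    = +-identityʳ _
    go (suc H) = trans (cong (∫ (q 0) f +_) (∫-++ (extrap H d (ΔM q)) _ f))
      (trans (solve 3 (λ a b c → a :+ (b :+ c) := b :+ (a :+ c)) refl
        (∫ (q 0) f) (∫ (extrap H d (ΔM q)) f) (∫ (sumM H (λ i → extrap i d (ΔM q))) f))
      (trans (cong₂ _+_ (trans (extrap-exact d (ΔM q) f (pd-cong d (λ i → sym (∫-ΔM q i f)) h) H) (∫-ΔM q H f)) (go H))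
        (solve 2 (λ a b → a :- b :+ b := a) refl (∫ (q (suc H)) f) (∫ (q H) f))))

  -- A difference at most doubles the norm and the sum has H terms, so each degree costs a factor 1
  -- + 2H.
  extrap-abs : ∀ d (q : ℕ → Meas X) f B → 0ℚ ≤ B → (∀ i → i ℕ.≤ d → ∫ (abs (q i)) f ≤ B) → ∀ H →
    ∫ (abs (extrap H d q)) f ≤ B * (1ℚ + ι 2 * ι H) ^^ d
  extrap-abs zero    q f B 0≤B h H = ≤-trans (h 0 ℕ.z≤n) (≤-reflexive (sym (*-identityʳ B)))
  extrap-abs (suc d) q f B 0≤B h H = begin
    ∫ (abs (q 0 ++ sumM H part)) f ≡⟨ ∫-abs-++ (q 0) _ f ⟩
    ∫ (abs (q 0)) f + ∫ (abs (sumM H part)) f ≤⟨ +-mono-≤ (h 0 ℕ.z≤n) (go H ℕ.≤-refl) ⟩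
    B + ι H * C ≤⟨ +-monoˡ-≤ (ι H * C) (≤-trans (≤-reflexive (sym (*-identityʳ B))) (*-monoˡ 0≤B (1≤^^ d 1≤x))) ⟩
    B * x ^^ d + ι H * C
      ≡⟨ solve 3 (λ b y h → b :* y :+ h :* ((con 1ℚ :+ con 1ℚ) :* b :* y) := b :* ((con 1ℚ :+ con (ι 2) :* h) :* y)) refl B (x ^^ d) (ι H) ⟩
    B * (x * x ^^ d) ∎
    where
    open ≤-Reasoning
    x = 1ℚ + ι 2 * ι H
    part = λ i → extrap i d (ΔM q)
    1≤x : 1ℚ ≤ x
    1≤x = p≤p+q (0≤* (0≤ι 2) (0≤ι H))
    C = (1ℚ + 1ℚ) * B * x ^^ d
    Δ≤ : ∀ i → i ℕ.≤ d → ∫ (abs (ΔM q i)) f ≤ (1ℚ + 1ℚ) * B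
    Δ≤ i le = begin
      ∫ (abs (ΔM q i)) f ≡⟨ ∫-abs-++ (q (suc i)) _ f ⟩
      ∫ (abs (q (suc i))) f + ∫ (abs (scale (- 1ℚ) (q i))) f
        ≡⟨ cong (∫ (abs (q (suc i))) f +_) (trans (cong (λ μ → ∫ μ f) (abs-scale (- 1ℚ) (q i))) (∫-scale 1ℚ (abs (q i)) f)) ⟩
      ∫ (abs (q (suc i))) f + 1ℚ * ∫ (abs (q i)) f
        ≤⟨ +-mono-≤ (h (suc i) (ℕ.s≤s le)) (*-monoˡ 0≤1 (h i (ℕ.m≤n⇒m≤1+n le))) ⟩
      B + 1ℚ * B ≡⟨ solve 1 (λ b → b :+ con 1ℚ :* b := (con 1ℚ :+ con 1ℚ) :* b) refl B ⟩
      (1ℚ + 1ℚ) * B ∎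
    go : ∀ n → n ℕ.≤ H → ∫ (abs (sumM n part)) f ≤ ι n * C
    go zero    le = ≤-reflexive (sym (*-zeroˡ C))
    go (suc n) le = begin
      ∫ (abs (part n ++ sumM n part)) f ≡⟨ ∫-abs-++ (part n) _ f ⟩
      ∫ (abs (part n)) f + ∫ (abs (sumM n part)) f
        ≤⟨ +-mono-≤ (≤-trans (extrap-abs d (ΔM q) f ((1ℚ + 1ℚ) * B) 0≤2B Δ≤ n)
          (*-monoˡ 0≤2B (^^-mono d (0≤+ 0≤1 (0≤* (0≤ι 2) (0≤ι n))) (+-monoʳ-≤ 1ℚ (*-monoˡ (0≤ι 2) (ι-mono (ℕ.<⇒≤ le)))))))
        (go n (ℕ.<⇒≤ le)) ⟩
      C + ι n * C ≡⟨ solve 2 (λ c n → c :+ n :* c := (con 1ℚ :+ n) :* c) refl C (ι n) ⟩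
      (1ℚ + ι n) * C ∎
      where
      0≤2B : 0ℚ ≤ (1ℚ + 1ℚ) * B
      0≤2B = 0≤* (0≤+ 0≤1 0≤1) 0≤B

  -- Linear forms in the rates

  ΣF : ∀ {R} → (Fin R → ℚ) → ℚ
  ΣF {zero}  f = 0ℚ
  ΣF {suc R} f = f zero + ΣF (f ∘ suc)

  ΣF-cong : ∀ {R} {f g : Fin R → ℚ} → (∀ v → f v ≡ g v) → ΣF f ≡ ΣF g
  ΣF-cong {zero}  h = refl
  ΣF-cong {suc R} h = cong₂ _+_ (h zero) (ΣF-cong (h ∘ suc))

  ΣF-* : ∀ {R} c (f : Fin R → ℚ) → ΣF (λ v → c * f v) ≡ c * ΣF f
  ΣF-* {zero}  c f = sym (*-zeroʳ c)
  ΣF-* {suc R} c f = trans (cong (c * f zero +_) (ΣF-* c (f ∘ suc))) (sym (*-distribˡ-+ c _ _))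

  ΣF-≤ : ∀ {R c} {f : Fin R → ℚ} → (∀ v → f v ≤ c) → ΣF f ≤ ι R * c
  ΣF-≤ {zero}  {c} h = ≤-reflexive (sym (*-zeroˡ c))
  ΣF-≤ {suc R} {c} h = ≤-trans (+-mono-≤ (h zero) (ΣF-≤ (h ∘ suc)))
    (≤-reflexive (solve 2 (λ c r → c :+ r :* c := (con 1ℚ :+ r) :* c) refl c (ι R)))

  0≤ΣF : ∀ {R} {f : Fin R → ℚ} → (∀ v → 0ℚ ≤ f v) → 0ℚ ≤ ΣF f
  0≤ΣF {zero}  h = ≤-refl
  0≤ΣF {suc R} h = 0≤+ (h zero) (0≤ΣF (h ∘ suc))

  ∫-ΣF : ∀ {R} (μ : Meas X) (F : Fin R → X → ℚ) → ∫ μ (λ x → ΣF (λ v → F v x)) ≡ ΣF (λ v → ∫ μ (F v))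
  ∫-ΣF {R = zero}  μ F = ∫-0 μ
  ∫-ΣF {R = suc R} μ F = trans (∫-+ μ (F zero) _) (cong (∫ μ (F zero) +_) (∫-ΣF μ (F ∘ suc)))

  lin : ∀ {R} → Vec ℕ R → (Fin R → ℚ) → ℚ
  lin s c = ΣF (λ v → c v * ι (lookup s v))

  lin-zero : ∀ {R} (s : Vec ℕ R) → lin s (λ _ → 0ℚ) ≡ 0ℚ
  lin-zero []       = refl
  lin-zero (s ∷ ss) = cong₂ _+_ (*-zeroˡ (ι s)) (lin-zero ss)

  _≡ᶠ_ : ∀ {R} → Fin R → Fin R → Bool
  zero  ≡ᶠ zero  = true
  zero  ≡ᶠ suc w = false
  suc v ≡ᶠ zero  = false
  suc v ≡ᶠ suc w = v ≡ᶠ w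

  lin-single : ∀ {R} (s : Vec ℕ R) v k → lin s (λ w → k * 𝟙 (v ≡ᶠ w)) ≡ k * ι (lookup s v)
  lin-single (s ∷ ss) zero    k = trans (cong (k * 1ℚ * ι s +_)
    (trans (ΣF-cong (λ w → trans (cong (_* ι (lookup ss w)) (*-zeroʳ k)) refl)) (lin-zero ss)))
    (solve 2 (λ k s → k :* con 1ℚ :* s :+ con 0ℚ := k :* s) refl k (ι s))
  lin-single (s ∷ ss) (suc v) k = trans (cong (k * 0ℚ * ι s +_) (lin-single ss v k))
    (solve 3 (λ k s x → k :* con 0ℚ :* s :+ x := x) refl k (ι s) (k * ι (lookup ss v)))

  -- Products of e affine forms a + λ Σ_v c_v s_v.
  data RPoly (R : ℕ) : ℕ → Set where
    one    : RPoly R 0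
    affine : ∀ {e} → ℚ → (Fin R → ℚ) → RPoly R e → RPoly R (suc e)

  ⟦_⟧ : ∀ {R e} → RPoly R e → ℚ → Vec ℕ R → ℚ
  ⟦ one ⟧          l s = 1ℚ
  ⟦ affine a c p ⟧ l s = (a + l * lin s c) * ⟦ p ⟧ l s

  rpoly-deg : ∀ {R e} (p : RPoly R e) k s → PolyDeg e (λ i → ⟦ p ⟧ (k * ι i) s)
  rpoly-deg one k s = λ _ → refl
  rpoly-deg (affine {e} a c p) k s = pd-cong (suc e)
    (λ i → cong (λ x → (a + x) * ⟦ p ⟧ (k * ι i) s)
      (solve 3 (λ k l i → k :* l :* i := k :* i :* l) refl k (lin s c) (ι i)))
    (pd-affine e a (k * lin s c) (rpoly-deg p k s))

  rates : ℕ → Space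
  rates = Pow rate

  bump : ∀ {R e} (v : Fin R) (m : PowT rate R e) →
    Σ ℕ λ e′ → Σ (PowT rate R e′) λ m′ → e′ ≡ suc e × (∀ s → ι (lookup s v) * evP rate m s ≡ evP rate m′ s)
  bump zero (_∷ₜ_ {e = e₁} tt m) = _ , _∷ₜ_ {e = suc e₁} tt m , refl ,
    λ { (s ∷ ss) → sym (*-assoc (ι s) _ _) }
  bump (suc v) (_∷ₜ_ {e = e₁} tt m) with bump v m
  ... | e′ , m′ , refl , h = _ , _∷ₜ_ {e = e₁} tt m′ , ℕ.+-suc e₁ _ , λ { (s ∷ ss) →
    trans (solve 3 (λ x y z → x :* (y :* z) := y :* (x :* z)) refl (ι (lookup ss v)) (ι s ^^ e₁) (evP rate m ss))
      (cong (ι s ^^ e₁ *_) (h ss)) }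

  -- Multiplying out one affine factor at a time: its constant comes out of the integral, and each
  -- c_v s_v moves s_v into the monomial m. The degree of m plus the number of remaining factors
  -- never grows.
  rpoly-match : ∀ {R D e e′} {ρ : Bool → Meas (Vec ℕ R)} → Match (rates R) D ρ →
    (m : PowT rate R e′) (p : RPoly R e) → e′ ℕ.+ e ℕ.< D → ∀ l →
    ∫ (ρ true) (λ s → evP rate m s * ⟦ p ⟧ l s) ≡ ∫ (ρ false) (λ s → evP rate m s * ⟦ p ⟧ l s)
  rpoly-match {e′ = e′} {ρ} mt m one lt l = trans (ex true) (trans (mt (subst (ℕ._< _) (ℕ.+-identityʳ e′) lt) m) (sym (ex false)))
    where
    ex : ∀ b → ∫ (ρ b) (λ s → evP rate m s * 1ℚ) ≡ ∫ (ρ b) (evP rate m)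
    ex b = ∫-cong (ρ b) (λ s → *-identityʳ _)
  rpoly-match {R} {D} {suc e} {e′} {ρ} mt m (affine a c p) lt l = trans (ex true) (trans (cong₂ (λ x y → a * x + l * y)
      (rpoly-match {ρ = ρ} mt m p (ℕ.≤-<-trans (ℕ.+-monoʳ-≤ e′ (ℕ.n≤1+n e)) lt) l)
      (ΣF-cong (λ v → cong (c v *_) (rpoly-match {ρ = ρ} mt (m′ v) p (lt′ v) l)))) (sym (ex false)))
    where
    m′ : ∀ v → PowT rate R (proj₁ (bump v m))
    m′ v = proj₁ (proj₂ (bump v m))
    lt′ : ∀ v → proj₁ (bump v m) ℕ.+ e ℕ.< D
    lt′ v = subst (ℕ._< D) (trans (ℕ.+-suc e′ e) (cong (ℕ._+ e) (sym (proj₁ (proj₂ (proj₂ (bump v m))))))) lt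
    pw : ∀ s → evP rate m s * ((a + l * lin s c) * ⟦ p ⟧ l s)
      ≡ a * (evP rate m s * ⟦ p ⟧ l s) + l * ΣF (λ v → c v * (evP rate (m′ v) s * ⟦ p ⟧ l s))
    pw s = trans (solve 5 (λ m a l x p → m :* ((a :+ l :* x) :* p) := a :* (m :* p) :+ l :* ((m :* p) :* x)) refl
        (evP rate m s) a l (lin s c) (⟦ p ⟧ l s))
      (cong (λ x → a * (evP rate m s * ⟦ p ⟧ l s) + l * x) (trans (sym (ΣF-* {R} (evP rate m s * ⟦ p ⟧ l s) (λ v → c v * ι (lookup s v))))
        (ΣF-cong (λ v → trans (solve 4 (λ m p c s → m :* p :* (c :* s) := c :* ((s :* m) :* p)) refl
          (evP rate m s) (⟦ p ⟧ l s) (c v) (ι (lookup s v)))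
          (cong (λ x → c v * (x * ⟦ p ⟧ l s)) (proj₂ (proj₂ (proj₂ (bump v m))) s))))))
    ex : ∀ b → ∫ (ρ b) (λ s → evP rate m s * ((a + l * lin s c) * ⟦ p ⟧ l s))
      ≡ a * ∫ (ρ b) (λ s → evP rate m s * ⟦ p ⟧ l s)
        + l * ΣF (λ v → c v * ∫ (ρ b) (λ s → evP rate (m′ v) s * ⟦ p ⟧ l s))
    ex b = trans (∫-cong (ρ b) pw) (trans (∫-+ (ρ b) _ _) (cong₂ _+_ (∫-*ˡ (ρ b) a _)
      (trans (∫-*ˡ (ρ b) l _) (cong (l *_) (trans (∫-ΣF {R = R} (ρ b) (λ v s → c v * (evP rate (m′ v) s * ⟦ p ⟧ l s))) (ΣF-cong (λ v → ∫-*ˡ (ρ b) (c v) _)))))))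

  1ᵗ : ∀ R → Σ ℕ λ e → Σ (PowT rate R e) λ m → e ≡ 0 × (∀ s → evP rate m s ≡ 1ℚ)
  1ᵗ zero    = 0 , [] , refl , λ { [] → refl }
  1ᵗ (suc R) with 1ᵗ R
  ... | e , m , refl , h = 0 , _∷ₜ_ {e = 0} tt m , refl , λ { (s ∷ ss) → cong (1ℚ *_) (h ss) }

  rpoly-match₀ : ∀ {R D e} {ρ : Bool → Meas (Vec ℕ R)} → Match (rates R) D ρ → e ℕ.< D →
    (p : RPoly R e) → ∀ l → ∫ (ρ true) (⟦ p ⟧ l) ≡ ∫ (ρ false) (⟦ p ⟧ l)
  rpoly-match₀ {R} {ρ = ρ} mt lt p l with 1ᵗ R
  ... | e , m , refl , h = trans (ex true) (trans (rpoly-match {ρ = ρ} mt m p lt l) (sym (ex false)))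
    where
    ex : ∀ b → ∫ (ρ b) (⟦ p ⟧ l) ≡ ∫ (ρ b) (λ s → evP rate m s * ⟦ p ⟧ l s)
    ex b = ∫-cong (ρ b) (λ s → sym (trans (cong (_* ⟦ p ⟧ l s) (h s)) (*-identityˡ _)))

  neq : Bool → Bool → Bool
  neq a b = a xor b

  -- Random slots, and truncation of large multiplicities.

  -- N independent slots: slot content elt v with probability l · s_v, null with the remaining probability.
  module Slots {X : Set} {R : ℕ} (null : X) (elt : Fin R → X) (hit : Fin R → X → Bool)
    (hit-null : ∀ v → hit v null ≡ false) (hit-elt : ∀ v w → hit v (elt w) ≡ (v ≡ᶠ w)) where

    cells : ∀ {R} → ℚ → Vec ℕ R → (Fin R → X) → Meas X
    cells l []       e = []
    cells l (s ∷ ss) e = (l * ι s , e zero) ∷ cells l ss (e ∘ suc)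

    total : ∀ {R} → Vec ℕ R → ℚ
    total s = ι (Vec.sum s)

    slot : ℚ → Vec ℕ R → Meas X
    slot l s = (1ℚ - l * total s , null) ∷ cells l s elt

    ∫-cells : ∀ {R} l (s : Vec ℕ R) e f → ∫ (cells l s e) f ≡ l * lin s (f ∘ e)
    ∫-cells l []       e f = sym (*-zeroʳ l)
    ∫-cells l (s ∷ ss) e f = trans (cong (l * ι s * f (e zero) +_) (∫-cells l ss (e ∘ suc) f))
      (solve 4 (λ l s y z → l :* s :* y :+ l :* z := l :* (y :* s :+ z)) refl l (ι s) (f (e zero)) (lin ss (f ∘ e ∘ suc)))

    lin-shift : ∀ {R} (s : Vec ℕ R) (h : Fin R → ℚ) c → lin s h ≡ c * total s + lin s (λ v → h v - c)
    lin-shift []       h c = sym (trans (+-identityʳ _) (*-zeroʳ c))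
    lin-shift (s ∷ ss) h c = trans (cong (h zero * ι s +_) (lin-shift ss (h ∘ suc) c))
      (trans (solve 5 (λ h s c t z → h :* s :+ (c :* t :+ z) := c :* (s :+ t) :+ ((h :- c) :* s :+ z)) refl
        (h zero) (ι s) c (total ss) (lin ss (λ v → h (suc v) - c)))
        (cong (λ x → c * x + ((h zero - c) * ι s + lin ss (λ v → h (suc v) - c))) (sym (ι-+ s (Vec.sum ss)))))

    -- The null slot takes up the remaining probability, so the mean of any function of one slot is
    -- affine in s. A product of e such functions thus becomes an `RPoly` of degree e.
    ∫-slot : ∀ l s f → ∫ (slot l s) f ≡ f null + l * lin s (λ v → f (elt v) - f null)
    ∫-slot l s f = trans (cong ((1ℚ - l * total s) * f null +_) (trans (∫-cells l s elt f) (cong (l *_) (lin-shift s (f ∘ elt) (f null)))))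
      (solve 4 (λ l t n z → (con 1ℚ :- l :* t) :* n :+ l :* (n :* t :+ z) := n :+ l :* z) refl l (total s) (f null) (lin s (λ v → f (elt v) - f null)))

    slot-1 : ∀ l s → ∫ (slot l s) (λ _ → 1ℚ) ≡ 1ℚ
    slot-1 l s = trans (∫-slot l s _) (trans (cong (λ x → 1ℚ + l * x) (lin-zero s)) (cong (1ℚ +_) (*-zeroʳ l)))

    slots : ∀ N → ℚ → Vec ℕ R → Meas (Vec X N)
    slots N l s = prod {X = ⊤} (λ _ → slot l s) (replicate N tt)

    slots-test : ∀ {N e} (t : PowT (atom X) N e) →
      Σ (RPoly R e) λ p → ∀ l s → ∫ (slots N l s) (evP (atom X) t) ≡ ⟦ p ⟧ l s
    slots-test [] = one , λ l s → refl
    slots-test {suc N} (one ∷ₜ t) with slots-test t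
    ... | p , h = p , λ l s → trans (∫-prod-ev (atom X) (λ _ → slot l s) one t tt (replicate N tt))
      (trans (cong₂ _*_ (slot-1 l s) (h l s)) (*-identityˡ _))
    slots-test {suc N} (fn f ∷ₜ t) with slots-test t
    ... | p , h = affine (f null) (λ v → f (elt v) - f null) p , λ l s →
      trans (∫-prod-ev (atom X) (λ _ → slot l s) (fn f) t tt (replicate N tt))
      (cong₂ _*_ (∫-slot l s f) (h l s))

    slots-1 : ∀ N l s → ∫ (slots N l s) (λ _ → 1ℚ) ≡ 1ℚ
    slots-1 N l s = ∫-prod-1 {κ = λ _ → slot l s} (λ _ → slot-1 l s) (replicate N tt)

    cells-pos : ∀ {R l} → 0ℚ ≤ l → (s : Vec ℕ R) → ∀ e → Pos (cells l s e)
    cells-pos 0≤l []       e = []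
    cells-pos 0≤l (s ∷ ss) e = 0≤* 0≤l (0≤ι s) ∷ cells-pos 0≤l ss (e ∘ suc)

    slots-pos : ∀ N l s → 0ℚ ≤ l → l * total s ≤ 1ℚ → Pos (slots N l s)
    slots-pos N l s 0≤l le = prod-pos {κ = λ _ → slot l s} (λ _ → p≤q⇒0≤q-p le ∷ cells-pos 0≤l s elt) (replicate N tt)

    seen : ∀ {N} → Fin R → Vec X N → Bool
    seen v []       = false
    seen v (x ∷ xs) = hit v x ∨ seen v xs

    unseen-prod : ∀ {N} v (xs : Vec X N) → 𝟙 (not (seen v xs)) ≡ vprod (λ x → 𝟙 (not (hit v x))) xs
    unseen-prod v []       = refl
    unseen-prod v (x ∷ xs) with hit v x
    ... | true  = sym (*-zeroˡ (vprod (λ x → 𝟙 (not (hit v x))) xs))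
    ... | false = trans (unseen-prod v xs) (sym (*-identityˡ _))

    ∫-unhit : ∀ l s v → ∫ (slot l s) (λ x → 𝟙 (not (hit v x))) ≡ 1ℚ - l * ι (lookup s v)
    ∫-unhit l s v = trans (∫-slot l s _) (trans
      (cong₂ _+_ (cong (𝟙 ∘ not) (hit-null v)) (cong (l *_) (trans (ΣF-cong (λ w → cong (_* ι (lookup s w)) (eq w))) (lin-single s v (- 1ℚ)))))
      (solve 2 (λ l s → con 1ℚ :+ l :* (:- con 1ℚ :* s) := con 1ℚ :- l :* s) refl l (ι (lookup s v))))
      where
      eq′ : ∀ b → 𝟙 (not b) - 1ℚ ≡ - 1ℚ * 𝟙 b
      eq′ true  = refl
      eq′ false = refl
      eq : ∀ w → 𝟙 (not (hit v (elt w))) - 𝟙 (not (hit v null)) ≡ - 1ℚ * 𝟙 (v ≡ᶠ w)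
      eq w = trans (cong₂ (λ a b → 𝟙 (not a) - 𝟙 (not b)) (hit-elt v w) (hit-null v)) (eq′ (v ≡ᶠ w))

    vprod-replicate : ∀ N c → vprod {X = ⊤} (λ _ → c) (replicate N tt) ≡ c ^^ N
    vprod-replicate zero    c = refl
    vprod-replicate (suc N) c = cong (c *_) (vprod-replicate N c)

    ∫-unseen : ∀ N l s v → ∫ (slots N l s) (λ x → 𝟙 (not (seen v x))) ≡ (1ℚ - l * ι (lookup s v)) ^^ N
    ∫-unseen N l s v = trans (∫-cong (slots N l s) (unseen-prod v))
      (trans (∫-prod-vprod {X = ⊤} (λ _ → slot l s) (replicate N tt) (λ x → 𝟙 (not (hit v x))))
      (trans (vprod-replicate N _) (cong (_^^ N) (∫-unhit l s v))))

    lookup≤sum : ∀ {R} (s : Vec ℕ R) v → lookup s v ℕ.≤ Vec.sum s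
    lookup≤sum (s ∷ ss) zero    = ℕ.m≤m+n s _
    lookup≤sum (s ∷ ss) (suc v) = ℕ.≤-trans (lookup≤sum ss v) (ℕ.m≤n+m _ s)

    -- A name of multiplicity 0 never occurs. Otherwise all T A slots miss it with probability at
    -- most ((1 - 1/A)^A)^T, and (1 - 1/A)^A ≤ 1/2.
    miss : ∀ T A .{{_ : ℕ.NonZero A}} s v → Vec.sum s ℕ.≤ A →
      ∫ (slots (T ℕ.* A) (inv A) s) (λ x → 𝟙 (neq (seen v x) (pos? (lookup s v)))) ≤ ½ ^^ T
    miss T A s v le with lookup s v in eq
    ... | zero = ≤-trans (≤-reflexive (begin
      ∫ Φ (λ x → 𝟙 (neq (seen v x) false)) ≡⟨ ∫-cong Φ (λ x → compl (seen v x)) ⟩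
      ∫ Φ (λ x → 1ℚ + - 1ℚ * 𝟙 (not (seen v x)))
        ≡⟨ trans (∫-+ Φ _ _) (cong₂ _+_ (slots-1 N (inv A) s) (∫-*ˡ Φ (- 1ℚ) _)) ⟩
      1ℚ + - 1ℚ * ∫ Φ (λ x → 𝟙 (not (seen v x))) ≡⟨ cong (λ y → 1ℚ + - 1ℚ * y) (trans (∫-unseen N (inv A) s v)
          (trans (cong (λ k → (1ℚ - inv A * ι k) ^^ N) eq) (trans (cong (λ y → (1ℚ - y) ^^ N) (*-zeroʳ (inv A))) (1^^ N)))) ⟩
      0ℚ ∎)) (0≤^^ T 0≤½)
      where
      open ≡-Reasoning
      N = T ℕ.* A
      Φ = slots N (inv A) s
      compl : ∀ b → 𝟙 (neq b false) ≡ 1ℚ + - 1ℚ * 𝟙 (not b)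
      compl true  = refl
      compl false = refl
    ... | suc k = begin
      ∫ Φ (λ x → 𝟙 (neq (seen v x) true)) ≡⟨ ∫-cong Φ (λ x → compl (seen v x)) ⟩
      ∫ Φ (λ x → 𝟙 (not (seen v x))) ≡⟨ ∫-unseen N (inv A) s v ⟩
      (1ℚ - inv A * ι (lookup s v)) ^^ N ≤⟨ ^^-mono N 0≤x x≤y ⟩
      y ^^ N ≡⟨ ^^-* y T A ⟩
      (y ^^ A) ^^ T ≤⟨ ^^-mono T (0≤^^ A (≤-trans 0≤x x≤y)) (decay A y (inv A) (≤-trans 0≤x x≤y) (0≤inv A)
        (≤-step (0≤* (0≤inv A) (0≤inv A)) (solve 1 (λ i → (con 1ℚ :- i) :* (con 1ℚ :+ i) :+ i :* i := con 1ℚ) refl (inv A)))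
        (≤-reflexive (sym (ι*inv A)))) ⟩
      ½ ^^ T ∎
      where
      open ≤-Reasoning
      N = T ℕ.* A
      Φ = slots N (inv A) s
      compl : ∀ b → 𝟙 (neq b true) ≡ 𝟙 (not b)
      compl true  = refl
      compl false = refl
      y = 1ℚ - inv A
      0≤x : 0ℚ ≤ 1ℚ - inv A * ι (lookup s v)
      0≤x = p≤q⇒0≤q-p (≤-trans (≤-reflexive (*-comm (inv A) _)) (inv-≤ A
        (≤-trans (ι-mono (ℕ.≤-trans (lookup≤sum s v) le)) (≤-reflexive (sym (*-identityʳ (ι A)))))))
      x≤y : 1ℚ - inv A * ι (lookup s v) ≤ y
      x≤y = +-monoʳ-≤ 1ℚ (neg-antimono-≤ (≤-trans (≤-reflexive (sym (*-identityʳ (inv A))))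
        (*-monoˡ (0≤inv A) (≤-trans (1≤ι k) (≤-reflexive (cong ι (sym eq)))))))

    diff : ∀ {R} (x y : Vec Bool R) → x ≡ y ⊎ 1ℚ ≤ ΣF (λ v → 𝟙 (neq (lookup x v) (lookup y v)))
    diff []      []      = inj₁ refl
    diff (a ∷ x) (b ∷ y) with diff x y
    ... | inj₂ h    = inj₂ (≤-trans h (p≤q+p (0≤𝟙 (neq a b))))
    ... | inj₁ refl with a | b
    ...   | true  | true  = inj₁ refl
    ...   | false | false = inj₁ refl
    ...   | true  | false = inj₂ (p≤p+q (0≤ΣF {f = λ v → 𝟙 (neq (lookup x v) (lookup x v))} (λ v → 0≤𝟙 (neq (lookup x v) (lookup x v)))))
    ...   | false | true  = inj₂ (p≤p+q (0≤ΣF {f = λ v → 𝟙 (neq (lookup x v) (lookup x v))} (λ v → 0≤𝟙 (neq (lookup x v) (lookup x v)))))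

    -- A union bound: f errs at x only if it errs at y or some coordinate of x and y differs.
    stable : ∀ (f : Vec Bool R → Bool) b x y →
      𝟙 (neq (f x) b) ≤ 𝟙 (neq (f y) b) + ΣF (λ v → 𝟙 (neq (lookup x v) (lookup y v)))
    stable f b x y with diff x y
    ... | inj₁ refl = p≤p+q (0≤ΣF {f = λ v → 𝟙 (neq (lookup x v) (lookup x v))} (λ v → 0≤𝟙 (neq (lookup x v) (lookup x v))))
    ... | inj₂ h    = ≤-trans (𝟙≤1 (neq (f x) b)) (≤-trans h (p≤q+p (0≤𝟙 (neq (f y) b))))

    seenAll : ∀ {N} → Vec X N → Vec Bool R
    seenAll x = tabulate (λ v → seen v x)

    module Truncated (T A d H Smax : ℕ) .{{_ : ℕ.NonZero A}} .{{_ : ℕ.NonZero H}} (dS≤H : d ℕ.* Smax ℕ.≤ H) where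

      N : ℕ
      N = T ℕ.* A

      -- At the rates i k with i ≤ d the null slot keeps a nonnegative weight even for
      -- multiplicities of sum `Smax`, while i = H is the wanted rate 1/A.
      k : ℚ
      k = inv A * inv H

      scaled : Vec ℕ R → ℕ → Meas (Vec X N)
      scaled s i = slots N (k * ι i) s

      choose : ∀ s → Dec (Vec.sum s ℕ.≤ A) → Meas (Vec X N)
      choose s (yes _) = slots N (inv A) s
      choose s (no _)  = extrap H d (scaled s)

      Φ : Vec ℕ R → Meas (Vec X N)
      Φ s = choose s (Vec.sum s ℕ.≤? A)

      kH : k * ι H ≡ inv A
      kH = trans (solve 3 (λ a h x → a :* h :* x := a :* (x :* h)) refl (inv A) (inv H) (ι H))
        (trans (cong (inv A *_) (ι*inv H)) (*-identityʳ (inv A)))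

      -- Both branches produce the same polynomial in s, the second because extrapolation is exact
      -- up to degree d. No test of that degree notices the truncation.
      choose-test : ∀ {e} (t : PowT (atom X) N e) → e ℕ.≤ d → ∀ s dec →
        ∫ (choose s dec) (evP (atom X) t) ≡ ⟦ proj₁ (slots-test t) ⟧ (inv A) s
      choose-test t le s (yes _) = proj₂ (slots-test t) (inv A) s
      choose-test {e} t le s (no _) = trans (extrap-exact d (scaled s) _
          (lift le (pd-cong e (λ i → sym (proj₂ (slots-test t) (k * ι i) s)) (rpoly-deg (proj₁ (slots-test t)) k s))) H)
        (trans (proj₂ (slots-test t) (k * ι H) s) (cong (λ l → ⟦ proj₁ (slots-test t) ⟧ l s) kH))
        where
        lift : ∀ {d e p} → e ℕ.≤ d → PolyDeg e p → PolyDeg d p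
        lift {zero}          ℕ.z≤n     h = h
        lift {suc d} {zero}  {p} ℕ.z≤n h = pd-suc d {p} (lift {d} {p = p} ℕ.z≤n h)
        lift {suc d} {suc e} {p} (ℕ.s≤s q) h = lift {d} {e} {Δ p} q h

      choose-1 : ∀ s dec → ∫ (choose s dec) (λ _ → 1ℚ) ≡ 1ℚ
      choose-1 s (yes _) = slots-1 N (inv A) s
      choose-1 s (no _)  = trans (extrap-exact d (scaled s) _
        (pd-cong d (λ i → sym (slots-1 N (k * ι i) s)) (pd-const d 1ℚ)) H) (slots-1 N (k * ι H) s)

      match-slots : ∀ {D} {ρ : Bool → Meas (Vec ℕ R)} → D ℕ.≤ suc d → Match (rates R) D ρ →
        Match (Pow (atom X) N) D (λ b → bind (ρ b) Φ)
      match-slots {D} {ρ} D≤d mt lt t = trans (ex true) (trans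
        (rpoly-match₀ {ρ = ρ} mt lt (proj₁ (slots-test t)) (inv A)) (sym (ex false)))
        where
        ex : ∀ b → ∫ (bind (ρ b) Φ) (evP (atom X) t) ≡ ∫ (ρ b) (⟦ proj₁ (slots-test t) ⟧ (inv A))
        ex b = trans (∫-bind (ρ b) Φ _) (∫-cong (ρ b)
          (λ s → choose-test t (ℕ.≤-pred (ℕ.≤-trans lt D≤d)) s (Vec.sum s ℕ.≤? A)))

      scaled-pos : ∀ s → Vec.sum s ℕ.≤ Smax → ∀ i → i ℕ.≤ d → Pos (scaled s i)
      scaled-pos s s≤ i i≤d = slots-pos N (k * ι i) s (0≤* 0≤k (0≤ι i))
        (≤-trans (≤-reflexive (solve 4 (λ a h i t → a :* h :* i :* t := a :* (i :* t :* h)) refl (inv A) (inv H) (ι i) (total s)))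
        (*-mono (0≤inv A) invA≤1 (0≤* (0≤* (0≤ι i) (0≤ι (Vec.sum s))) (0≤inv H))
          (inv-≤ H (≤-trans (≤-reflexive (sym (ι-* i (Vec.sum s)))) (≤-trans (ι-mono (ℕ.≤-trans (ℕ.*-mono-≤ i≤d s≤) dS≤H))
            (≤-reflexive (sym (*-identityʳ (ι H)))))))))
        where
        0≤k : 0ℚ ≤ k
        0≤k = 0≤* (0≤inv A) (0≤inv H)
        invA≤1 : inv A ≤ 1ℚ
        invA≤1 = subst (λ x → inv x ≤ 1ℚ) (ℕ.suc-pred A) (inv≤1 (ℕ.pred A))

      -- The overflow factor r^S r⁻^A dominates the indicator of S > A.
      choose-J : ∀ r r⁻ → 1ℚ ≤ r → 0ℚ ≤ r⁻ → r * r⁻ ≡ 1ℚ → (f : Vec Bool R → Bool) → ∀ b s dec → Vec.sum s ℕ.≤ Smax →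
        ∫ (abs (choose s dec)) (λ x → 1ℚ + 𝟙 (neq (f (seenAll x)) b))
          ≤ (1ℚ + 𝟙 (neq (f (Vec.map pos? s)) b)) + ι R * ½ ^^ T
            + (ι 2 * (1ℚ + ι 2 * ι H) ^^ d) * (r ^^ Vec.sum s * r⁻ ^^ A)
      choose-J r r⁻ 1≤r 0≤r⁻ rr f b s (yes S≤A) S≤ = begin
        ∫ (abs Ψ) (λ x → 1ℚ + 𝟙 (neq (f (seenAll x)) b))
          ≡⟨ cong (λ μ → ∫ μ (λ x → 1ℚ + 𝟙 (neq (f (seenAll x)) b))) (abs-id Ψ-pos) ⟩
        ∫ Ψ (λ x → 1ℚ + 𝟙 (neq (f (seenAll x)) b))
          ≤⟨ ∫-mono Ψ-pos (λ x → ≤-trans (+-monoʳ-≤ 1ℚ (stable f b (seenAll x) (Vec.map pos? s)))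
            (≤-reflexive (sym (+-assoc 1ℚ g _)))) ⟩
        ∫ Ψ (λ x → 1ℚ + g + ΣF (λ v → F v x)) ≡⟨ trans (∫-+ Ψ _ _) (cong₂ _+_
            (trans (∫-const Ψ (1ℚ + g)) (trans (cong ((1ℚ + g) *_) (slots-1 N (inv A) s)) (*-identityʳ (1ℚ + g)))) (∫-ΣF Ψ F)) ⟩
        1ℚ + g + ΣF (λ v → ∫ Ψ (F v)) ≤⟨ +-monoʳ-≤ (1ℚ + g) (ΣF-≤ (λ v → ≤-trans (≤-reflexive (∫-cong Ψ (λ x →
            cong₂ (λ p q → 𝟙 (neq p q)) (Vec.lookup∘tabulate (λ v → seen v x) v) (Vec.lookup-map v pos? s)))) (miss T A s v S≤A))) ⟩
        1ℚ + g + ι R * ½ ^^ T ≤⟨ p≤p+q (0≤* (0≤* (0≤ι 2) (0≤^^ d (0≤+ 0≤1 (0≤* (0≤ι 2) (0≤ι H)))))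
            (0≤* (0≤^^ (Vec.sum s) (≤-trans 0≤1 1≤r)) (0≤^^ A 0≤r⁻))) ⟩
        _ ∎
        where
        open ≤-Reasoning
        import Data.Vec.Properties as Vₚ
        Ψ = slots N (inv A) s
        g = 𝟙 (neq (f (Vec.map pos? s)) b)
        F : Fin R → Vec X N → ℚ
        F v x = 𝟙 (neq (lookup (seenAll x) v) (lookup (Vec.map pos? s) v))
        Ψ-pos : Pos Ψ
        Ψ-pos = slots-pos N (inv A) s (0≤inv A) (≤-trans (≤-reflexive (*-comm (inv A) _))
          (inv-≤ A (≤-trans (ι-mono S≤A) (≤-reflexive (sym (*-identityʳ (ι A)))))))
      choose-J r r⁻ 1≤r 0≤r⁻ rr f b s (no S≰A) S≤ = begin
        ∫ (abs (extrap H d (scaled s))) h ≤⟨ extrap-abs d (scaled s) h (ι 2) (0≤ι 2) norm H ⟩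
        E ≡⟨ *-identityʳ E ⟨
        E * 1ℚ ≤⟨ *-monoˡ (0≤* (0≤ι 2) (0≤^^ d (0≤+ 0≤1 (0≤* (0≤ι 2) (0≤ι H))))) tail ⟩
        E * (r ^^ Vec.sum s * r⁻ ^^ A)
          ≤⟨ p≤q+p (0≤+ (0≤+ 0≤1 (0≤𝟙 (neq (f (Vec.map pos? s)) b))) (0≤* (0≤ι R) (0≤^^ T 0≤½))) ⟩
        _ ∎
        where
        open ≤-Reasoning
        E = ι 2 * (1ℚ + ι 2 * ι H) ^^ d
        h : Vec X N → ℚ
        h x = 1ℚ + 𝟙 (neq (f (seenAll x)) b)
        norm : ∀ i → i ℕ.≤ d → ∫ (abs (scaled s i)) h ≤ ι 2
        norm i le = begin
          ∫ (abs (scaled s i)) h ≡⟨ cong (λ μ → ∫ μ h) (abs-id (scaled-pos s S≤ i le)) ⟩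
          ∫ (scaled s i) h ≤⟨ ∫-mono (scaled-pos s S≤ i le) (λ x → +-monoʳ-≤ 1ℚ (𝟙≤1 (neq (f (seenAll x)) b))) ⟩
          ∫ (scaled s i) (λ _ → 1ℚ + 1ℚ)
            ≡⟨ trans (∫-const (scaled s i) (1ℚ + 1ℚ)) (cong ((1ℚ + 1ℚ) *_) (slots-1 N (k * ι i) s)) ⟩
          ι 2 ∎
        tail : 1ℚ ≤ r ^^ Vec.sum s * r⁻ ^^ A
        tail = begin
          1ℚ ≡⟨ 1^^ A ⟨
          1ℚ ^^ A ≡⟨ cong (_^^ A) rr ⟨
          (r * r⁻) ^^ A ≡⟨ ^^-*-distrib r r⁻ A ⟩
          r ^^ A * r⁻ ^^ A ≤⟨ *-monoʳ (0≤^^ A 0≤r⁻) (^^-monoʳ 1≤r (ℕ.<⇒≤ (ℕ.≰⇒> S≰A))) ⟩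
          r ^^ Vec.sum s * r⁻ ^^ A ∎

  -- The error of composed pairs.

  noise : ∀ {n} → (Y → Bool) → Vec Bool n → Vec Y n → ℚ
  noise g []       []       = 1ℚ
  noise g (z ∷ zs) (y ∷ ys) = (1ℚ + 𝟙 (neq (g y) z)) * noise g zs ys

  1≤1+𝟙 : ∀ b → 1ℚ ≤ 1ℚ + 𝟙 b
  1≤1+𝟙 b = p≤p+q (0≤𝟙 b)

  -- A single wrong coordinate already brings the product to 2, the largest value of 1 + [f ≠ b].
  -- Being a product, `noise` integrates coordinatewise over product measures.
  noise-dichotomy : ∀ {n} (g : Y → Bool) (z : Vec Bool n) y →
    1ℚ ≤ noise g z y × (Vec.map g y ≡ z ⊎ ι 2 ≤ noise g z y)
  noise-dichotomy g []       []       = ≤-refl , inj₁ refl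
  noise-dichotomy g (z ∷ zs) (y ∷ ys) with noise-dichotomy g zs ys
  ... | h , inj₂ h₂ = ≤-trans h (grow zs ys h) , inj₂ (≤-trans h₂ (grow zs ys h))
    where
    grow : ∀ {n} (zs : Vec Bool n) ys → 1ℚ ≤ noise g zs ys → noise g zs ys ≤ (1ℚ + 𝟙 (neq (g y) z)) * noise g zs ys
    grow zs ys h = subst (_≤ (1ℚ + 𝟙 (neq (g y) z)) * noise g zs ys) (*-identityˡ _)
      (*-monoʳ (≤-trans 0≤1 h) (1≤1+𝟙 (neq (g y) z)))
  ... | h , inj₁ eq with g y | z
  ...   | true  | true  = ≤-trans h (≤-reflexive (sym (*-identityˡ _))) , inj₁ (cong (true ∷_) eq)
  ...   | false | false = ≤-trans h (≤-reflexive (sym (*-identityˡ _))) , inj₁ (cong (false ∷_) eq)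
  ...   | true  | false = ≤-trans (1≤1+𝟙 true) two , inj₂ two
    where two = subst (_≤ ι 2 * noise g zs ys) (*-identityʳ (ι 2)) (*-monoˡ (0≤ι 2) h)
  ...   | false | true  = ≤-trans (1≤1+𝟙 true) two , inj₂ two
    where two = subst (_≤ ι 2 * noise g zs ys) (*-identityʳ (ι 2)) (*-monoˡ (0≤ι 2) h)

  noise-bound : ∀ {n} (g : Y → Bool) (f : Vec Bool n → Bool) b z y →
    1ℚ + 𝟙 (neq (f (Vec.map g y)) b) ≤ (1ℚ + 𝟙 (neq (f z) b)) * noise g z y
  noise-bound g f b z y with noise-dichotomy g z y
  ... | h , inj₁ refl = subst (_≤ (1ℚ + 𝟙 (neq (f z) b)) * noise g z y) (*-identityʳ _)
    (*-monoˡ (0≤+ 0≤1 (0≤𝟙 (neq (f z) b))) h)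
  ... | h , inj₂ h₂ = ≤-trans (+-monoʳ-≤ 1ℚ (𝟙≤1 (neq (f (Vec.map g y)) b)))
    (subst (_≤ (1ℚ + 𝟙 (neq (f z) b)) * noise g z y) (*-identityˡ _) (*-mono 0≤1 (1≤1+𝟙 (neq (f z) b)) (0≤ι 2) h₂))

  ∫-noise : ∀ {n c} (g : Y → Bool) (κ : Bool → Meas Y) → (∀ b → Pos (κ b)) →
    (∀ b → ∫ (κ b) (λ y → 1ℚ + 𝟙 (neq (g y) b)) ≤ c) → (z : Vec Bool n) →
    0ℚ ≤ ∫ (prod κ z) (noise g z) × ∫ (prod κ z) (noise g z) ≤ c ^^ n
  ∫-noise g κ p h [] = 0≤1 , ≤-refl
  ∫-noise {n = suc n} {c} g κ p h (b ∷ z) with ∫-noise g κ p h z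
  ... | h₀ , h₁ = subst (0ℚ ≤_) (sym eq) (0≤* 0≤i h₀) , subst (_≤ c ^^ suc n) (sym eq) (*-mono 0≤i (h b) h₀ h₁)
    where
    i = ∫ (κ b) (λ y → 1ℚ + 𝟙 (neq (g y) b))
    0≤i : 0ℚ ≤ i
    0≤i = 0≤∫ (p b) (λ y → 0≤+ 0≤1 (0≤𝟙 (neq (g y) b)))
    eq : ∫ (prod κ (b ∷ z)) (noise g (b ∷ z)) ≡ i * ∫ (prod κ z) (noise g z)
    eq = trans (∫-cong (prod κ (b ∷ z)) (λ { (y ∷ ys) → refl }))
      (∫-prod-split κ b z (λ y → 1ℚ + 𝟙 (neq (g y) b)) (noise g z))

  -- The summand 1 records total variation, the indicator misplaced mass.
  err : (X → Bool) → Bool → X → ℚ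
  err f b x = 1ℚ + 𝟙 (neq (f x) b)

  0≤err : ∀ (f : X → Bool) b x → 0ℚ ≤ err f b x
  0≤err f b x = 0≤+ 0≤1 (0≤𝟙 (neq (f x) b))

  prod-err : ∀ {n c} (g : Y → Bool) (κ : Bool → Meas Y) → (∀ b → Pos (κ b)) →
    (∀ b → ∫ (κ b) (err g b) ≤ c) → (f : Vec Bool n → Bool) → ∀ b z →
    ∫ (prod κ z) (err (f ∘ Vec.map g) b) ≤ err f b z * c ^^ n
  prod-err {c = c} g κ p h f b z = ≤-trans (∫-mono (prod-pos p z) (noise-bound g f b z))
    (≤-trans (≤-reflexive (∫-*ˡ (prod κ z) (err f b z) (noise g z)))
      (*-monoˡ (0≤err f b z) (proj₂ (∫-noise g κ p h z))))

  ∫-prod-++ : ∀ {m n} (κ : X → Meas Y) (xs : Vec X m) (ys : Vec X n) f →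
    ∫ (prod κ (xs Vec.++ ys)) f ≡ ∫ (prod κ xs) (λ a → ∫ (prod κ ys) (λ b → f (a Vec.++ b)))
  ∫-prod-++ κ []       ys f = sym (∫-δ [] (λ a → ∫ (prod κ ys) (λ b → f (a Vec.++ b))))
  ∫-prod-++ κ (x ∷ xs) ys f = trans (∫-prod-∷ κ x (xs Vec.++ ys) f)
    (trans (∫-cong (κ x) (λ y → ∫-prod-++ κ xs ys (f ∘ (y ∷_)))) (sym (∫-prod-∷ κ x xs _)))

  ∫-prod-concat : ∀ {t n} (κ : X → Meas Y) (g : Bool → Vec X t) (z : Vec Bool n) f →
    ∫ (prod κ (concat (Vec.map g z))) f ≡ ∫ (prod (prod κ ∘ g) z) (f ∘ concat)
  ∫-prod-concat κ g []      f = refl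
  ∫-prod-concat κ g (b ∷ z) f = trans (∫-prod-++ κ (g b) _ f) (trans
    (∫-cong (prod κ (g b)) (λ a → ∫-prod-concat κ g z (λ s → f (a Vec.++ s))))
    (sym (∫-prod-∷ (prod κ ∘ g) b z (f ∘ concat))))

  -- Copies for AND, and exponential moments of the multiplicities.

  expand : ∀ {n} t → Vec Bool n → Vec Bool (n ℕ.* t)
  expand t z = concat (Vec.map (replicate t) z)

  conj : ∀ {t} → Vec Bool t → Bool
  conj []       = true
  conj (b ∷ bs) = b ∧ conj bs

  chunks : ∀ {A : Set} n t → Vec A (n ℕ.* t) → Vec (Vec A t) n
  chunks zero    t x = []
  chunks (suc n) t x = Vec.take t x ∷ chunks n t (Vec.drop t x)

  take-++ : ∀ {A : Set} {m n} (x : Vec A m) (y : Vec A n) → Vec.take m (x Vec.++ y) ≡ x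
  take-++ []      y = refl
  take-++ (a ∷ x) y = cong (a ∷_) (take-++ x y)

  drop-++ : ∀ {A : Set} {m n} (x : Vec A m) (y : Vec A n) → Vec.drop m (x Vec.++ y) ≡ y
  drop-++ []      y = refl
  drop-++ (a ∷ x) y = drop-++ x y

  chunks-concat : ∀ {A : Set} {n t} (x : Vec (Vec A t) n) → chunks n t (concat x) ≡ x
  chunks-concat []       = refl
  chunks-concat {t = t} (x ∷ xs) = cong₂ _∷_ (take-++ x (concat xs))
    (trans (cong (chunks _ t) (drop-++ x (concat xs))) (chunks-concat xs))

  ands : ∀ n t → Vec Bool (n ℕ.* t) → Vec Bool n
  ands n t x = Vec.map conj (chunks n t x)

  conj-prod : ∀ {t} (s : Vec ℕ t) → 𝟙 (conj (Vec.map pos? s)) ≡ vprod (𝟙 ∘ pos?) s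
  conj-prod []           = refl
  conj-prod (zero ∷ s)   = sym (*-zeroˡ (vprod (𝟙 ∘ pos?) s))
  conj-prod (suc k ∷ s)  = trans (conj-prod s) (sym (*-identityˡ _))

  prod-supp : ∀ {n} {Q : ∀ {n} → Vec Y n → Set} {P : Y → Set} {κ : X → Meas Y} → Q [] →
    (∀ {n} y (ys : Vec Y n) → P y → Q ys → Q (y ∷ ys)) → (xs : Vec X n) →
    (∀ i → Supp P (κ (lookup xs i))) → Supp Q (prod κ xs)
  prod-supp q₀ qs []       h = q₀ ∷ []
  prod-supp {Q = Q} {P} {κ} q₀ qs (x ∷ xs) h = bind-supp (h zero) (λ y py → pmap-supp (y ∷_)
    (All.map (qs y _ py) (prod-supp {Q = Q} {P} {κ} q₀ qs xs (h ∘ suc))))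

  module RateStage (K : ℕ) .{{_ : ℕ.NonZero K}} (N : ℕ) (N≡ : N ≡ suc K ℕ.+ K) (t : ℕ) where

    open OrGadget K N N≡ using (μ; μ-pos; μ-1; μ-match; true-pos; false-pos; mean≤5; bound; μ-bound)

    m : ℕ
    m = bound

    instance
      m-nz : ℕ.NonZero m
      m-nz = ℕ.m*n≢0 4 (K ℕ.* K) {{_}} {{ℕ.m*n≢0 K K}}

    μ-pos-prod : ∀ {n} (z : Vec Bool n) → Pos (prod μ z)
    μ-pos-prod = prod-pos μ-pos

    ε : ℚ
    ε = 1ℚ - ½ * η

    copies : Bool → Meas (Vec ℕ t)
    copies b = prod μ (replicate t b)

    any⁺ : Vec ℕ t → Bool
    any⁺ s = conj (Vec.map pos? s)

    -- The error is one-sided: multiplicities drawn for true are never 0, and those drawn for false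
    -- all escape 0 with probability ε^t.
    copies-err : ∀ b → ∫ (copies b) (err any⁺ b) ≤ 1ℚ + ε ^^ t
    copies-err true = begin
      ∫ (copies true) (err any⁺ true) ≡⟨ ∫-congS (copies true) all⁺ (λ s e → cong (λ c → 1ℚ + 𝟙 (neq c true)) e) ⟩
      ∫ (copies true) (λ _ → 1ℚ) ≡⟨ ∫-prod-1 {κ = μ} μ-1 (replicate t true) ⟩
      1ℚ ≤⟨ p≤p+q (0≤^^ t 0≤ε) ⟩
      1ℚ + ε ^^ t ∎
      where
      open ≤-Reasoning
      0≤ε : 0ℚ ≤ ε
      0≤ε = nonNegative⁻¹ ε
      all⁺ : Supp (λ s → any⁺ s ≡ true) (copies true)
      all⁺ = prod-supp {Q = λ s → conj (Vec.map pos? s) ≡ true} {P = λ s → pos? s ≡ true} {κ = μ} refl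
        (λ y ys p q → cong₂ _∧_ p q) (replicate t true)
        (λ i → subst (λ b → Supp (λ s → pos? s ≡ true) (μ b)) (sym (Vec.lookup-replicate i true)) true-pos)
    copies-err false = ≤-reflexive (begin
      ∫ (copies false) (err any⁺ false)
        ≡⟨ ∫-cong (copies false) (λ s → cong (1ℚ +_) (trans (cong 𝟙 (xor-false (any⁺ s))) (conj-prod s))) ⟩
      ∫ (copies false) (λ s → 1ℚ + vprod (𝟙 ∘ pos?) s) ≡⟨ ∫-+ (copies false) _ _ ⟩
      ∫ (copies false) (λ _ → 1ℚ) + ∫ (copies false) (vprod (𝟙 ∘ pos?))
        ≡⟨ cong₂ _+_ (∫-prod-1 {κ = μ} μ-1 (replicate t false)) (∫-prod-vprod μ (replicate t false) (𝟙 ∘ pos?)) ⟩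
      1ℚ + vprod (λ b → ∫ (μ b) (𝟙 ∘ pos?)) (replicate t false) ≡⟨ cong (1ℚ +_) (rep t) ⟩
      1ℚ + ε ^^ t ∎)
      where
      open ≡-Reasoning
      xor-false : ∀ b → neq b false ≡ b
      xor-false true  = refl
      xor-false false = refl
      rep : ∀ t → vprod (λ b → ∫ (μ b) (𝟙 ∘ pos?)) (replicate t false) ≡ ε ^^ t
      rep zero    = refl
      rep (suc t) = cong₂ _*_ false-pos (rep t)

    -- The base of a Chernoff bound. With 1 + 1/(2m) the power r^s lies below a linear function of s
    -- on the range s ≤ m, so the mean alone controls the exponential moment.
    r : ℚ
    r = 1ℚ + inv (2 ℕ.* m)

    instance
      2m-nz : ℕ.NonZero (2 ℕ.* m)
      2m-nz = ℕ.m*n≢0 2 m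

    1≤r : 1ℚ ≤ r
    1≤r = p≤p+q (0≤inv (2 ℕ.* m))

    r⁻ : ℚ
    r⁻ = ι (2 ℕ.* m) * inv (suc (2 ℕ.* m))

    0≤r⁻ : 0ℚ ≤ r⁻
    0≤r⁻ = 0≤* (0≤ι (2 ℕ.* m)) (0≤inv (suc (2 ℕ.* m)))

    rr⁻ : r * r⁻ ≡ 1ℚ
    rr⁻ = trans (solve 3 (λ i a b → (con 1ℚ :+ i) :* (a :* b) := (a :+ a :* i) :* b) refl (inv (2 ℕ.* m)) (ι (2 ℕ.* m)) (inv (suc (2 ℕ.* m))))
      (trans (cong (_* inv (suc (2 ℕ.* m))) (trans (cong (ι (2 ℕ.* m) +_) (ι*inv (2 ℕ.* m))) (+-comm (ι (2 ℕ.* m)) 1ℚ)))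
        (ι*inv (suc (2 ℕ.* m))))

    r-small : ∀ s → s ℕ.≤ m → r ^^ s ≤ 1ℚ + inv m * ι s
    r-small zero    le = p≤p+q (0≤* (0≤inv m) ≤-refl)
    r-small (suc s) le = begin
      r * r ^^ s ≤⟨ *-monoˡ (≤-trans 0≤1 1≤r) (r-small s (ℕ.<⇒≤ le)) ⟩
      (1ℚ + y) * (1ℚ + x * ι s) ≡⟨ cong (λ x → (1ℚ + y) * (1ℚ + x * ι s)) (sym 2y) ⟩
      (1ℚ + y) * (1ℚ + ι 2 * y * ι s) ≡⟨ solve 2 (λ y s → (con 1ℚ :+ y) :* (con 1ℚ :+ con (ι 2) :* y :* s)
         := con 1ℚ :+ con (ι 2) :* y :* s :+ y :+ y :* (con (ι 2) :* y :* s)) refl y (ι s) ⟩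
      1ℚ + ι 2 * y * ι s + y + y * (ι 2 * y * ι s) ≤⟨ +-monoʳ-≤ (1ℚ + ι 2 * y * ι s + y) (*-monoˡ 0≤y small) ⟩
      1ℚ + ι 2 * y * ι s + y + y * 1ℚ ≡⟨ solve 2 (λ y s → con 1ℚ :+ con (ι 2) :* y :* s :+ y :+ y :* con 1ℚ
         := con 1ℚ :+ con (ι 2) :* y :* (con 1ℚ :+ s)) refl y (ι s) ⟩
      1ℚ + ι 2 * y * ι (suc s) ≡⟨ cong (λ x → 1ℚ + x * ι (suc s)) 2y ⟩
      1ℚ + x * ι (suc s) ∎
      where
      open ≤-Reasoning
      y = inv (2 ℕ.* m)
      x = inv m
      0≤y = 0≤inv (2 ℕ.* m)
      2y : ι 2 * y ≡ x
      2y = trans (sym (trans (cong (ι 2 * y *_) (ι*inv m)) (*-identityʳ (ι 2 * y))))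
        (trans (solve 4 (λ t y a x → t :* y :* (a :* x) := t :* a :* y :* x) refl (ι 2) y (ι m) x)
        (trans (cong (λ k → k * y * x) (sym (ι-* 2 m))) (trans (cong (_* x) (ι*inv (2 ℕ.* m))) (*-identityˡ x))))
      small : ι 2 * y * ι s ≤ 1ℚ
      small = ≤-trans (≤-reflexive (trans (cong (_* ι s) 2y) (*-comm x (ι s)))) (inv-≤ m (≤-trans (ι-mono (ℕ.<⇒≤ le))
        (≤-reflexive (sym (*-identityʳ (ι m))))))

    -- The linear bound and mean 5 give 1 + 5/m = 1 + 10/(2m), and Bernoulli's inequality turns this
    -- into r^10: each multiplicity uses up 10 units of capacity.
    r-mean : ∀ b → ∫ (μ b) (r ^^_) ≤ r ^^ 10
    r-mean b = begin
      ∫ (μ b) (r ^^_) ≤⟨ ∫-monoS (μ-pos b) (μ-bound b) r-small ⟩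
      ∫ (μ b) (λ s → 1ℚ + inv m * ι s) ≡⟨ trans (∫-+ (μ b) _ _) (cong₂ _+_ (μ-1 b) (∫-*ˡ (μ b) (inv m) ι)) ⟩
      1ℚ + inv m * ∫ (μ b) ι ≤⟨ +-monoʳ-≤ 1ℚ (*-monoˡ (0≤inv m) (mean≤5 b)) ⟩
      1ℚ + inv m * ι 5 ≡⟨ cong (1ℚ +_) eq ⟩
      1ℚ + ι 10 * inv (2 ℕ.* m) ≤⟨ bernoulli 10 (0≤inv (2 ℕ.* m)) ⟩
      r ^^ 10 ∎
      where
      open ≤-Reasoning
      y = inv (2 ℕ.* m)
      x = inv m
      eq : x * ι 5 ≡ ι 10 * y
      eq = trans (sym (trans (cong (x * ι 5 *_) (ι*inv (2 ℕ.* m))) (*-identityʳ (x * ι 5))))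
        (trans (cong (λ k → x * ι 5 * (k * y)) (ι-* 2 m))
        (trans (solve 3 (λ x a y → x :* con (ι 5) :* (con (ι 2) :* a :* y) := con (ι 10) :* y :* (a :* x)) refl x (ι m) y)
        (trans (cong (ι 10 * y *_) (ι*inv m)) (*-identityʳ (ι 10 * y)))))

    r-decay : r⁻ ^^ (2 ℕ.* m) ≤ ½
    r-decay = decay (2 ℕ.* m) r⁻ (inv (2 ℕ.* m)) 0≤r⁻ (0≤inv (2 ℕ.* m)) (≤-reflexive (trans (*-comm r⁻ r) rr⁻))
      (≤-reflexive (sym (ι*inv (2 ℕ.* m))))

    rsum-prod : ∀ {n} (s : Vec ℕ n) → r ^^ Vec.sum s ≡ vprod (r ^^_) s
    rsum-prod []      = refl
    rsum-prod (a ∷ s) = trans (^^-+ r a (Vec.sum s)) (cong (r ^^ a *_) (rsum-prod s))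

    -- The first 10 R units of capacity offset the R moments; every further 2m units halve the tail.
    r-tail : ∀ {R} (z : Vec Bool R) A G → 10 ℕ.* R ℕ.+ G ℕ.* (2 ℕ.* m) ℕ.≤ A →
      ∫ (prod μ z) (λ s → r ^^ Vec.sum s * r⁻ ^^ A) ≤ ½ ^^ G
    r-tail {R} z A G le = begin
      ∫ (prod μ z) (λ s → r ^^ Vec.sum s * r⁻ ^^ A) ≡⟨ ∫-*ʳ (prod μ z) (r⁻ ^^ A) _ ⟩
      ∫ (prod μ z) (λ s → r ^^ Vec.sum s) * r⁻ ^^ A
        ≡⟨ cong (_* r⁻ ^^ A) (trans (∫-cong (prod μ z) rsum-prod) (∫-prod-vprod μ z (r ^^_))) ⟩
      vprod (λ b → ∫ (μ b) (r ^^_)) z * r⁻ ^^ A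
        ≤⟨ *-mono (0≤vprod 0≤∫r z) (vprod-≤ 0≤∫r r-mean z) (0≤^^ A 0≤r⁻) r⁻-anti ⟩
      (r ^^ 10) ^^ R * r⁻ ^^ A′ ≡⟨ cong₂ _*_ (sym (^^-* r R 10)) (^^-+ r⁻ (10 ℕ.* R) (G ℕ.* (2 ℕ.* m))) ⟩
      r ^^ (R ℕ.* 10) * (r⁻ ^^ (10 ℕ.* R) * r⁻ ^^ (G ℕ.* (2 ℕ.* m)))
        ≡⟨ trans (cong (λ k → r ^^ k * (r⁻ ^^ (10 ℕ.* R) * r⁻ ^^ (G ℕ.* (2 ℕ.* m)))) (ℕ.*-comm R 10)) (sym (*-assoc (r ^^ (10 ℕ.* R)) (r⁻ ^^ (10 ℕ.* R)) (r⁻ ^^ (G ℕ.* (2 ℕ.* m))))) ⟩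
      r ^^ (10 ℕ.* R) * r⁻ ^^ (10 ℕ.* R) * r⁻ ^^ (G ℕ.* (2 ℕ.* m))
        ≡⟨ cong₂ _*_ (trans (sym (^^-*-distrib r r⁻ (10 ℕ.* R))) (trans (cong (_^^ (10 ℕ.* R)) rr⁻) (1^^ (10 ℕ.* R)))) (^^-* r⁻ G (2 ℕ.* m)) ⟩
      1ℚ * (r⁻ ^^ (2 ℕ.* m)) ^^ G ≡⟨ *-identityˡ _ ⟩
      (r⁻ ^^ (2 ℕ.* m)) ^^ G ≤⟨ ^^-mono G (0≤^^ (2 ℕ.* m) 0≤r⁻) r-decay ⟩
      ½ ^^ G ∎
      where
      open ≤-Reasoning
      A′ = 10 ℕ.* R ℕ.+ G ℕ.* (2 ℕ.* m)
      0≤∫r : ∀ b → 0ℚ ≤ ∫ (μ b) (r ^^_)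
      0≤∫r b = 0≤∫ (μ-pos b) (λ s → 0≤^^ s (≤-trans 0≤1 1≤r))
      r⁻≤1 : r⁻ ≤ 1ℚ
      r⁻≤1 = inv-≤ (suc (2 ℕ.* m)) {ι (2 ℕ.* m)} {1ℚ} (≤-trans (p≤q+p 0≤1) (≤-reflexive (sym (*-identityʳ (ι (suc (2 ℕ.* m)))))))
      anti : ∀ {a b} → a ℕ.≤ b → r⁻ ^^ b ≤ r⁻ ^^ a
      anti {b = b} ℕ.z≤n = subst (r⁻ ^^ b ≤_) (1^^ b) (^^-mono b 0≤r⁻ r⁻≤1)
      anti (ℕ.s≤s p) = *-monoˡ 0≤r⁻ (anti p)
      r⁻-anti : r⁻ ^^ A ≤ r⁻ ^^ A′
      r⁻-anti = anti le

    module _ {n d : ℕ} (ν : Bool → Meas (Vec Bool n)) (ν-match : Match (bits n) d ν) where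

      R : ℕ
      R = n ℕ.* t

      ρ : Bool → Meas (Vec ℕ R)
      ρ b = bind (pmap (expand t) (ν b)) (prod μ)

      -- Copying a bit for the AND is a map out of an atom and leaves the degree d alone; the OR
      -- gadget multiplies it by K.
      ρ-match : Match (rates R) (d ℕ.* K) ρ
      ρ-match = match-compose rate d K {ν = λ b → pmap (expand t) (ν b)} {κ = μ} (match-pmap {S = bits n} {T = bits R} {h = expand t} {μ = ν}
        (pb-∘ {S = bits n} {T = Pow (bits t) n} {U = bits R} {g = concat} {h = Vec.map (replicate t)}
          (pb-map {S = atom Bool} {T = bits t} {h = replicate t} (pb-atom (replicate t))) (pb-concat (atom Bool) t)) ν-match) μ-match

      ρ-1 : (∀ b → ∫ (ν b) (λ _ → 1ℚ) ≡ 1ℚ) → ∀ b → ∫ (ρ b) (λ _ → 1ℚ) ≡ 1ℚ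
      ρ-1 h b = ∫-bind-1 {μ = pmap (expand t) (ν b)} {k = prod μ} (∫-pmap-1 (expand t) {ν b} (h b)) (∫-prod-1 {κ = μ} μ-1)

      ρ-supp : ∀ b → Supp (λ s → Vec.sum s ℕ.≤ R ℕ.* m) (ρ b)
      ρ-supp b = bind-supp (supp-univ {P = λ _ → Bool} (λ _ → true) (pmap (expand t) (ν b)))
        (λ z _ → prod-supp {Q = λ {n} s → Vec.sum s ℕ.≤ n ℕ.* m} {P = ℕ._≤ m} {κ = μ} ℕ.z≤n
          (λ y ys p q → ℕ.+-mono-≤ p q) z (λ i → μ-bound (lookup z i)))

      ρ-abs : ∀ b h → ∫ (abs (ρ b)) h ≡ ∫ (abs (ν b)) (λ z → ∫ (prod μ (expand t z)) h)
      ρ-abs b h = trans (∫-abs-bind (pmap (expand t) (ν b)) (prod μ) h) (trans (∫-abs-pmap (expand t) (ν b) _)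
        (∫-cong (abs (ν b)) (λ z → cong (λ m → ∫ m h) (abs-id (μ-pos-prod (expand t z))))))

      ρ-err : (f : Vec Bool n → Bool) → ∀ b c₁ c₂ A G → 0ℚ ≤ c₁ → 0ℚ ≤ c₂ → 10 ℕ.* R ℕ.+ G ℕ.* (2 ℕ.* m) ℕ.≤ A →
        ∫ (abs (ρ b)) (λ s → err (f ∘ ands n t ∘ Vec.map pos?) b s + c₁ + c₂ * (r ^^ Vec.sum s * r⁻ ^^ A))
          ≤ ∫ (abs (ν b)) (err f b) * ((1ℚ + ε ^^ t) ^^ n + c₁ + c₂ * ½ ^^ G)
      ρ-err f b c₁ c₂ A G 0≤c₁ 0≤c₂ le = begin
        ∫ (abs (ρ b)) h ≡⟨ ρ-abs b h ⟩
        ∫ (abs (ν b)) (λ z → ∫ (prod μ (expand t z)) h) ≤⟨ ∫-mono (abs-pos (ν b)) each ⟩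
        ∫ (abs (ν b)) (λ z → err f b z * C) ≡⟨ ∫-*ʳ (abs (ν b)) C (err f b) ⟩
        ∫ (abs (ν b)) (err f b) * C ∎
        where
        open ≤-Reasoning
        ef : Vec ℕ R → ℚ
        ef = err (f ∘ ands n t ∘ Vec.map pos?) b
        h : Vec ℕ R → ℚ
        h s = ef s + c₁ + c₂ * (r ^^ Vec.sum s * r⁻ ^^ A)
        C = (1ℚ + ε ^^ t) ^^ n + c₁ + c₂ * ½ ^^ G
        ands-concat : ∀ {n} (S : Vec (Vec ℕ t) n) → ands n t (Vec.map pos? (concat S)) ≡ Vec.map any⁺ S
        ands-concat {n} S = trans (cong (ands n t) (sym (concat-map S)))
          (trans (cong (Vec.map conj) (chunks-concat (Vec.map (Vec.map pos?) S))) (sym (Vec.map-∘ conj (Vec.map pos?) S)))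
          where
          concat-map : ∀ {n} (S : Vec (Vec ℕ t) n) → concat (Vec.map (Vec.map pos?) S) ≡ Vec.map pos? (concat S)
          concat-map []      = refl
          concat-map (s ∷ S) = trans (cong (Vec.map pos? s Vec.++_) (concat-map S)) (sym (Vec.map-++ pos? s (concat S)))
        e-bound : ∀ z → ∫ (prod μ (expand t z)) ef ≤ err f b z * (1ℚ + ε ^^ t) ^^ n
        e-bound z = ≤-trans (≤-reflexive (trans (∫-prod-concat μ (replicate t) z ef)
            (∫-cong (prod copies z) (λ S → cong (λ x → 1ℚ + 𝟙 (neq (f x) b)) (ands-concat S)))))
          (prod-err any⁺ copies (λ b → μ-pos-prod (replicate t b)) copies-err f b z)
        each : ∀ z → ∫ (prod μ (expand t z)) h ≤ err f b z * C
        each z = begin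
          ∫ P h ≡⟨ trans (∫-+ P _ _) (cong₂ _+_ (∫-+ P ef (λ _ → c₁)) (∫-*ˡ P c₂ _)) ⟩
          ∫ P ef + ∫ P (λ _ → c₁) + c₂ * ∫ P (λ s → r ^^ Vec.sum s * r⁻ ^^ A)
            ≤⟨ +-mono-≤ (+-mono-≤ (e-bound z) (≤-reflexive (trans (∫-const P c₁) (trans (cong (c₁ *_) (∫-prod-1 {κ = μ} μ-1 (expand t z))) (*-identityʳ c₁)))))
                 (*-monoˡ 0≤c₂ (r-tail (expand t z) A G le)) ⟩
          E * X′ + c₁ + c₂ * ½ ^^ G ≤⟨ +-mono-≤ (+-monoʳ-≤ (E * X′) (up 0≤c₁)) (up (0≤* 0≤c₂ (0≤^^ G 0≤½))) ⟩
          E * X′ + E * c₁ + E * (c₂ * ½ ^^ G)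
            ≡⟨ solve 4 (λ a x y z → a :* x :+ a :* y :+ a :* z := a :* (x :+ y :+ z)) refl E X′ c₁ (c₂ * ½ ^^ G) ⟩
          E * C ∎
          where
          P = prod μ (expand t z)
          E = err f b z
          X′ = (1ℚ + ε ^^ t) ^^ n
          -- As `err` is at least 1, additive constants may be multiplied by it.
          up : ∀ {c} → 0ℚ ≤ c → c ≤ E * c
          up {c} 0≤c = subst (_≤ E * c) (*-identityˡ c) (*-monoʳ 0≤c (1≤1+𝟙 (neq (f z) b)))

  -- Monotone certificates.

  TrueOn : Vec Bool n → List (Fin n) → Set
  TrueOn u = All (λ i → lookup u i ≡ true)

  -- In particular f is monotone.
  MonoCert : (Vec Bool n → Bool) → ℕ → Set
  MonoCert {n} f w = ∀ u → f u ≡ true → Σ (List (Fin n)) λ P →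
    List.length P ℕ.≤ w × TrueOn u P × (∀ u′ → TrueOn u′ P → f u′ ≡ true)

  mc-compose : ∀ {R} {f : Vec Bool R → Bool} {h : Fin R → Vec Bool n → Bool} →
    MonoCert f w → (∀ v → MonoCert (h v) w′) → MonoCert (λ u → f (tabulate (λ v → h v u))) (w ℕ.* w′)
  mc-compose {n} {w} {w′} {R} {f} {h} mf mh u fu with mf (tabulate (λ v → h v u)) fu
  ... | P , P≤ , Pt , force with collect P Pt
    where
    collect : ∀ P → TrueOn (tabulate (λ v → h v u)) P → Σ (List (Fin n)) λ Q →
      List.length Q ℕ.≤ List.length P ℕ.* w′ × TrueOn u Q ×
      (∀ u′ → TrueOn u′ Q → TrueOn (tabulate (λ v → h v u′)) P)
    collect []      []       = [] , ℕ.z≤n , [] , λ _ _ → []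
    collect (v ∷ P) (p ∷ ps) with mh v u (trans (sym (Vec.lookup∘tabulate (λ v → h v u) v)) p) | collect P ps
    ... | Q₁ , l₁ , t₁ , f₁ | Q₂ , l₂ , t₂ , f₂ = Q₁ ++ Q₂ ,
      ℕ.≤-trans (ℕ.≤-reflexive (List.length-++ Q₁)) (ℕ.+-mono-≤ l₁ l₂) , All.++⁺ t₁ t₂ ,
      λ u′ t → trans (Vec.lookup∘tabulate (λ v → h v u′) v) (f₁ u′ (All.++⁻ˡ Q₁ t)) ∷ f₂ u′ (All.++⁻ʳ Q₁ t)
  ... | Q , Q≤ , Qt , g = Q , ℕ.≤-trans Q≤ (ℕ.*-monoˡ-≤ w′ P≤) , Qt , λ u′ t → force _ (g u′ t)

  lookup-take : ∀ {A : Set} m {n} (u : Vec A (m ℕ.+ n)) i → lookup u (i ↑ˡ n) ≡ lookup (Vec.take m u) i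
  lookup-take (suc m) (x ∷ u) zero    = refl
  lookup-take (suc m) (x ∷ u) (suc i) = lookup-take m u i

  lookup-drop : ∀ {A : Set} m {n} (u : Vec A (m ℕ.+ n)) i → lookup u (m ↑ʳ i) ≡ lookup (Vec.drop m u) i
  lookup-drop zero    u       i = refl
  lookup-drop (suc m) (x ∷ u) i = lookup-drop m u i

  mc-reindex : ∀ {m} {f : Vec Bool m → Bool} (π : Fin m → Fin n) (p : Vec Bool n → Vec Bool m) →
    (∀ u i → lookup u (π i) ≡ lookup (p u) i) → MonoCert f w → MonoCert (f ∘ p) w
  mc-reindex π p h mf u fu with mf (p u) fu
  ... | P , P≤ , Pt , force = List.map π P , ℕ.≤-trans (ℕ.≤-reflexive (List.length-map π P)) P≤ ,
    All.map⁺ (All.map (λ {i} e → trans (h u i) e) Pt) ,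
    λ u′ t → force (p u′) (All.map (λ {i} e → trans (sym (h u′ i)) e) (All.map⁻ t))

  mc-take : ∀ m {f : Vec Bool m → Bool} → MonoCert f w → MonoCert (λ (u : Vec Bool (m ℕ.+ n)) → f (Vec.take m u)) w
  mc-take {n = n} m = mc-reindex (_↑ˡ n) (Vec.take m) (lookup-take m)

  mc-drop : ∀ m {f : Vec Bool n → Bool} → MonoCert f w → MonoCert (λ (u : Vec Bool (m ℕ.+ n)) → f (Vec.drop m u)) w
  mc-drop m = mc-reindex (m ↑ʳ_) (Vec.drop m) (lookup-drop m)

  -- A disjunction needs a witness for one side only, so its width does not grow. This keeps `seen`
  -- as narrow as a single address, however many slots there are.
  mc-∨ : ∀ {f g : Vec Bool n → Bool} → MonoCert f w → MonoCert g w → MonoCert (λ u → f u ∨ g u) w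
  mc-∨ {f = f} {g} mf mg u e with f u in fu
  ... | true  with mf u fu
  ...   | P , l , t , force = P , l , t , λ u′ t′ → cong (_∨ g u′) (force u′ t′)
  mc-∨ {f = f} {g} mf mg u e | false with mg u e
  ...   | P , l , t , force = P , l , t , λ u′ t′ → trans (cong (f u′ ∨_) (force u′ t′)) (∨-zeroʳ (f u′))

  mc-chunk : ∀ n b {g : Vec Bool b → Bool} → MonoCert g w → ∀ j → MonoCert (λ u → g (lookup (chunks n b u) j)) w
  mc-chunk (suc n) b mg zero    = mc-take b mg
  mc-chunk (suc n) b mg (suc j) = mc-drop b (mc-chunk n b mg j)

  mc-cong : ∀ {f g : Vec Bool n → Bool} → (∀ u → f u ≡ g u) → MonoCert f w → MonoCert g w
  mc-cong h mf u e with mf u (trans (h u) e)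
  ... | P , l , t , force = P , l , t , λ u′ t′ → trans (sym (h u′)) (force u′ t′)

  mc-blocks : ∀ n b {f : Vec Bool n → Bool} {g : Vec Bool b → Bool} → MonoCert f w → MonoCert g w′ →
    MonoCert (λ u → f (Vec.map g (chunks n b u))) (w ℕ.* w′)
  mc-blocks n b {f} {g} mf mg = mc-cong
    (λ u → cong f (trans (Vec.tabulate-cong (λ j → sym (Vec.lookup-map j g (chunks n b u)))) (Vec.tabulate∘lookup _)))
    (mc-compose mf (mc-chunk n b mg))

  ∧-true : ∀ {a b} → a ∧ b ≡ true → a ≡ true × b ≡ true
  ∧-true {true} {true} e = refl , refl

  mc-∧ : ∀ {f g : Vec Bool n → Bool} → MonoCert f w → MonoCert g w′ → MonoCert (λ u → f u ∧ g u) (w ℕ.+ w′)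
  mc-∧ mf mg u e with mf u (proj₁ (∧-true e)) | mg u (proj₂ (∧-true e))
  ... | P₁ , l₁ , t₁ , f₁ | P₂ , l₂ , t₂ , f₂ = P₁ ++ P₂ ,
    ℕ.≤-trans (ℕ.≤-reflexive (List.length-++ P₁)) (ℕ.+-mono-≤ l₁ l₂) , All.++⁺ t₁ t₂ ,
    λ u′ t → cong₂ _∧_ (f₁ u′ (All.++⁻ˡ P₁ t)) (f₂ u′ (All.++⁻ʳ P₁ t))

  mc-head : MonoCert {suc n} Vec.head 1
  mc-head (true ∷ u) e = zero ∷ [] , ℕ.≤-refl , refl ∷ [] , λ { (b ∷ u′) (p ∷ []) → p }

  mc-conj : ∀ t → MonoCert (conj {t}) t
  mc-conj zero    u e = [] , ℕ.z≤n , [] , λ { [] _ → refl }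
  mc-conj (suc t) = mc-cong (λ { (b ∷ u) → refl }) (mc-∧ mc-head (mc-drop 1 (mc-conj t)))

  -- Addresses in dual-rail encoding: each bit b is stored as the pair b, ¬b, so that codewords form an antichain.

  -- 2^l as an iterated sum, the shape on which `splitAt` reads off one address bit.
  pw : ℕ → ℕ
  pw zero    = 1
  pw (suc l) = pw l ℕ.+ pw l

  pw≡ : ∀ l → pw l ≡ 2 ℕ.^ l
  pw≡ zero    = refl
  pw≡ (suc l) = cong₂ ℕ._+_ (pw≡ l) (trans (pw≡ l) (sym (ℕ.+-identityʳ _)))

  address : ∀ l → Fin (pw l) → Vec Bool l
  address zero    i = []
  address (suc l) i with splitAt (pw l) i
  ... | inj₁ j = false ∷ address l j
  ... | inj₂ j = true ∷ address l j

  decode : ∀ {l} → Vec Bool l → Fin (pw l)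
  decode []                = zero
  decode {suc l} (false ∷ c) = decode c ↑ˡ pw l
  decode {suc l} (true ∷ c)  = pw l ↑ʳ decode c

  decode-address : ∀ l i → decode (address l i) ≡ i
  decode-address zero    zero = refl
  decode-address (suc l) i with splitAt (pw l) i | Fin.join-splitAt (pw l) (pw l) i
  ... | inj₁ j | eq = trans (cong (_↑ˡ pw l) (decode-address l j)) eq
  ... | inj₂ j | eq = trans (cong (pw l ↑ʳ_) (decode-address l j)) eq

  rail : ∀ {l} → Vec Bool l → Vec Bool (l ℕ.* 2)
  rail []      = []
  rail (b ∷ c) = b ∷ not b ∷ rail c

  hits : ∀ {l} → Vec Bool l → Vec Bool (l ℕ.* 2) → Bool
  hits []      u           = true
  hits (b ∷ c) (p ∷ q ∷ u) = (if b then p else q) ∧ hits c u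

  mc-hits : ∀ {l} (c : Vec Bool l) → MonoCert (hits c) l
  mc-hits []          u e = [] , ℕ.z≤n , [] , λ _ _ → refl
  mc-hits (true ∷ c)  = mc-cong (λ { (p ∷ q ∷ u) → refl }) (mc-∧ mc-head (mc-drop 2 (mc-hits c)))
  mc-hits (false ∷ c) = mc-cong (λ { (p ∷ q ∷ u) → refl }) (mc-∧ (mc-drop 1 mc-head) (mc-drop 2 (mc-hits c)))

  hits-self : ∀ {l} (c : Vec Bool l) → hits c (rail c) ≡ true
  hits-self []          = refl
  hits-self (true ∷ c)  = hits-self c
  hits-self (false ∷ c) = hits-self c

  hits-only : ∀ {l} (c d : Vec Bool l) → hits c (rail d) ≡ true → c ≡ d
  hits-only []          []          e = refl
  hits-only (true ∷ c)  (true ∷ d)  e = cong (true ∷_) (hits-only c d e)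
  hits-only (false ∷ c) (false ∷ d) e = cong (false ∷_) (hits-only c d e)

  ≡ᶠ-refl : ∀ {R} (v : Fin R) → (v ≡ᶠ v) ≡ true
  ≡ᶠ-refl zero    = refl
  ≡ᶠ-refl (suc v) = ≡ᶠ-refl v

  ≡ᶠ-sound : ∀ {R} (v w : Fin R) → (v ≡ᶠ w) ≡ true → v ≡ w
  ≡ᶠ-sound zero    zero    e = refl
  ≡ᶠ-sound (suc v) (suc w) e = cong suc (≡ᶠ-sound v w e)

  module Encoding {R l : ℕ} (R≤ : R ℕ.≤ pw (suc l)) where

    Slot : Set
    Slot = Vec Bool (suc l ℕ.* 2)

    name : Fin R → Vec Bool (suc l)
    name v = address (suc l) (inject≤ v R≤)

    name-injective : ∀ {v w} → name v ≡ name w → v ≡ w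
    name-injective {v} {w} e = Fin.inject≤-injective R≤ R≤ v w
      (trans (sym (decode-address (suc l) _)) (trans (cong decode e) (decode-address (suc l) _)))

    -- All false is no codeword: an address has at least one bit, and either value of it asks for a
    -- true rail.
    null : Slot
    null = replicate _ false

    elt : Fin R → Slot
    elt v = rail (name v)

    hit : Fin R → Slot → Bool
    hit v = hits (name v)

    hit-null : ∀ v → hit v null ≡ false
    hit-null v with name v
    ... | true ∷ c  = refl
    ... | false ∷ c = refl

    hit-elt : ∀ v w → hit v (elt w) ≡ (v ≡ᶠ w)
    hit-elt v w with hit v (elt w) in e₁ | v ≡ᶠ w in e₂
    ... | true  | true  = refl
    ... | false | false = refl
    ... | true  | false = trans (sym (≡ᶠ-refl v)) (trans (cong (v ≡ᶠ_) (name-injective {v} {w} (hits-only _ _ e₁))) e₂)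
    ... | false | true  = sym (trans (sym (hits-self (name v))) (trans (cong (λ w → hit v (elt w)) (≡ᶠ-sound v w e₂)) e₁))

  -- Hard pairs and one round of amplification.

  -- f has width-w monotone certificates, while the signed measures μ true and μ false, nearly concentrated on
  -- f⁻¹(true) and f⁻¹(false), cannot be told apart by polynomials of degree below d.
  record Hard (n d w : ℕ) (J : ℚ) : Set where
    field
      f       : Vec Bool n → Bool
      mono    : MonoCert f w
      μ       : Bool → Meas (Vec Bool n)
      match   : Match (bits n) d μ
      μ-1     : ∀ b → ∫ (μ b) (λ _ → 1ℚ) ≡ 1ℚ
      J-bound : ∀ b → ∫ (abs (μ b)) (err f b) ≤ J

  hard₀ : Hard 1 1 1 1ℚ
  hard₀ .Hard.f (b ∷ []) = b
  hard₀ .Hard.mono = mc-cong (λ { (b ∷ []) → refl }) mc-head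
  hard₀ .Hard.μ b = δ (b ∷ [])
  hard₀ .Hard.match {zero} lt t = cong (λ x → 1ℚ * x + 0ℚ) (trans (test₀ t (true ∷ [])) (sym (test₀ t (false ∷ []))))
  hard₀ .Hard.match {suc e} (ℕ.s≤s ()) t
  hard₀ .Hard.μ-1 b = refl
  hard₀ .Hard.J-bound true  = ≤-refl
  hard₀ .Hard.J-bound false = ≤-refl

  weaken : ∀ {n d w J J′} → J ≤ J′ → Hard n d w J → Hard n d w J′
  weaken J≤J′ hard = record
    { f = f ; mono = mono ; μ = μ ; match = match ; μ-1 = μ-1 ; J-bound = λ b → ≤-trans (J-bound b) J≤J′ }
    where open Hard hard

  -- A test of e bits meets at most e slots, and its effect within a slot is one function of that
  -- slot.
  pb-slots : ∀ {N} b → PullsBack (Pow (atom (Vec Bool b)) N) (bits (N ℕ.* b)) concat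
  pb-slots {N} b t with pb-concat (atom Bool) b {N} t
  ... | e₁ , t₁ , le₁ , eq₁ with pb-map {S = atom (Vec Bool b)} {T = bits b} {h = λ x → x} (pb-atom (λ x → x)) t₁
  ...   | e₂ , t₂ , le₂ , eq₂ = e₂ , t₂ , ℕ.≤-trans le₂ le₁ ,
    λ x → trans (eq₁ x) (trans (cong (evP (bits b) t₁) (sym (Vec.map-id x))) (eq₂ x))

  module _ {n d w J} (hard : Hard n d w J) (K : ℕ) .{{_ : ℕ.NonZero K}} (t l T A G H : ℕ)
    .{{_ : ℕ.NonZero A}} .{{_ : ℕ.NonZero H}} where

    open Hard hard

    private
      m R : ℕ
      m = 4 ℕ.* (K ℕ.* K)
      R = n ℕ.* t

    -- In this order: all copies of some false bit are positive; some name of positive multiplicity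
    -- occurs in no slot; the capacity is exceeded, weighted by the norm of the extrapolation.
    loss : ℚ
    loss = (1ℚ + (1ℚ - ½ * η) ^^ t) ^^ n + ι R * ½ ^^ T + (ι 2 * (1ℚ + ι 2 * ι H) ^^ (d ℕ.* K)) * ½ ^^ G

    step′ : ∀ N₀ → N₀ ≡ suc K ℕ.+ K → R ℕ.≤ pw (suc l) → 10 ℕ.* R ℕ.+ G ℕ.* (2 ℕ.* m) ℕ.≤ A →
      (d ℕ.* K) ℕ.* (R ℕ.* m) ℕ.≤ H →
      Hard ((T ℕ.* A) ℕ.* (suc l ℕ.* 2)) (d ℕ.* K) (w ℕ.* t ℕ.* suc l) (J * loss)
    step′ N₀ N₀≡ R≤ A≥ H≥ = record
      { f = f⁺ ; mono = mono⁺ ; μ = μ⁺ ; match = match⁺ ; μ-1 = μ⁺-1 ; J-bound = J⁺ }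
      where
      module RS = RateStage K N₀ N₀≡ t
      open Encoding {R} {l} R≤
      module S = Slots null elt hit hit-null hit-elt
      module Tr = S.Truncated T A (d ℕ.* K) H (R ℕ.* m) H≥

      N : ℕ
      N = T ℕ.* A

      f⁺ : Vec Bool (N ℕ.* (suc l ℕ.* 2)) → Bool
      f⁺ u = f (ands n t (S.seenAll (chunks N (suc l ℕ.* 2) u)))

      mc-seen : ∀ N v → MonoCert (λ u → S.seen v (chunks N (suc l ℕ.* 2) u)) (suc l)
      mc-seen zero    v u ()
      mc-seen (suc N) v = mc-∨ (mc-take _ (mc-hits (name v))) (mc-drop _ (mc-seen N v))

      mono⁺ : MonoCert f⁺ (w ℕ.* t ℕ.* suc l)
      mono⁺ = mc-compose (mc-blocks n t mono (mc-conj t)) (mc-seen N)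

      ρ : Bool → Meas (Vec ℕ R)
      ρ = RS.ρ μ match

      μ⁺ : Bool → Meas (Vec Bool (N ℕ.* (suc l ℕ.* 2)))
      μ⁺ b = pmap concat (bind (ρ b) Tr.Φ)

      match⁺ : Match (bits (N ℕ.* (suc l ℕ.* 2))) (d ℕ.* K) μ⁺
      match⁺ = match-pmap {S = Pow (atom Slot) N} {T = bits (N ℕ.* (suc l ℕ.* 2))} {h = concat} {μ = λ b → bind (ρ b) Tr.Φ}
        (pb-slots (suc l ℕ.* 2)) (Tr.match-slots {ρ = ρ} (ℕ.n≤1+n _) (RS.ρ-match μ match))

      μ⁺-1 : ∀ b → ∫ (μ⁺ b) (λ _ → 1ℚ) ≡ 1ℚ
      μ⁺-1 b = ∫-pmap-1 concat {bind (ρ b) Tr.Φ} (∫-bind-1 {μ = ρ b} {k = Tr.Φ} (RS.ρ-1 μ match μ-1 b)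
        (λ s → Tr.choose-1 s (Vec.sum s ℕ.≤? A)))

      J⁺ : ∀ b → ∫ (abs (μ⁺ b)) (err f⁺ b) ≤ J * loss
      J⁺ b = begin
        ∫ (abs (μ⁺ b)) (err f⁺ b) ≡⟨ ∫-abs-pmap {X = Vec Slot N} concat (bind (ρ b) Tr.Φ) (err f⁺ b) ⟩
        ∫ (abs (bind (ρ b) Tr.Φ)) (err f⁺ b ∘ concat) ≡⟨ ∫-cong (abs (bind (ρ b) Tr.Φ)) (λ x →
            cong (λ y → 1ℚ + 𝟙 (neq (f (ands n t (S.seenAll y))) b)) (chunks-concat x)) ⟩
        ∫ (abs (bind (ρ b) Tr.Φ)) h ≡⟨ ∫-abs-bind (ρ b) Tr.Φ h ⟩
        ∫ (abs (ρ b)) (λ s → ∫ (abs (Tr.Φ s)) h) ≤⟨ ∫-monoS (abs-pos (ρ b)) (abs-supp (RS.ρ-supp μ match b))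
            (λ s s≤ → Tr.choose-J RS.r RS.r⁻ RS.1≤r RS.0≤r⁻ RS.rr⁻ (f ∘ ands n t) b s (Vec.sum s ℕ.≤? A) s≤) ⟩
        ∫ (abs (ρ b)) (λ s → err (f ∘ ands n t ∘ Vec.map pos?) b s + c₁ + c₂ * (RS.r ^^ Vec.sum s * RS.r⁻ ^^ A))
          ≤⟨ RS.ρ-err μ match f b c₁ c₂ A G (0≤* (0≤ι R) (0≤^^ T 0≤½)) 0≤c₂ A≥ ⟩
        ∫ (abs (μ b)) (err f b) * loss ≤⟨ *-monoʳ 0≤loss (J-bound b) ⟩
        J * loss ∎
        where
        open ≤-Reasoning
        c₁ c₂ : ℚ
        c₁ = ι R * ½ ^^ T
        c₂ = ι 2 * (1ℚ + ι 2 * ι H) ^^ (d ℕ.* K)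
        0≤c₂ : 0ℚ ≤ c₂
        0≤c₂ = 0≤* (0≤ι 2) (0≤^^ (d ℕ.* K) (0≤+ 0≤1 (0≤* (0≤ι 2) (0≤ι H))))
        h : Vec Slot N → ℚ
        h = err (f ∘ ands n t ∘ S.seenAll) b
        0≤loss : 0ℚ ≤ loss
        0≤loss = 0≤+ (0≤+ (0≤^^ n (0≤+ 0≤1 (0≤^^ t (nonNegative⁻¹ (1ℚ - ½ * η))))) (0≤* (0≤ι R) (0≤^^ T 0≤½)))
          (0≤* 0≤c₂ (0≤^^ G 0≤½))

    step : R ℕ.≤ pw (suc l) → 10 ℕ.* R ℕ.+ G ℕ.* (2 ℕ.* m) ℕ.≤ A → (d ℕ.* K) ℕ.* (R ℕ.* m) ℕ.≤ H →
      Hard ((T ℕ.* A) ℕ.* (suc l ℕ.* 2)) (d ℕ.* K) (w ℕ.* t ℕ.* suc l) (J * loss)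
    step = step′ _ refl

  -- An approximating p would have the same integral against both measures, but an error of at most
  -- 5/4 puts these integrals within 5/6 of 1 and of -1 respectively.
  no-approx : ∀ {n D k} (F : BoolFn n) (μ : Bool → Meas (Cube n)) → Match (bits n) D μ →
    (∀ b → ∫ (μ b) (λ _ → 1ℚ) ≡ 1ℚ) → (∀ b → ∫ (abs (μ b)) (err F b) ≤ 1ℚ + ½ * ½) →
    k ℕ.< D → ¬ ApproxDegAtMost F k
  no-approx F μ mt mass J≤ k<D (p , deg , approx) = toWitnessFalse {a? = c ≤? - c} _ (begin
      c ≤⟨ lower ⟩
      ∫ (μ true) (eval p) ≡⟨ match-eval {μ = μ} mt k<D p deg ⟩
      ∫ (μ false) (eval p) ≤⟨ upper ⟩
      - c ∎)
    where
    open ≤-Reasoning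
    third c : ℚ
    third = int 1 / 3
    c = int 1 / 6
    -- |p - val b| ≤ 1/3 + 2 [F ≠ b] = 2 err - 5/3, and the total variation is at least 1.
    close : ∀ b x → ∣ eval p x - val b ∣ ≤ ι 2 * err F b x + - (ι 5 * third)
    close b x = ≤-trans (≤-reflexive (cong ∣_∣ (solve 3 (λ a v w → a :- w := (a :- v) :+ (v :- w)) refl (eval p x) (val (F x)) (val b))))
      (≤-trans (∣p+q∣≤∣p∣+∣q∣ (eval p x - val (F x)) (val (F x) - val b)) (≤-trans (+-mono-≤ (approx x) (gap (F x) b)) (≤-reflexive (eq (𝟙 (neq (F x) b))))))
      where
      gap : ∀ a b → ∣ val a - val b ∣ ≤ ι 2 * 𝟙 (neq a b)
      gap true  true  = ≤-refl
      gap true  false = ≤-refl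
      gap false true  = ≤-refl
      gap false false = ≤-refl
      eq : ∀ i → third + ι 2 * i ≡ ι 2 * (1ℚ + i) + - (ι 5 * third)
      eq = solve 1 (λ i → con third :+ con (ι 2) :* i := con (ι 2) :* (con 1ℚ :+ i) :+ con (- (ι 5 * third))) refl
    1≤∥∥ : ∀ b → 1ℚ ≤ ∫ (abs (μ b)) (λ _ → 1ℚ)
    1≤∥∥ b = ≤-trans (≤-reflexive (sym (mass b))) (≤-trans (p≤∣p∣ (∫ (μ b) (λ _ → 1ℚ))) (∣∫∣≤ (μ b) (λ _ → 1ℚ)))
    dist≤ : ∀ b → ∣ ∫ (μ b) (eval p) - val b ∣ ≤ 1ℚ - c
    dist≤ b = begin
      ∣ ∫ (μ b) (eval p) - val b ∣
        ≡⟨ cong ∣_∣ (trans (cong (∫ (μ b) (eval p) +_) (sym (trans (∫-const (μ b) (- val b)) (trans (cong (- val b *_) (mass b)) (*-identityʳ (- val b))))))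
          (sym (∫-+ (μ b) (eval p) (λ _ → - val b)))) ⟩
      ∣ ∫ (μ b) (λ x → eval p x - val b) ∣ ≤⟨ ∣∫∣≤ (μ b) _ ⟩
      ∫ (abs (μ b)) (λ x → ∣ eval p x - val b ∣) ≤⟨ ∫-mono (abs-pos (μ b)) (close b) ⟩
      ∫ (abs (μ b)) (λ x → ι 2 * err F b x + - (ι 5 * third))
        ≡⟨ trans (∫-+ (abs (μ b)) _ _) (cong₂ _+_ (∫-*ˡ (abs (μ b)) (ι 2) (err F b)) (∫-const (abs (μ b)) (- (ι 5 * third)))) ⟩
      ι 2 * ∫ (abs (μ b)) (err F b) + - (ι 5 * third) * ∫ (abs (μ b)) (λ _ → 1ℚ)
        ≤⟨ +-mono-≤ (*-monoˡ (0≤ι 2) (J≤ b)) (*-monoˡ-≤-nonPos (- (ι 5 * third)) (1≤∥∥ b)) ⟩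
      ι 2 * (1ℚ + ½ * ½) + - (ι 5 * third) * 1ℚ ≡⟨⟩
      1ℚ - c ∎
    lower : c ≤ ∫ (μ true) (eval p)
    lower = 0≤q-p⇒p≤q (subst (0ℚ ≤_) (solve 1 (λ x → con (1ℚ - c) :- (:- (x :- con 1ℚ)) := x :- con c) refl (∫ (μ true) (eval p)))
      (p≤q⇒0≤q-p (≤-trans (-p≤∣p∣ (∫ (μ true) (eval p) - 1ℚ)) (dist≤ true))))
    upper : ∫ (μ false) (eval p) ≤ - c
    upper = 0≤q-p⇒p≤q (subst (0ℚ ≤_) (solve 1 (λ x → con (1ℚ - c) :- (x :- con (- 1ℚ)) := con (- c) :- x) refl (∫ (μ false) (eval p)))
      (p≤q⇒0≤q-p (≤-trans (p≤∣p∣ (∫ (μ false) (eval p) - - 1ℚ)) (dist≤ false))))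

  -- Composition with the dual-rail version, and guards.

  mergeT : ∀ {X n e e′} (t : PowT (atom X) n e) (t′ : PowT (atom X) n e′) → Σ ℕ λ e″ → Σ (PowT (atom X) n e″) λ t″ →
    e″ ℕ.≤ e ℕ.+ e′ × (∀ x → evP (atom X) t x * evP (atom X) t′ x ≡ evP (atom X) t″ x)
  mergeT [] [] = 0 , [] , ℕ.z≤n , λ x → refl
  mergeT {X} {e = e} {e′} (_∷ₜ_ {e = a} {e′ = r} t ts) (_∷ₜ_ {e = a′} {e′ = r′} t′ ts′) with mergeA t t′ | mergeT ts ts′
    where
    mergeA : ∀ {a a′} (t : AtomT X a) (t′ : AtomT X a′) → Σ ℕ λ a″ → Σ (AtomT X a″) λ t″ → a″ ℕ.≤ a ℕ.+ a′ ×
      (∀ x → Space.ev (atom X) t x * Space.ev (atom X) t′ x ≡ Space.ev (atom X) t″ x)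
    mergeA one    one     = 0 , one , ℕ.z≤n , λ x → refl
    mergeA one    (fn f)  = 1 , fn f , ℕ.≤-refl , λ x → *-identityˡ (f x)
    mergeA (fn f) one     = 1 , fn f , ℕ.≤-refl , λ x → *-identityʳ (f x)
    mergeA (fn f) (fn g)  = 1 , fn (λ x → f x * g x) , ℕ.s≤s ℕ.z≤n , λ x → refl
  ... | a″ , t₁ , l₁ , h₁ | r″ , t₂ , l₂ , h₂ = a″ ℕ.+ r″ , t₁ ∷ₜ t₂ ,
    ℕ.≤-trans (ℕ.+-mono-≤ l₁ l₂) (ℕ.≤-reflexive (solveℕ 4 (λ a b c d → (a ⊕ b) ⊕ (c ⊕ d) ⊜ (a ⊕ c) ⊕ (b ⊕ d)) refl a a′ r r′)) ,
    λ { (x ∷ xs) → trans (solve 4 (λ a b c d → (a :* b) :* (c :* d) := (a :* c) :* (b :* d)) refl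
          (Space.ev (atom X) t x) (evP (atom X) ts xs) (Space.ev (atom X) t′ x) (evP (atom X) ts′ xs)) (cong₂ _*_ (h₁ x) (h₂ xs)) }

  dual : ∀ {n} → Vec Bool n → Vec Bool (n ℕ.+ n)
  dual x = x Vec.++ Vec.map not x

  -- A factor on a bit and one on its negation merge into a single function of that bit, so doubling
  -- the input does not raise the degree.
  pb-dual : ∀ {n} → PullsBack (bits n) (bits (n ℕ.+ n)) dual
  pb-dual {n} t with splitT (atom Bool) n t
  ... | e₁ , e₂ , t₁ , t₂ , refl , h with pb-map {S = atom Bool} {T = atom Bool} {h = not} pb-not t₂
    where
    pb-not : PullsBack (atom Bool) (atom Bool) not
    pb-not one    = 0 , one , ℕ.z≤n , λ x → refl
    pb-not (fn f) = 1 , fn (f ∘ not) , ℕ.≤-refl , λ x → refl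
  ... | e₃ , t₃ , le , h₃ with mergeT t₁ t₃
  ...   | e₄ , t₄ , le₄ , h₄ = e₄ , t₄ , ℕ.≤-trans le₄ (ℕ.+-monoʳ-≤ e₁ le) ,
    λ x → trans (h x (Vec.map not x)) (trans (cong (evP (atom Bool) t₁ x *_) (h₃ x)) (h₄ x))

  match-prefix : ∀ {m n d} (a : Vec Bool m) {μ : Bool → Meas (Vec Bool n)} → Match (bits n) d μ →
    Match (bits (m ℕ.+ n)) d (λ b → pmap (a Vec.++_) (μ b))
  match-prefix {m} a {μ} mt lt t with splitT (atom Bool) m t
  ... | e₁ , e₂ , t₁ , t₂ , refl , h = trans (ex true) (trans (cong (evP (atom Bool) t₁ a *_)
      (mt (ℕ.≤-<-trans (ℕ.m≤n+m e₂ e₁) lt) t₂)) (sym (ex false)))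
    where
    ex : ∀ b → ∫ (pmap (a Vec.++_) (μ b)) (evP (atom Bool) t) ≡ evP (atom Bool) t₁ a * ∫ (μ b) (evP (atom Bool) t₂)
    ex b = trans (∫-pmap (a Vec.++_) (μ b) _) (trans (∫-cong (μ b) (h a)) (∫-*ˡ (μ b) (evP (atom Bool) t₁ a) (evP (atom Bool) t₂)))

  Cert : ∀ {n} → (Vec Bool n → Bool) → Vec Bool n → List (Fin n) → Set
  Cert F x P = ∀ y → All (λ i → lookup y i ≡ lookup x i) P → F y ≡ F x

  FalseOn : ∀ {n} → Vec Bool n → List (Fin n) → Set
  FalseOn u = All (λ i → lookup u i ≡ false)

  conj-false : ∀ {t} (x : Vec Bool t) → conj x ≡ false → Σ (Fin t) λ i → lookup x i ≡ false
  conj-false (false ∷ x) e = zero , refl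
  conj-false (true ∷ x)  e with conj-false x e
  ... | i , h = suc i , h

  false-conj : ∀ {t} (x : Vec Bool t) i → lookup x i ≡ false → conj x ≡ false
  false-conj (false ∷ x) zero    e = refl
  false-conj (false ∷ x) (suc i) e = refl
  false-conj (true ∷ x)  (suc i) e = false-conj x i e

  conj-all : ∀ {t} (x : Vec Bool t) → (∀ i → lookup x i ≡ true) → conj x ≡ true
  conj-all []      h = refl
  conj-all (b ∷ x) h = cong₂ _∧_ (h zero) (conj-all x (h ∘ suc))

  all-conj : ∀ {t} (x : Vec Bool t) → conj x ≡ true → ∀ i → lookup x i ≡ true
  all-conj (true ∷ x) e zero    = refl
  all-conj (true ∷ x) e (suc i) = all-conj x e i

  trueSet : ∀ {n} (x : Vec Bool n) → Σ (List (Fin n)) λ P → List.length P ℕ.≤ n × TrueOn x P ×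
    (∀ y → TrueOn y P → ∀ i → lookup x i ≡ true → lookup y i ≡ true)
  trueSet []      = [] , ℕ.z≤n , [] , λ y t ()
  trueSet (b ∷ x) with trueSet x
  ... | P , l , t , h with b
  ...   | false = List.map suc P , ℕ.m≤n⇒m≤1+n (ℕ.≤-trans (ℕ.≤-reflexive (List.length-map suc P)) l) , All.map⁺ t ,
    λ { (c ∷ y) q (suc i) e → h y (All.map⁻ q) i e }
  ...   | true  = zero ∷ List.map suc P , ℕ.s≤s (ℕ.≤-trans (ℕ.≤-reflexive (List.length-map suc P)) l) , refl ∷ All.map⁺ t ,
    λ { (c ∷ y) (r ∷ q) zero e → r ; (c ∷ y) (r ∷ q) (suc i) e → h y (All.map⁻ q) i e }

  ∨-≡ : ∀ {a b} → a ∨ b ≡ false → a ≡ false × b ≡ false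
  ∨-≡ {false} {false} e = refl , refl

  module DualRail {n w : ℕ} (f : Vec Bool n → Bool) (mono : MonoCert f w) where

    pairs : Vec Bool (n ℕ.+ n) → Vec Bool n
    pairs u = Vec.zipWith _∨_ (Vec.take n u) (Vec.drop n u)

    inner : Vec Bool (n ℕ.+ n) → Vec Bool n
    inner u = Vec.map not (Vec.drop n u)

    -- The input of f is the negated second half: a one of it is a zero of u. The w ones that
    -- certify f thus cost w zeros, whereas a value false of f and the nonempty pairs are certified
    -- by ones alone.
    g : Vec Bool (n ℕ.+ n) → Bool
    g u = conj (pairs u) ∧ f (inner u)

    g-dual : ∀ x → g (dual x) ≡ f x
    g-dual x = cong₂ (λ a y → a ∧ f y)
      (trans (cong₂ (λ p q → conj (Vec.zipWith _∨_ p q)) (take-++ x (Vec.map not x)) (drop-++ x (Vec.map not x))) (lem x))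
      (trans (cong (Vec.map not) (drop-++ x (Vec.map not x))) (inv-not x))
      where
      lem : ∀ {n} (x : Vec Bool n) → conj (Vec.zipWith _∨_ x (Vec.map not x)) ≡ true
      lem []          = refl
      lem (true ∷ x)  = lem x
      lem (false ∷ x) = lem x
      inv-not : ∀ {n} (x : Vec Bool n) → Vec.map not (Vec.map not x) ≡ x
      inv-not []          = refl
      inv-not (true ∷ x)  = cong (true ∷_) (inv-not x)
      inv-not (false ∷ x) = cong (false ∷_) (inv-not x)

    lookup-pairs : ∀ u i → lookup (pairs u) i ≡ lookup u (i ↑ˡ n) ∨ lookup u (n ↑ʳ i)
    lookup-pairs u i = trans (Vec.lookup-zipWith _∨_ i (Vec.take n u) (Vec.drop n u))
      (sym (cong₂ _∨_ (lookup-take n u i) (lookup-drop n u i)))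

    lookup-inner : ∀ u i → lookup (inner u) i ≡ not (lookup u (n ↑ʳ i))
    lookup-inner u i = trans (Vec.lookup-map i not (Vec.drop n u)) (cong not (sym (lookup-drop n u i)))

    -- A zero of u will cost n coordinates of the composed input and a one only w, so zeros are to be used sparingly.
    g-cert : ∀ u → Σ (List (Fin (n ℕ.+ n))) λ Pz → Σ (List (Fin (n ℕ.+ n))) λ Po →
      List.length Pz ℕ.≤ w ℕ.+ 2 × List.length Po ℕ.≤ n × FalseOn u Pz × TrueOn u Po ×
      (∀ u′ → FalseOn u′ Pz → TrueOn u′ Po → g u′ ≡ g u)
    g-cert u with conj (pairs u) in e₁
    ... | false with conj-false (pairs u) e₁
    ...   | i , h with ∨-≡ (trans (sym (lookup-pairs u i)) h)
    -- An empty pair forces g to false by its two zeros, whence the 2 in w + 2.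
    ...     | p , q = (i ↑ˡ n) ∷ (n ↑ʳ i) ∷ [] , [] , ℕ.m≤n+m 2 w , ℕ.z≤n , p ∷ q ∷ [] , [] ,
      λ { u′ (p′ ∷ q′ ∷ []) _ → cong (_∧ f (inner u′)) (false-conj (pairs u′) i (trans (lookup-pairs u′ i) (cong₂ _∨_ p′ q′))) }
    g-cert u | true with f (inner u) in e₂
    ... | true with mono (inner u) e₂
    ...   | P , l , t , force = List.map (n ↑ʳ_) P , List.tabulate pick ,
      ℕ.≤-trans (ℕ.≤-reflexive (List.length-map (n ↑ʳ_) P)) (ℕ.m≤n⇒m≤n+o 2 l) , ℕ.≤-reflexive (List.length-tabulate pick) ,
      All.map⁺ (All.map (λ {i} e → flip (trans (sym (lookup-inner u i)) e)) t) , All.tabulate⁺ picked ,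
      λ u′ z o → cong₂ _∧_ (conj-all (pairs u′) (λ i → trans (lookup-pairs u′ i) (pick-∨ u′ i (All.tabulate⁻ o i))))
        (force (inner u′) (All.map (λ {i} e → trans (lookup-inner u′ i) (cong not e)) (All.map⁻ z)))
      where
      flip : ∀ {b} → not b ≡ true → b ≡ false
      flip {false} e = refl
      side : Bool → Fin n → Fin (n ℕ.+ n)
      side b i = if b then i ↑ˡ n else n ↑ʳ i
      pick : Fin n → Fin (n ℕ.+ n)
      pick i = side (lookup u (i ↑ˡ n)) i
      picked : ∀ i → lookup u (pick i) ≡ true
      picked i with lookup u (i ↑ˡ n) in e | trans (sym (lookup-pairs u i)) (all-conj (pairs u) e₁ i)
      ... | true  | h = e
      ... | false | h = h
      pick-∨ : ∀ u′ i → lookup u′ (pick i) ≡ true → lookup u′ (i ↑ˡ n) ∨ lookup u′ (n ↑ʳ i) ≡ true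
      pick-∨ u′ i h with lookup u (i ↑ˡ n)
      ... | true  = cong (_∨ lookup u′ (n ↑ʳ i)) h
      ... | false = trans (cong (lookup u′ (i ↑ˡ n) ∨_) h) (∨-zeroʳ (lookup u′ (i ↑ˡ n)))
    -- Keeping the ones of the second half keeps the inner input below that of u, and f is monotone.
    g-cert u | true | false with trueSet (Vec.drop n u)
    ... | P , l , t , mon = [] , List.map (n ↑ʳ_) P , ℕ.z≤n ,
      ℕ.≤-trans (ℕ.≤-reflexive (List.length-map (n ↑ʳ_) P)) l , [] ,
      All.map⁺ (All.map (λ {i} e → trans (lookup-drop n u i) e) t) , force
      where
      force : ∀ u′ → FalseOn u′ [] → TrueOn u′ (List.map (n ↑ʳ_) P) → conj (pairs u′) ∧ f (inner u′) ≡ false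
      force u′ _ o with f (inner u′) in e
      ... | false = ∧-zeroʳ (conj (pairs u′))
      ... | true with mono (inner u′) e
      -- Monotonicity in action: a certificate of f at the smaller inner input also holds at that of
      -- u.
      ...   | Q , _ , tQ , forceQ = contradiction (trans (sym (forceQ (inner u) (All.map (λ {i} h → down i h) tQ))) e₂) (λ ())
        where
        down : ∀ i → lookup (inner u′) i ≡ true → lookup (inner u) i ≡ true
        down i h with lookup (Vec.drop n u) i in e₃
        ... | false = trans (Vec.lookup-map i not (Vec.drop n u)) (cong not e₃)
        ... | true  = contradiction (trans (sym h) (trans (Vec.lookup-map i not (Vec.drop n u′))
          (cong not (mon (Vec.drop n u′) (All.map (λ {j} q → trans (sym (lookup-drop n u′ j)) q) (All.map⁻ o)) i e₃)))) (λ ())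

  length-map-≤ : ∀ {A B : Set} (f : A → B) (P : List A) {k} → List.length P ℕ.≤ k → List.length (List.map f P) ℕ.≤ k
  length-map-≤ f P h = ℕ.≤-trans (ℕ.≤-reflexive (List.length-map f P)) h

  length-++-≤ : ∀ {A : Set} (P Q : List A) {a b} → List.length P ℕ.≤ a → List.length Q ℕ.≤ b →
    List.length (P ++ Q) ℕ.≤ a ℕ.+ b
  length-++-≤ P Q h k = ℕ.≤-trans (ℕ.≤-reflexive (List.length-++ P)) (ℕ.+-mono-≤ h k)

  Agree : ∀ {n} → Vec Bool n → Vec Bool n → List (Fin n) → Set
  Agree y x = All (λ i → lookup y i ≡ lookup x i)

  vec-ext : ∀ {n} {x y : Vec Bool n} → (∀ i → lookup x i ≡ lookup y i) → x ≡ y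
  vec-ext {x = x} {y} h = trans (sym (Vec.tabulate∘lookup x)) (trans (Vec.tabulate-cong h) (Vec.tabulate∘lookup y))

  blockSet : ∀ n b (a : Fin n) → Σ (List (Fin (n ℕ.* b))) λ P → List.length P ℕ.≤ b ×
    (∀ x y → Agree y x P → lookup (chunks n b y) a ≡ lookup (chunks n b x) a)
  blockSet (suc n) b zero = List.tabulate (_↑ˡ (n ℕ.* b)) , ℕ.≤-reflexive (List.length-tabulate _) ,
    λ x y h → vec-ext (λ i → trans (sym (lookup-take b y i)) (trans (All.tabulate⁻ h i) (lookup-take b x i)))
  blockSet (suc n) b (suc a) with blockSet n b a
  ... | P , l , h = List.map (b ↑ʳ_) P , length-map-≤ (b ↑ʳ_) P l ,
    λ x y e → h (Vec.drop b x) (Vec.drop b y) (All.map (λ {i} q → trans (sym (lookup-drop b y i)) (trans q (lookup-drop b x i))) (All.map⁻ e))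

  module Compose {n d w J} (hard : Hard n d w J) where

    open Hard hard
    open DualRail f mono

    F : Vec Bool ((n ℕ.+ n) ℕ.* n) → Bool
    F x = g (Vec.map f (chunks (n ℕ.+ n) n x))

    ν : Bool → Meas (Vec Bool (n ℕ.+ n))
    ν b = pmap dual (μ b)

    Λ : Bool → Meas (Vec Bool ((n ℕ.+ n) ℕ.* n))
    Λ b = pmap concat (bind (ν b) (prod μ))

    Λ-match : Match (bits ((n ℕ.+ n) ℕ.* n)) (d ℕ.* d) Λ
    Λ-match = match-pmap {S = Pow (bits n) (n ℕ.+ n)} {T = bits ((n ℕ.+ n) ℕ.* n)} {h = concat} {μ = λ b → bind (ν b) (prod μ)}
      (pb-concat (atom Bool) n) (match-compose (bits n) d d {ν = ν} {κ = μ}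
        (match-pmap {S = bits n} {T = bits (n ℕ.+ n)} {h = dual} {μ = μ} pb-dual match) match)

    Λ-1 : ∀ b → ∫ (Λ b) (λ _ → 1ℚ) ≡ 1ℚ
    Λ-1 b = ∫-pmap-1 concat {bind (ν b) (prod μ)} (∫-bind-1 {μ = ν b} {k = prod μ} (∫-pmap-1 dual {μ b} (μ-1 b)) (∫-prod-1 {κ = μ} μ-1))

    -- One factor J for the outer pair and one for each of the 2n blocks. This is the demand that
    -- sets the accuracy of all rounds.
    Λ-J : 0ℚ ≤ J → ∀ b → ∫ (abs (Λ b)) (err F b) ≤ J * J ^^ (n ℕ.+ n)
    Λ-J 0≤J b = begin
      ∫ (abs (Λ b)) (err F b) ≡⟨ ∫-abs-pmap concat (bind (ν b) (prod μ)) (err F b) ⟩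
      ∫ (abs (bind (ν b) (prod μ))) (err F b ∘ concat)
        ≡⟨ ∫-cong (abs (bind (ν b) (prod μ))) (λ x → cong (λ y → 1ℚ + 𝟙 (neq (g (Vec.map f y)) b)) (chunks-concat x)) ⟩
      ∫ (abs (bind (ν b) (prod μ))) h ≡⟨ ∫-abs-bind (ν b) (prod μ) h ⟩
      ∫ (abs (ν b)) (λ z → ∫ (abs (prod μ z)) h) ≡⟨ ∫-cong (abs (ν b)) (λ z → cong (λ m → ∫ m h) (prod-abs μ z)) ⟩
      ∫ (abs (ν b)) (λ z → ∫ (prod (abs ∘ μ) z) h)
        ≤⟨ ∫-mono (abs-pos (ν b)) (prod-err f (abs ∘ μ) (λ b → abs-pos (μ b)) J-bound g b) ⟩
      ∫ (abs (ν b)) (λ z → err g b z * J ^^ (n ℕ.+ n)) ≡⟨ ∫-*ʳ (abs (ν b)) (J ^^ (n ℕ.+ n)) (err g b) ⟩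
      ∫ (abs (ν b)) (err g b) * J ^^ (n ℕ.+ n) ≡⟨ cong (_* J ^^ (n ℕ.+ n)) (trans (∫-abs-pmap dual (μ b) (err g b))
          (∫-cong (abs (μ b)) (λ x → cong (λ y → 1ℚ + 𝟙 (neq y b)) (g-dual x)))) ⟩
      ∫ (abs (μ b)) (err f b) * J ^^ (n ℕ.+ n) ≤⟨ *-monoʳ (0≤^^ (n ℕ.+ n) 0≤J) (J-bound b) ⟩
      J * J ^^ (n ℕ.+ n) ∎
      where
      open ≤-Reasoning
      h : Vec (Vec Bool n) (n ℕ.+ n) → ℚ
      h = err (g ∘ Vec.map f) b

    -- At most w + 2 zeros, each certified by its block of n bits, and at most n ones, each
    -- certified by w bits.
    size : ℕ
    size = (w ℕ.+ 2) ℕ.* n ℕ.+ n ℕ.* w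

    block : ∀ x a → lookup (Vec.map f (chunks (n ℕ.+ n) n x)) a ≡ f (lookup (chunks (n ℕ.+ n) n x) a)
    block x a = Vec.lookup-map a f (chunks (n ℕ.+ n) n x)

    zero-cert : ∀ x Pz → FalseOn (Vec.map f (chunks (n ℕ.+ n) n x)) Pz → Σ (List (Fin ((n ℕ.+ n) ℕ.* n))) λ P →
      List.length P ℕ.≤ List.length Pz ℕ.* n × (∀ y → Agree y x P → FalseOn (Vec.map f (chunks (n ℕ.+ n) n y)) Pz)
    zero-cert x []       []       = [] , ℕ.z≤n , λ y _ → []
    zero-cert x (a ∷ Pz) (q ∷ qs) with zero-cert x Pz qs | blockSet (n ℕ.+ n) n a
    ... | P , l , h | P₁ , l₁ , h₁ = P₁ ++ P , length-++-≤ P₁ P l₁ l ,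
      λ y ag → trans (block y a) (trans (cong f (h₁ x y (All.++⁻ˡ P₁ ag))) (trans (sym (block x a)) q)) ∷ h y (All.++⁻ʳ P₁ ag)

    one-cert : ∀ x Po → TrueOn (Vec.map f (chunks (n ℕ.+ n) n x)) Po → Σ (List (Fin ((n ℕ.+ n) ℕ.* n))) λ P →
      List.length P ℕ.≤ List.length Po ℕ.* w × (∀ y → Agree y x P → TrueOn (Vec.map f (chunks (n ℕ.+ n) n y)) Po)
    one-cert x []       []       = [] , ℕ.z≤n , λ y _ → []
    one-cert x (a ∷ Po) (q ∷ qs) with one-cert x Po qs | mc-chunk (n ℕ.+ n) n mono a x (trans (sym (block x a)) q)
    ... | P , l , h | P₁ , l₁ , t₁ , h₁ = P₁ ++ P , length-++-≤ P₁ P l₁ l ,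
      λ y ag → trans (block y a) (h₁ y (All.zipWith (λ { (e , t) → trans e t }) (All.++⁻ˡ P₁ ag , t₁))) ∷ h y (All.++⁻ʳ P₁ ag)

    F-cert : ∀ x → Σ (List (Fin ((n ℕ.+ n) ℕ.* n))) λ P → List.length P ℕ.≤ size × Cert F x P
    F-cert x with g-cert (Vec.map f (chunks (n ℕ.+ n) n x))
    ... | Pz , Po , lz , lo , z , o , force with zero-cert x Pz z | one-cert x Po o
    ...   | P₁ , l₁ , h₁ | P₂ , l₂ , h₂ = P₁ ++ P₂ ,
      length-++-≤ P₁ P₂ (ℕ.≤-trans l₁ (ℕ.*-monoˡ-≤ n lz)) (ℕ.≤-trans l₂ (ℕ.*-monoˡ-≤ w lo)) ,
      λ y ag → force _ (h₁ y (All.++⁻ˡ P₁ ag)) (h₂ y (All.++⁻ʳ P₁ ag))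

  -- Guarding F by c extra bits makes every certificate at one particular input contain all of them.
  module Guard {M : ℕ} (F : Vec Bool M → Bool) (c : ℕ) where

    origin : Vec Bool M
    origin = replicate M true

    -- Without full guards the value is opposite to that at `origin`, so that switching off any one
    -- guard of `top` changes it.
    guarded : Bool → Vec Bool M → Bool
    guarded b x = if b then F x else not (F origin)

    F⁺ : Vec Bool (c ℕ.+ M) → Bool
    F⁺ u = guarded (conj (Vec.take c u)) (Vec.drop c u)

    ones : Vec Bool c
    ones = replicate c true

    conj-ones : ∀ c → conj (replicate c true) ≡ true
    conj-ones zero    = refl
    conj-ones (suc c) = conj-ones c

    F⁺-ones : ∀ x → F⁺ (ones Vec.++ x) ≡ F x
    F⁺-ones x = cong₂ guarded (trans (cong conj (take-++ ones x)) (conj-ones c)) (drop-++ ones x)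

    F⁺-err : ∀ μ b → ∫ (abs (pmap (ones Vec.++_) μ)) (err F⁺ b) ≡ ∫ (abs μ) (err F b)
    F⁺-err μ b = trans (∫-abs-pmap (ones Vec.++_) μ (err F⁺ b))
      (∫-cong (abs μ) (λ x → cong (λ v → 1ℚ + 𝟙 (neq v b)) (F⁺-ones x)))

    F⁺-cert : ∀ {k} → (∀ x → Σ (List (Fin M)) λ P → List.length P ℕ.≤ k × Cert F x P) →
      ∀ u → Σ (List (Fin (c ℕ.+ M))) λ P → List.length P ℕ.≤ c ℕ.+ k × Cert F⁺ u P
    F⁺-cert {k} h u with conj (Vec.take c u) in e
    ... | true with h (Vec.drop c u)
    ...   | P , l , cert = guards ++ List.map (c ↑ʳ_) P ,
      length-++-≤ guards (List.map (c ↑ʳ_) P) (ℕ.≤-reflexive (List.length-tabulate {n = c} (_↑ˡ M))) (length-map-≤ (c ↑ʳ_) P l) ,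
      λ y ag → trans
        (cong (λ b → guarded b (Vec.drop c y)) (trans (cong conj (vec-ext {x = Vec.take c y} {y = Vec.take c u}
          (λ i → trans (sym (lookup-take c y i)) (trans (All.tabulate⁻ (All.++⁻ˡ guards ag) i) (lookup-take c u i))))) e))
        (cert (Vec.drop c y) (All.map (λ {i} q → trans (sym (lookup-drop c y i)) (trans q (lookup-drop c u i))) (All.map⁻ (All.++⁻ʳ guards ag))))
      where
      guards : List (Fin (c ℕ.+ M))
      guards = List.tabulate (_↑ˡ M)
    F⁺-cert {k} h u | false with conj-false (Vec.take c u) e
    ... | i , q = (i ↑ˡ M) ∷ [] , ℕ.≤-trans (inhabited i) (ℕ.m≤m+n c k) ,
      λ { y (ag ∷ []) → cong (λ b → guarded b (Vec.drop c y)) (false-conj (Vec.take c y) i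
        (trans (sym (lookup-take c y i)) (trans ag (trans (lookup-take c u i) q)))) }
      where
      inhabited : ∀ {c} → Fin c → 1 ℕ.≤ c
      inhabited {suc c} _ = ℕ.s≤s ℕ.z≤n

    top : Vec Bool (c ℕ.+ M)
    top = ones Vec.++ origin

    sensitive : ∀ (i : Fin c) y → (∀ j → j ≢ i ↑ˡ M → lookup y j ≡ lookup top j) → lookup y (i ↑ˡ M) ≡ false → F⁺ y ≢ F⁺ top
    sensitive i y same e eq = not-self (F origin) (trans (sym (cong (λ b → guarded b (Vec.drop c y))
      (false-conj (Vec.take c y) i (trans (sym (lookup-take c y i)) e)))) (trans eq (F⁺-ones origin)))
      where
      not-self : ∀ b → not b ≢ b
      not-self true  ()
      not-self false ()

  -- Existence of the certificate complexity.

  allCube? : ∀ {n} {P : Cube n → Set} → (∀ y → Dec (P y)) → Dec (∀ y → P y)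
  -- Points of the cube and subsets are both boolean vectors, so a search through subsets finds a
  -- counterexample.
  allCube? P? with anySubset? (λ y → ¬? (P? y))
  ... | yes (y , ¬p) = no (λ h → ¬p (h y))
  ... | no ¬∃        = yes (λ y → decidable-stable (P? y) (λ ¬p → ¬∃ (y , ¬p)))

  isCertificate? : ∀ {n} (F : BoolFn n) x S → Dec (IsCertificate F x S)
  isCertificate? F x S = allCube? (λ y →
    Fin.all? (λ i → (i ∈? S) →-dec (lookup y i Bool.≟ lookup x i)) →-dec (F y Bool.≟ F x))

  smallest : ∀ {n} {P : Subset n → Set} → (∀ S → Dec (P S)) → ∀ S → P S →
    Σ (Subset n) λ S₀ → P S₀ × (∀ S → P S → card S₀ ℕ.≤ card S)
  smallest {P = P} P? S p = go S p (<-wellFounded (card S))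
    where
    go : ∀ S → P S → Acc ℕ._<_ (card S) → Σ _ λ S₀ → P S₀ × (∀ S → P S → card S₀ ℕ.≤ card S)
    go S p (acc rec) with anySubset? (λ S′ → P? S′ ×-dec (card S′ ℕ.<? card S))
    ... | yes (S′ , p′ , lt) = go S′ p′ (rec lt)
    ... | no ¬∃              = S , p , λ S′ p′ → ℕ.≮⇒≥ (λ lt → ¬∃ (S′ , p′ , lt))

  maximal : ∀ {n} (h : Cube n → ℕ) → Σ (Cube n) λ x₀ → ∀ x → h x ℕ.≤ h x₀
  maximal {zero}  h = [] , λ { [] → ℕ.≤-refl }
  maximal {suc n} h with maximal (h ∘ (true ∷_)) | maximal (h ∘ (false ∷_))
  ... | a , ha | b , hb with ℕ.≤-total (h (true ∷ a)) (h (false ∷ b))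
  ...   | inj₁ le = false ∷ b , λ { (true ∷ x) → ℕ.≤-trans (ha x) le ; (false ∷ x) → hb x }
  ...   | inj₂ ge = true ∷ a , λ { (true ∷ x) → ha x ; (false ∷ x) → ℕ.≤-trans (hb x) ge }

  ∪-size : ∀ {n} (p q : Subset n) → card (p ∪ q) ℕ.≤ card p ℕ.+ card q
  ∪-size []          []          = ℕ.z≤n
  ∪-size (true ∷ p)  (true ∷ q)  = ℕ.s≤s (ℕ.≤-trans (∪-size p q) (ℕ.+-monoʳ-≤ (card p) (ℕ.n≤1+n (card q))))
  ∪-size (true ∷ p)  (false ∷ q) = ℕ.s≤s (∪-size p q)
  ∪-size (false ∷ p) (true ∷ q)  = ℕ.≤-trans (ℕ.s≤s (∪-size p q)) (ℕ.≤-reflexive (sym (ℕ.+-suc (card p) (card q))))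
  ∪-size (false ∷ p) (false ∷ q) = ∪-size p q

  toSubset : ∀ {n} → List (Fin n) → Subset n
  toSubset []      = ∅
  toSubset (i ∷ P) = ⁅ i ⁆ ∪ toSubset P

  toSubset-size : ∀ {n} (P : List (Fin n)) → card (toSubset P) ℕ.≤ List.length P
  toSubset-size {n} []  = ℕ.≤-reflexive (∣⊥∣≡0 n)
  toSubset-size (i ∷ P) = ℕ.≤-trans (∪-size ⁅ i ⁆ (toSubset P))
    (ℕ.+-mono-≤ (ℕ.≤-reflexive (∣⁅x⁆∣≡1 i)) (toSubset-size P))

  agree-on : ∀ {n} (P : List (Fin n)) (x y : Cube n) → (∀ i → i ∈ toSubset P → lookup y i ≡ lookup x i) → Agree y x P
  agree-on []      x y h = []
  agree-on (i ∷ P) x y h = h i (p⊆p∪q (toSubset P) (x∈⁅x⁆ i)) ∷ agree-on P x y (λ j j∈ → h j (q⊆p∪q ⁅ i ⁆ (toSubset P) j∈))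

  certComplexity : ∀ {n} (F : BoolFn n) U → (∀ x → Σ (List (Fin n)) λ P → List.length P ℕ.≤ U × Cert F x P) →
    Σ ℕ λ c → CertComplexity F c × c ℕ.≤ U × (∀ x k → (∀ S → IsCertificate F x S → k ℕ.≤ card S) → k ℕ.≤ c)
  certComplexity {n} F U certs = h x₀ ,
    ((λ x → h x , at x , proj₂ (maximal h) x) , x₀ , at x₀) ,
    ℕ.≤-trans (proj₂ (proj₂ (least x₀)) (S₁ x₀) (isCert x₀)) (ℕ.≤-trans (toSubset-size (proj₁ (certs x₀))) (proj₁ (proj₂ (certs x₀)))) ,
    λ x k lower → ℕ.≤-trans (lower (proj₁ (least x)) (proj₁ (proj₂ (least x)))) (proj₂ (maximal h) x)
    where
    S₁ : Cube n → Subset n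
    S₁ x = toSubset (proj₁ (certs x))
    isCert : ∀ x → IsCertificate F x (S₁ x)
    isCert x y ag = proj₂ (proj₂ (certs x)) y (agree-on (proj₁ (certs x)) x y ag)
    least : ∀ x → Σ (Subset n) λ S₀ → IsCertificate F x S₀ × (∀ S → IsCertificate F x S → card S₀ ℕ.≤ card S)
    least x = smallest (isCertificate? F x) (S₁ x) (isCert x)
    h : Cube n → ℕ
    h x = card (proj₁ (least x))
    at : ∀ x → CertComplexityAt F x (h x)
    at x = (proj₁ (least x) , proj₁ (proj₂ (least x)) , refl) , proj₂ (proj₂ (least x))
    x₀ : Cube n
    x₀ = proj₁ (maximal h)

  prefix-size : ∀ c {M} (S : Subset (c ℕ.+ M)) → (∀ (i : Fin c) → (i ↑ˡ M) ∈ S) → c ℕ.≤ card S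
  prefix-size zero    S           h = ℕ.z≤n
  prefix-size (suc c) {M} (b ∷ S) h with h zero
  ... | here = ℕ.s≤s (prefix-size c S (λ i → drop-there (h (suc i))))
    where
    drop-there : ∀ {n b} {S : Subset n} {i} → suc i ∈ (b ∷ S) → i ∈ S
    drop-there (there p) = p

  -- This makes certificate complexity unbounded along the family, whatever the size of the
  -- certificates of F.
  guard-needed : ∀ {M} (F : Vec Bool M → Bool) c S → IsCertificate (Guard.F⁺ F c) (Guard.top F c) S → c ℕ.≤ card S
  guard-needed {M} F c S cert = prefix-size c S mem
    where
    open Guard F c
    mem : ∀ i → (i ↑ˡ M) ∈ S
    mem i with (i ↑ˡ M) ∈? S
    ... | yes p = p
    ... | no ¬p = contradiction (cert y (λ j j∈ → same j (λ { refl → ¬p j∈ }))) (sensitive i y same (Vec.lookup∘updateAt (i ↑ˡ M) top))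
      where
      y : Vec Bool (c ℕ.+ M)
      y = top [ i ↑ˡ M ]≔ false
      same : ∀ j → j ≢ i ↑ˡ M → lookup y j ≡ lookup top j
      same j j≢ = Vec.lookup∘update′ j≢ top false

  -- (1 + x)^n ≤ 1 / (1 - n x), multiplied out. The induction step is (1 + x)(1 - (n+1) x) ≤ 1 - n
  -- x.
  pow-recip : ∀ n {x} → 0ℚ ≤ x → (1ℚ + x) ^^ n * (1ℚ - ι n * x) ≤ 1ℚ
  pow-recip zero    {x} 0≤x = ≤-reflexive (solve 1 (λ x → con 1ℚ :* (con 1ℚ :- con 0ℚ :* x) := con 1ℚ) refl x)
  pow-recip (suc n) {x} 0≤x = ≤-trans
    (≤-step (0≤* (0≤^^ n (0≤+ 0≤1 0≤x)) (0≤* (0≤* (0≤ι (suc n)) 0≤x) 0≤x))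
      (solve 3 (λ n x p → (con 1ℚ :+ x) :* p :* (con 1ℚ :- (con 1ℚ :+ n) :* x) :+ p :* ((con 1ℚ :+ n) :* x :* x)
        := p :* (con 1ℚ :- n :* x)) refl (ι n) x ((1ℚ + x) ^^ n)))
    (pow-recip n 0≤x)

  pow-small : ∀ n {x} → 0ℚ ≤ x → ι n * x ≤ ½ → (1ℚ + x) ^^ n ≤ 1ℚ + ι 2 * (ι n * x)
  pow-small n {x} 0≤x small = ≤-trans (≤-reflexive (solve 2 (λ p y → p := p :* (con 1ℚ :- y) :+ p :* y) refl p y))
    (+-mono-≤ (pow-recip n 0≤x) (*-monoʳ (0≤* (0≤ι n) 0≤x) p≤2))
    where
    p = (1ℚ + x) ^^ n
    y = ι n * x
    0≤p : 0ℚ ≤ p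
    0≤p = 0≤^^ n (0≤+ 0≤1 0≤x)
    p≤2 : p ≤ ι 2
    p≤2 = ≤-trans (≤-reflexive (solve 1 (λ p → p := con (ι 2) :* (p :* (con 1ℚ :- con ½))) refl p))
      (≤-trans (*-monoˡ (0≤ι 2) (≤-trans (*-monoˡ 0≤p (+-monoʳ-≤ 1ℚ (neg-antimono-≤ small))) (pow-recip n 0≤x))) ≤-refl)

  ε-decay : ∀ k → (1ℚ - ½ * η) ^^ (k ℕ.* 16) ≤ ½ ^^ k
  ε-decay k = ≤-trans (≤-reflexive (^^-* (1ℚ - ½ * η) k 16)) (^^-mono k (0≤^^ 16 0≤ε)
    (decay 16 (1ℚ - ½ * η) (½ * η) 0≤ε (0≤* 0≤½ 0≤η) (toWitness {a? = ((1ℚ - ½ * η) * (1ℚ + ½ * η)) ≤? 1ℚ} _) ≤-refl))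
    where
    0≤ε : 0ℚ ≤ 1ℚ - ½ * η
    0≤ε = nonNegative⁻¹ (1ℚ - ½ * η)

  ½-cancel : ∀ {a} L k → a ℕ.≤ 2 ℕ.^ L → ι a * ½ ^^ (L ℕ.+ k) ≤ ½ ^^ k
  ½-cancel {a} L k h = begin
    ι a * ½ ^^ (L ℕ.+ k) ≤⟨ *-monoʳ (0≤^^ (L ℕ.+ k) 0≤½) (ι-mono h) ⟩
    ι (2 ℕ.^ L) * ½ ^^ (L ℕ.+ k) ≡⟨ cong (ι (2 ℕ.^ L) *_) (^^-+ ½ L k) ⟩
    ι (2 ℕ.^ L) * (½ ^^ L * ½ ^^ k) ≡⟨ *-assoc (ι (2 ℕ.^ L)) (½ ^^ L) (½ ^^ k) ⟨
    ι (2 ℕ.^ L) * ½ ^^ L * ½ ^^ k ≡⟨ trans (cong (_* ½ ^^ k) (2^½ L)) (*-identityˡ _) ⟩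
    ½ ^^ k ∎
    where open ≤-Reasoning

  -- Parameters of one round in terms of the address length L.

  module Scale (l : ℕ) where

    L : ℕ
    L = suc l

    -- With y = 2^(-2L): 2y for failing copies, y for missing names, y for overflow. As arities stay
    -- below 2^L, the 2n + 1 factors of the final composition raise the total only to order I
    -- 2^(-L).
    slack : ℚ
    slack = ι 4 * ½ ^^ (L ℕ.+ L)

    0≤slack : 0ℚ ≤ slack
    0≤slack = 0≤* (0≤ι 4) (0≤^^ (L ℕ.+ L) 0≤½)

    Jᵢ : ℕ → ℚ
    Jᵢ i = (1ℚ + slack) ^^ i

    0≤Jᵢ : ∀ i → 0ℚ ≤ Jᵢ i
    0≤Jᵢ i = 0≤^^ i (0≤+ 0≤1 0≤slack)

    J-composed : ∀ I n → 32 ℕ.* (I ℕ.+ (n ℕ.+ n) ℕ.* I) ℕ.≤ 2 ℕ.^ (L ℕ.+ L) → Jᵢ I * Jᵢ I ^^ (n ℕ.+ n) ≤ 1ℚ + ½ * ½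
    J-composed I n h = begin
      x ^^ I * (x ^^ I) ^^ (n ℕ.+ n)
        ≡⟨ trans (cong (x ^^ I *_) (sym (^^-* x (n ℕ.+ n) I))) (sym (^^-+ x I ((n ℕ.+ n) ℕ.* I))) ⟩
      x ^^ q ≤⟨ pow-small q 0≤slack (≤-trans q·slack≤ (toWitness {a? = (½ * (½ * ½)) ≤? ½} _)) ⟩
      1ℚ + ι 2 * (ι q * slack) ≤⟨ +-monoʳ-≤ 1ℚ (*-monoˡ (0≤ι 2) q·slack≤) ⟩
      1ℚ + ½ * ½ ∎
      where
      open ≤-Reasoning
      q = I ℕ.+ (n ℕ.+ n) ℕ.* I
      x = 1ℚ + slack
      y = ½ ^^ (L ℕ.+ L)
      q·slack≤ : ι q * slack ≤ ½ * (½ * ½)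
      q·slack≤ = begin
        ι q * (ι 4 * y)
          ≡⟨ solve 2 (λ q y → q :* (con (ι 4) :* y) := con (½ * (½ * ½)) :* (con (ι 32) :* q :* y)) refl (ι q) y ⟩
        ½ * (½ * ½) * (ι 32 * ι q * y) ≡⟨ cong (λ z → ½ * (½ * ½) * (z * y)) (ι-* 32 q) ⟨
        ½ * (½ * ½) * (ι (32 ℕ.* q) * y)
          ≡⟨ cong (λ k → ½ * (½ * ½) * (ι (32 ℕ.* q) * ½ ^^ k)) (ℕ.+-identityʳ (L ℕ.+ L)) ⟨
        ½ * (½ * ½) * (ι (32 ℕ.* q) * ½ ^^ (L ℕ.+ L ℕ.+ 0))
          ≤⟨ *-monoˡ (0≤* 0≤½ (0≤* 0≤½ 0≤½)) (½-cancel (L ℕ.+ L) 0 h) ⟩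
        ½ * (½ * ½) ∎

    2L-small : ½ ^^ (L ℕ.+ L) ≤ ½
    2L-small = ≤-trans (*-monoˡ 0≤½ (anti (l ℕ.+ L))) (≤-reflexive (*-identityʳ ½))
      where
      anti : ∀ k → ½ ^^ k ≤ 1ℚ
      anti k = subst (½ ^^ k ≤_) (1^^ k) (^^-mono k 0≤½ (toWitness {a? = ½ ≤? 1ℚ} _))

    -- The factor 16 is due to (1 - η/2)¹⁶ = (15/16)¹⁶ ≤ 1/2.
    copies T : ℕ
    copies = (L ℕ.+ (L ℕ.+ L)) ℕ.* 16
    T = L ℕ.+ (L ℕ.+ L)

    module _ {n d w i} (hard : Hard n d w (Jᵢ i)) (K : ℕ) .{{_ : ℕ.NonZero K}} where

      G A H : ℕ
      -- (d K) L halvings beat (1 + 2H)^(d K), one beats the factor 2 of the extrapolation, and 2L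
      -- remain as the loss.
      G = (d ℕ.* K) ℕ.* L ℕ.+ (1 ℕ.+ (L ℕ.+ L))
      -- The capacity asked for by `r-tail`; the successors here and in H ensure that both are
      -- nonzero.
      A = suc (10 ℕ.* (n ℕ.* copies) ℕ.+ G ℕ.* (2 ℕ.* (4 ℕ.* (K ℕ.* K))))
      H = suc ((d ℕ.* K) ℕ.* ((n ℕ.* copies) ℕ.* (4 ℕ.* (K ℕ.* K))))

      -- In each of the first two terms 3L halvings are available: L of them cancel a count of at
      -- most 2^L, and 2L remain.
      loss≤ : n ℕ.≤ 2 ℕ.^ L → n ℕ.* copies ℕ.≤ 2 ℕ.^ L → 1 ℕ.+ 2 ℕ.* H ℕ.≤ 2 ℕ.^ L →
        loss hard K copies l T A G H ≤ 1ℚ + slack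
      loss≤ n≤ R≤ H≤ = begin
        (1ℚ + x) ^^ n + ι R * ½ ^^ T + ι 2 * (1ℚ + ι 2 * ι H) ^^ D * ½ ^^ G
          ≤⟨ +-mono-≤ (+-mono-≤ first (½-cancel L (L ℕ.+ L) R≤)) third ⟩
        (1ℚ + ι 2 * y) + y + y ≡⟨ solve 1 (λ y → (con 1ℚ :+ con (ι 2) :* y) :+ y :+ y := con 1ℚ :+ con (ι 4) :* y) refl y ⟩
        1ℚ + slack ∎
        where
        open ≤-Reasoning
        x = (1ℚ - ½ * η) ^^ copies
        y = ½ ^^ (L ℕ.+ L)
        D = d ℕ.* K
        R = n ℕ.* copies
        0≤x : 0ℚ ≤ x
        0≤x = 0≤^^ copies (nonNegative⁻¹ (1ℚ - ½ * η))
        nx≤ : ι n * x ≤ y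
        nx≤ = ≤-trans (*-monoˡ (0≤ι n) (ε-decay T)) (½-cancel L (L ℕ.+ L) n≤)
        first : (1ℚ + x) ^^ n ≤ 1ℚ + ι 2 * y
        first = ≤-trans (pow-small n 0≤x (≤-trans nx≤ 2L-small)) (+-monoʳ-≤ 1ℚ (*-monoˡ (0≤ι 2) nx≤))
        base : (1ℚ + ι 2 * ι H) * ½ ^^ L ≤ 1ℚ
        base = ≤-trans (*-monoʳ (0≤^^ L 0≤½) (≤-trans (≤-reflexive (sym (trans (ι-+ 1 (2 ℕ.* H)) (cong₂ _+_ (+-identityʳ 1ℚ) (ι-* 2 H))))) (ι-mono H≤)))
          (≤-reflexive (2^½ L))
        third : ι 2 * (1ℚ + ι 2 * ι H) ^^ D * ½ ^^ G ≤ y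
        third = begin
          ι 2 * (1ℚ + ι 2 * ι H) ^^ D * ½ ^^ G
            ≡⟨ cong (ι 2 * (1ℚ + ι 2 * ι H) ^^ D *_) (trans (^^-+ ½ (D ℕ.* L) (1 ℕ.+ (L ℕ.+ L))) (cong (_* (½ * y)) (^^-* ½ D L))) ⟩
          ι 2 * (1ℚ + ι 2 * ι H) ^^ D * ((½ ^^ L) ^^ D * (½ * y))
            ≡⟨ solve 3 (λ a b y → con (ι 2) :* a :* (b :* (con ½ :* y)) := a :* b :* y) refl ((1ℚ + ι 2 * ι H) ^^ D) ((½ ^^ L) ^^ D) y ⟩
          (1ℚ + ι 2 * ι H) ^^ D * (½ ^^ L) ^^ D * y ≡⟨ cong (_* y) (^^-*-distrib (1ℚ + ι 2 * ι H) (½ ^^ L) D) ⟨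
          ((1ℚ + ι 2 * ι H) * ½ ^^ L) ^^ D * y ≤⟨ *-monoʳ (0≤^^ (L ℕ.+ L) 0≤½)
             (≤-trans (^^-mono D (0≤* (0≤+ 0≤1 (0≤* (0≤ι 2) (0≤ι H))) (0≤^^ L 0≤½)) base) (≤-reflexive (1^^ D))) ⟩
          1ℚ * y ≡⟨ *-identityˡ y ⟩
          y ∎

      next : n ℕ.≤ 2 ℕ.^ L → n ℕ.* copies ℕ.≤ 2 ℕ.^ L → 1 ℕ.+ 2 ℕ.* H ℕ.≤ 2 ℕ.^ L →
        Hard ((T ℕ.* A) ℕ.* (L ℕ.* 2)) (K ℕ.* d) (w ℕ.* copies ℕ.* L) (Jᵢ (suc i))
      next n≤ R≤ H≤ = subst (λ d → Hard ((T ℕ.* A) ℕ.* (L ℕ.* 2)) d (w ℕ.* copies ℕ.* L) (Jᵢ (suc i))) (ℕ.*-comm d K)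
        (weaken (≤-trans (*-monoˡ (0≤Jᵢ i) (loss≤ n≤ R≤ H≤)) (≤-reflexive (*-comm (Jᵢ i) (1ℚ + slack))))
          (step hard K copies l T A G H (ℕ.≤-trans R≤ (ℕ.≤-reflexive (sym (pw≡ L)))) (ℕ.n≤1+n _) (ℕ.n≤1+n _)))

open HardPairs
open import Data.Bool using (Bool)
open import Data.Nat
  using (ℕ; zero; suc; pred; _≤_; _<_; _^_; _+_; _*_; _∸_; s≤s; z≤n; _≤?_; NonZero; >-nonZero)
import Data.Nat.Properties as ℕₚ
open import Data.Nat.Solver using (module +-*-Solver)
open import Data.Product using (Σ; _×_; _,_; proj₁; proj₂)
open import Data.Rational as ℚ using (1ℚ; ½)
import Data.Rational.Properties as ℚₚ
import Data.Vec as Vec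
open import Relation.Binary.PropositionalEquality
open import Relation.Nullary using (¬_)
open import Relation.Nullary.Decidable using (toWitness)
open +-*-Solver using () renaming (solve to solveℕ; con to conℕ; _:+_ to _⊕_; _:*_ to _⊗_; _:=_ to _⊜_)

-- Growth of arity, width and range over the rounds.

1≤^ : ∀ {K} n → 1 ≤ K → 1 ≤ K ^ n
1≤^ {K} n h = ℕₚ.≤-trans (ℕₚ.≤-reflexive (sym (ℕₚ.^-zeroˡ n))) (ℕₚ.^-monoˡ-≤ n h)

≤* : ∀ a {b} → 1 ≤ b → a ≤ b * a
≤* a h = ℕₚ.≤-trans (ℕₚ.≤-reflexive (sym (ℕₚ.*-identityˡ a))) (ℕₚ.*-monoˡ-≤ a h)

-- A round turns the bound P Q K² on the arity into the same with an additional factor 4096 L³ K.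
-- The computed constant 3078 = 6 (1 + 480 + 32) is rounded up to 2^12, so that B can become a power
-- of two.
arity-growth : ∀ L P Q K n c → 1 ≤ L → 1 ≤ P → 1 ≤ Q → 1 ≤ K → n ≤ P * (Q * (K * K)) →
  c ≡ (L + (L + L)) * 16 →
  ((L + (L + L)) * suc (10 * (n * c) +
    ((Q * K) * L + (1 + (L + L))) * (2 * (4 * (K * K))))) * (L * 2)
  ≤ 4096 * (L * (L * L)) * P * (Q * (K * (K * K)))
arity-growth L P Q K n c 1≤L 1≤P 1≤Q 1≤K n≤ refl = begin
  (L + (L + L)) * suc (10 * (n * c) + G * (2 * (4 * (K * K)))) * (L * 2)
    ≤⟨ ℕₚ.*-monoˡ-≤ (L * 2) (ℕₚ.*-monoʳ-≤ (L + (L + L)) (ℕₚ.+-mono-≤ unit (ℕₚ.+-mono-≤ first second))) ⟩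
  (L + (L + L)) * (L * Z + (480 * (L * Z) + 32 * (L * Z))) * (L * 2)
    ≡⟨ solveℕ 2 (λ L Z → (L ⊕ (L ⊕ L)) ⊗ (L ⊗ Z ⊕ (conℕ 480 ⊗ (L ⊗ Z) ⊕ conℕ 32 ⊗ (L ⊗ Z))) ⊗ (L ⊗ conℕ 2)
         ⊜ conℕ 3078 ⊗ (L ⊗ (L ⊗ L) ⊗ Z)) refl L Z ⟩
  3078 * (L * (L * L) * Z) ≤⟨ ℕₚ.*-monoˡ-≤ (L * (L * L) * Z) (toWitness {a? = 3078 ≤? 4096} _) ⟩
  4096 * (L * (L * L) * Z)
    ≡⟨ solveℕ 4 (λ C l P W → C ⊗ (l ⊗ (P ⊗ W)) ⊜ C ⊗ l ⊗ P ⊗ W) refl 4096 (L * (L * L)) P (Q * (K * (K * K))) ⟩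
  4096 * (L * (L * L)) * P * (Q * (K * (K * K))) ∎
  where
  open ℕₚ.≤-Reasoning
  G = (Q * K) * L + (1 + (L + L))
  Z = P * (Q * (K * (K * K)))
  unit : 1 ≤ L * Z
  unit = ℕₚ.*-mono-≤ 1≤L (ℕₚ.*-mono-≤ 1≤P (ℕₚ.*-mono-≤ 1≤Q (ℕₚ.*-mono-≤ 1≤K (ℕₚ.*-mono-≤ 1≤K 1≤K))))
  first : 10 * (n * c) ≤ 480 * (L * Z)
  first = begin
    10 * (n * c) ≡⟨ solveℕ 2 (λ n L → conℕ 10 ⊗ (n ⊗ ((L ⊕ (L ⊕ L)) ⊗ conℕ 16)) ⊜ conℕ 480 ⊗ (L ⊗ n)) refl n L ⟩
    480 * (L * n)
      ≤⟨ ℕₚ.*-monoʳ-≤ 480 (ℕₚ.*-monoʳ-≤ L (ℕₚ.≤-trans n≤ (ℕₚ.*-monoʳ-≤ P (ℕₚ.*-monoʳ-≤ Q (≤* (K * K) 1≤K))))) ⟩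
    480 * (L * Z) ∎
  G≤ : G ≤ 4 * (L * (Q * K))
  G≤ = begin
    (Q * K) * L + (1 + (L + L)) ≤⟨ ℕₚ.+-monoʳ-≤ ((Q * K) * L) (ℕₚ.≤-trans (ℕₚ.+-monoˡ-≤ (L + L) 1≤L)
        (≤* (L + (L + L)) (ℕₚ.*-mono-≤ 1≤Q 1≤K))) ⟩
    (Q * K) * L + (Q * K) * (L + (L + L)) ≡⟨ solveℕ 2 (λ L q → q ⊗ L ⊕ q ⊗ (L ⊕ (L ⊕ L)) ⊜ conℕ 4 ⊗ (L ⊗ q)) refl L (Q * K) ⟩
    4 * (L * (Q * K)) ∎
  second : G * (2 * (4 * (K * K))) ≤ 32 * (L * Z)
  second = begin
    G * (2 * (4 * (K * K))) ≤⟨ ℕₚ.*-monoˡ-≤ (2 * (4 * (K * K))) G≤ ⟩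
    4 * (L * (Q * K)) * (2 * (4 * (K * K)))
      ≡⟨ solveℕ 3 (λ L Q K → conℕ 4 ⊗ (L ⊗ (Q ⊗ K)) ⊗ (conℕ 2 ⊗ (conℕ 4 ⊗ (K ⊗ K))) ⊜ conℕ 32 ⊗ (L ⊗ (Q ⊗ (K ⊗ (K ⊗ K))))) refl L Q K ⟩
    32 * (L * (Q * (K * (K * K)))) ≤⟨ ℕₚ.*-monoʳ-≤ 32 (ℕₚ.*-monoʳ-≤ L (≤* (Q * (K * (K * K))) 1≤P)) ⟩
    32 * (L * Z) ∎

-- The range H matters only through its logarithm, so a crude bound suffices and P is replaced by K.
range-growth : ∀ L P Q K n c → 1 ≤ L → 1 ≤ Q → 1 ≤ K → P ≤ K → n ≤ P * (Q * (K * K)) →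
  c ≡ (L + (L + L)) * 16 →
  1 + 2 * suc ((Q * K) * ((n * c) * (4 * (K * K))))
  ≤ 4096 * (L * (L * L)) * (Q * Q * K ^ 6)
range-growth L P Q K n c 1≤L 1≤Q 1≤K P≤K n≤ refl = begin
  1 + 2 * suc ((Q * K) * ((n * c) * (4 * (K * K))))
    ≡⟨ solveℕ 4 (λ Q K n L → conℕ 1 ⊕ conℕ 2 ⊗ (conℕ 1 ⊕ (Q ⊗ K) ⊗ ((n ⊗ ((L ⊕ (L ⊕ L)) ⊗ conℕ 16)) ⊗ (conℕ 4 ⊗ (K ⊗ K))))
        ⊜ conℕ 3 ⊕ conℕ 384 ⊗ (L ⊗ (Q ⊗ K ⊗ (K ⊗ K) ⊗ n))) refl Q K n L ⟩
  3 + 384 * (L * (Q * K * (K * K) * n))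
    ≤⟨ ℕₚ.+-mono-≤ (ℕₚ.*-monoʳ-≤ 3 unit) (ℕₚ.*-monoʳ-≤ 384 (ℕₚ.*-monoʳ-≤ L (ℕₚ.*-monoʳ-≤ (Q * K * (K * K))
         (ℕₚ.≤-trans n≤ (ℕₚ.*-monoˡ-≤ (Q * (K * K)) P≤K))))) ⟩
  3 * (L * W) + 384 * (L * (Q * K * (K * K) * (K * (Q * (K * K)))))
    ≡⟨ solveℕ 3 (λ L Q K → let W = Q ⊗ Q ⊗ (K ⊗ (K ⊗ (K ⊗ (K ⊗ (K ⊗ (K ⊗ conℕ 1)))))) in
        conℕ 3 ⊗ (L ⊗ W) ⊕ conℕ 384 ⊗ (L ⊗ (Q ⊗ K ⊗ (K ⊗ K) ⊗ (K ⊗ (Q ⊗ (K ⊗ K))))) ⊜ conℕ 387 ⊗ (L ⊗ W)) refl L Q K ⟩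
  387 * (L * W) ≤⟨ ℕₚ.*-mono-≤ (toWitness {a? = 387 ≤? 4096} _) (ℕₚ.*-monoˡ-≤ W L≤) ⟩
  4096 * (L * (L * L) * W) ≡⟨ ℕₚ.*-assoc 4096 (L * (L * L)) W ⟨
  4096 * (L * (L * L)) * W ∎
  where
  open ℕₚ.≤-Reasoning
  W = Q * Q * K ^ 6
  unit : 1 ≤ L * W
  unit = ℕₚ.*-mono-≤ 1≤L (ℕₚ.*-mono-≤ (ℕₚ.*-mono-≤ 1≤Q 1≤Q) (1≤^ 6 1≤K))
  L≤ : L ≤ L * (L * L)
  L≤ = ℕₚ.≤-trans (≤* L (ℕₚ.*-mono-≤ 1≤L 1≤L)) (ℕₚ.≤-reflexive (ℕₚ.*-comm (L * L) L))

cube-bound : ∀ L → 1 ≤ L → 1 ≤ 4096 * (L * (L * L)) × 48 * (L * L) ≤ 4096 * (L * (L * L))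
cube-bound L h = ℕₚ.*-mono-≤ (toWitness {a? = 1 ≤? 4096} _) (ℕₚ.*-mono-≤ h (ℕₚ.*-mono-≤ h h)) ,
  ℕₚ.*-mono-≤ (toWitness {a? = 48 ≤? 4096} _) (≤* (L * L) h)

-- B bounds the polylogarithmic losses of one round, and K = B^I those of all I rounds.
module Iterate (l I B K : ℕ) (1≤I : 1 ≤ I)
  (B≡ : 4096 * (Scale.L l * (Scale.L l * Scale.L l)) ≡ B) (K≡ : K ≡ B ^ I) where

  open Scale l

  1≤B : 1 ≤ B
  1≤B = subst (1 ≤_) B≡ (proj₁ (cube-bound L (s≤s z≤n)))

  1≤K : 1 ≤ K
  1≤K = subst (1 ≤_) (sym K≡) (1≤^ I 1≤B)

  instance
    B-nz : NonZero B
    B-nz = >-nonZero 1≤B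
    K-nz : NonZero K
    K-nz = >-nonZero 1≤K

  B^≤K : ∀ {i} → i ≤ I → B ^ i ≤ K
  B^≤K {i} h = subst (B ^ i ≤_) (sym K≡) (ℕₚ.^-monoʳ-≤ B h)

  B≤K : B ≤ K
  B≤K = ℕₚ.≤-trans (ℕₚ.≤-reflexive (sym (ℕₚ.*-identityʳ B))) (B^≤K 1≤I)

  -- The surplus K² in the arity is due to the tail: K^(i+1) L halvings at 8K² slots each, for the
  -- next degree K^(i+1). It is added afresh in each round and not multiplied.
  record Stage (i : ℕ) : Set where
    field
      {n w} : ℕ
      hard  : Hard n (K ^ i) w (Jᵢ i)
      n≤    : n ≤ B ^ i * (K ^ i * (K * K))
      w≤    : w ≤ B ^ i

  -- The left side bounds 1 + 2H in every round. Since K is polynomial in L for fixed I, it falls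
  -- below 2^L for large L.
  module _ (room : K ^ (I + I + 5) ≤ 2 ^ L) where

    stage : ∀ i → i ≤ I → Stage i
    stage zero    _  = record { hard = hard₀ ; n≤ = ℕₚ.*-mono-≤ {1} {1} ℕₚ.≤-refl (ℕₚ.*-mono-≤ {1} {1} ℕₚ.≤-refl (ℕₚ.*-mono-≤ 1≤K 1≤K)) ; w≤ = ℕₚ.≤-refl }
    stage (suc i) lt = record
      { n = (T * A {i = i} hard K) * (L * 2)
      ; w = w * copies * L
      ; hard = next {i = i} hard K (ℕₚ.≤-trans n≤R R≤) R≤ H≤
      ; n≤ = ℕₚ.≤-trans (subst (λ b → (T * A {i = i} hard K) * (L * 2) ≤ b * B ^ i * (Q * (K * (K * K)))) B≡
            (arity-growth L (B ^ i) (K ^ i) K n copies (s≤s z≤n) (1≤^ i 1≤B) (1≤^ i 1≤K) 1≤K n≤ refl))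
          (ℕₚ.≤-reflexive (cong (B * B ^ i *_) (solveℕ 2 (λ Q K → Q ⊗ (K ⊗ (K ⊗ K)) ⊜ (K ⊗ Q) ⊗ (K ⊗ K)) refl (K ^ i) K)))
      ; w≤ = begin
          w * copies * L ≡⟨ solveℕ 2 (λ w L → w ⊗ ((L ⊕ (L ⊕ L)) ⊗ conℕ 16) ⊗ L ⊜ conℕ 48 ⊗ (L ⊗ L) ⊗ w) refl w L ⟩
          48 * (L * L) * w ≤⟨ ℕₚ.*-mono-≤ (subst (48 * (L * L) ≤_) B≡ (proj₂ (cube-bound L (s≤s z≤n)))) w≤ ⟩
          B * B ^ i ∎ }
      where
      open ℕₚ.≤-Reasoning
      open Stage (stage i (ℕₚ.<⇒≤ lt))
      Q R : ℕ
      Q = K ^ i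
      R = n * copies
      H≤ : 1 + 2 * H {i = i} hard K ≤ 2 ^ L
      H≤ = begin
        1 + 2 * H {i = i} hard K ≤⟨ subst (λ b → 1 + 2 * H {i = i} hard K ≤ b * (Q * Q * K ^ 6)) B≡
            (range-growth L (B ^ i) Q K n copies (s≤s z≤n) (1≤^ i 1≤K) 1≤K (B^≤K (ℕₚ.<⇒≤ lt)) n≤ refl) ⟩
        B * (Q * Q * K ^ 6) ≤⟨ ℕₚ.*-monoˡ-≤ (Q * Q * K ^ 6) B≤K ⟩
        K * (Q * Q * K ^ 6) ≡⟨ solveℕ 3 (λ K Q S → K ⊗ (Q ⊗ Q ⊗ (K ⊗ S)) ⊜ (K ⊗ Q) ⊗ (K ⊗ Q) ⊗ S) refl K Q (K ^ 5) ⟩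
        K ^ suc i * K ^ suc i * K ^ 5
          ≡⟨ trans (ℕₚ.^-distribˡ-+-* K (suc i + suc i) 5) (cong (_* K ^ 5) (ℕₚ.^-distribˡ-+-* K (suc i) (suc i))) ⟨
        K ^ (suc i + suc i + 5) ≤⟨ ℕₚ.^-monoʳ-≤ K (ℕₚ.+-monoˡ-≤ 5 (ℕₚ.+-mono-≤ lt lt)) ⟩
        K ^ (I + I + 5) ≤⟨ room ⟩
        2 ^ L ∎
      R≤ : R ≤ 2 ^ L
      R≤ = begin
        R ≤⟨ ≤* R (ℕₚ.*-mono-≤ {1} {4} (s≤s z≤n) (ℕₚ.*-mono-≤ 1≤K 1≤K)) ⟩
        4 * (K * K) * R ≡⟨ ℕₚ.*-comm (4 * (K * K)) R ⟩
        R * (4 * (K * K)) ≤⟨ ≤* _ (ℕₚ.*-mono-≤ (1≤^ i 1≤K) 1≤K) ⟩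
        (Q * K) * (R * (4 * (K * K))) ≤⟨ ℕₚ.n≤1+n _ ⟩
        H {i = i} hard K ≤⟨ ℕₚ.m≤m+n (H {i = i} hard K) (H {i = i} hard K + 0) ⟩
        2 * H {i = i} hard K ≤⟨ ℕₚ.n≤1+n _ ⟩
        1 + 2 * H {i = i} hard K ≤⟨ H≤ ⟩
        2 ^ L ∎
      n≤R : n ≤ R
      n≤R = ℕₚ.≤-trans (≤* n {copies} (ℕₚ.*-mono-≤ {1} {L + (L + L)} {1} {16} (s≤s z≤n) (s≤s z≤n))) (ℕₚ.≤-reflexive (ℕₚ.*-comm copies n))

n≤2^n : ∀ n → n ≤ 2 ^ n
n≤2^n zero    = z≤n
n≤2^n (suc n) = ℕₚ.≤-trans (ℕₚ.+-mono-≤ (1≤^ n (s≤s z≤n)) (n≤2^n n))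
  (ℕₚ.≤-reflexive (cong (2 ^ n +_) (sym (ℕₚ.+-identityʳ (2 ^ n)))))

size-bound : ∀ K N n w m → 4 ≤ K → 1 ≤ N → n ≤ N → w ≤ K → m ≤ K →
  m + ((w + 2) * n + n * w) ≤ K * (K * N)
size-bound K N n w m 4≤K 1≤N n≤ w≤ m≤ = begin
  m + ((w + 2) * n + n * w)
    ≤⟨ ℕₚ.+-mono-≤ (ℕₚ.≤-trans m≤ (ℕₚ.≤-trans (≤* K 1≤N) (ℕₚ.≤-reflexive (ℕₚ.*-comm N K))))
         (ℕₚ.+-mono-≤ (ℕₚ.*-mono-≤ (ℕₚ.+-mono-≤ w≤ (ℕₚ.≤-trans (s≤s (s≤s z≤n)) 4≤K)) n≤) (ℕₚ.*-mono-≤ n≤ w≤)) ⟩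
  K * N + ((K + K) * N + N * K)
    ≡⟨ solveℕ 2 (λ K N → K ⊗ N ⊕ ((K ⊕ K) ⊗ N ⊕ N ⊗ K) ⊜ conℕ 4 ⊗ (K ⊗ N)) refl K N ⟩
  4 * (K * N) ≤⟨ ℕₚ.*-monoˡ-≤ (K * N) 4≤K ⟩
  K * (K * N) ∎
  where open ℕₚ.≤-Reasoning

-- The arity of the last stage is at most K^(I+3) and its width at most K, so the composed
-- certificates are of order K^(I+4); one more K absorbs constants and guards.
record Gap (m I K : ℕ) : Set where
  field
    {arity} : ℕ
    F       : BoolFn arity
    c       : ℕ
    cert    : CertComplexity F c
    m≤c     : m ≤ c
    c≤      : c ≤ K ^ (I + 5)
    hardF   : ∀ k → k < K ^ (I + I) → ¬ ApproxDegAtMost F k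

module _ (l I B K : ℕ) (1≤I : 1 ≤ I)
  (B≡ : 4096 * (Scale.L l * (Scale.L l * Scale.L l)) ≡ B) (K≡ : K ≡ B ^ I) where

  open Scale l using (L; Jᵢ; 0≤Jᵢ; J-composed)
  open Iterate l I B K 1≤I B≡ K≡ using (1≤K; B≤K; B^≤K; module Stage; stage; K-nz)

  private
    4≤B : 4 ≤ B
    4≤B = subst (4 ≤_) B≡ (big L (s≤s z≤n))
      where
      big : ∀ L → 1 ≤ L → 4 ≤ 4096 * (L * (L * L))
      big L h = ℕₚ.*-mono-≤ (toWitness {a? = 4 ≤? 4096} _) (ℕₚ.*-mono-≤ h (ℕₚ.*-mono-≤ h h))

    4≤K : 4 ≤ K
    4≤K = ℕₚ.≤-trans 4≤B B≤K

    I≤K : I ≤ K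
    I≤K = ℕₚ.≤-trans (n≤2^n I) (subst (2 ^ I ≤_) (sym K≡) (ℕₚ.^-monoˡ-≤ I (ℕₚ.≤-trans (s≤s (s≤s z≤n)) 4≤B)))

  gap : K ^ (I + I + 5) ≤ 2 ^ L → 96 * I ≤ 2 ^ L → ∀ m → m ≤ I → Gap m I K
  gap room 96I≤ m m≤I = record
    { F = F⁺ ; c = proj₁ cc ; cert = proj₁ (proj₂ cc)
    ; m≤c = proj₂ (proj₂ (proj₂ cc)) top m (guard-needed F m)
    ; c≤ = ℕₚ.≤-trans (proj₁ (proj₂ (proj₂ cc))) size≤
    ; hardF = λ k k< → no-approx F⁺ Λ⁺ (match-prefix ones {μ = Λ} Λ-match)
        (λ b → ∫-pmap-1 (ones Vec.++_) {Λ b} (Λ-1 b)) Λ⁺-J (subst (k <_) (ℕₚ.^-distribˡ-+-* K I I) k<) }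
    where
    open Stage (stage room I ℕₚ.≤-refl)
    open Compose hard using (F; Λ; Λ-match; Λ-1; Λ-J; size; F-cert)
    open Guard F m using (F⁺; top; ones; F⁺-err; F⁺-cert)

    N : ℕ
    N = K * (K ^ I * (K * K))

    n≤N : n ≤ N
    n≤N = ℕₚ.≤-trans n≤ (ℕₚ.*-monoˡ-≤ (K ^ I * (K * K)) (B^≤K ℕₚ.≤-refl))

    size≤ : m + size ≤ K ^ (I + 5)
    size≤ = ℕₚ.≤-trans (size-bound K N n w m 4≤K
        (ℕₚ.*-mono-≤ 1≤K (ℕₚ.*-mono-≤ (1≤^ I 1≤K) (ℕₚ.*-mono-≤ 1≤K 1≤K))) n≤N (ℕₚ.≤-trans w≤ (B^≤K ℕₚ.≤-refl)) (ℕₚ.≤-trans m≤I I≤K))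
      (ℕₚ.≤-reflexive (trans (solveℕ 2 (λ K Q → K ⊗ (K ⊗ (K ⊗ (Q ⊗ (K ⊗ K)))) ⊜ Q ⊗ (K ⊗ (K ⊗ (K ⊗ (K ⊗ (K ⊗ conℕ 1)))))) refl K (K ^ I))
        (sym (ℕₚ.^-distribˡ-+-* K I 5))))

    cc : Σ ℕ λ c → CertComplexity F⁺ c × c ≤ m + size × (∀ x k → (∀ S → IsCertificate F⁺ x S → k ≤ _) → k ≤ c)
    cc = certComplexity F⁺ (m + size) (F⁺-cert F-cert)

    Λ⁺ : Bool → Meas (Cube (m + ((n + n) * n)))
    Λ⁺ b = pmap (ones Vec.++_) (Λ b)

    n≤2^L : n ≤ 2 ^ L
    n≤2^L = begin
      n ≤⟨ n≤N ⟩
      N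
        ≡⟨ trans (solveℕ 2 (λ K Q → K ⊗ (Q ⊗ (K ⊗ K)) ⊜ Q ⊗ (K ⊗ (K ⊗ (K ⊗ conℕ 1)))) refl K (K ^ I)) (sym (ℕₚ.^-distribˡ-+-* K I 3)) ⟩
      K ^ (I + 3) ≤⟨ ℕₚ.^-monoʳ-≤ K (ℕₚ.+-mono-≤ (ℕₚ.m≤m+n I I) (toWitness {a? = 3 ≤? 5} _)) ⟩
      K ^ (I + I + 5) ≤⟨ room ⟩
      2 ^ L ∎
      where open ℕₚ.≤-Reasoning

    q≤ : 32 * (I + (n + n) * I) ≤ 2 ^ (L + L)
    q≤ = begin
      32 * (I + (n + n) * I) ≤⟨ ℕₚ.*-monoʳ-≤ 32 (ℕₚ.+-mono-≤ (≤* I (1≤^ L (s≤s z≤n)))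
          (ℕₚ.*-monoˡ-≤ I (ℕₚ.+-mono-≤ n≤2^L n≤2^L))) ⟩
      32 * (W * I + (W + W) * I) ≡⟨ solveℕ 2 (λ W I → conℕ 32 ⊗ (W ⊗ I ⊕ (W ⊕ W) ⊗ I) ⊜ W ⊗ (conℕ 96 ⊗ I)) refl W I ⟩
      W * (96 * I) ≤⟨ ℕₚ.*-monoʳ-≤ W 96I≤ ⟩
      W * W ≡⟨ ℕₚ.^-distribˡ-+-* 2 L L ⟨
      2 ^ (L + L) ∎
      where
      open ℕₚ.≤-Reasoning
      W = 2 ^ L

    Λ⁺-J : ∀ b → ∫ (abs (Λ⁺ b)) (err F⁺ b) ℚ.≤ 1ℚ ℚ.+ ½ ℚ.* ½
    Λ⁺-J b = ℚₚ.≤-trans (ℚₚ.≤-reflexive (F⁺-err (Λ b) b)) (ℚₚ.≤-trans (Λ-J (0≤Jᵢ I) b) (J-composed I n q≤))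

-- Choice of the scale.

cube-pow : ∀ a s C L → C ≡ 2 ^ a → L ≡ 2 ^ (s + s) → C * (L * (L * L)) ≡ 2 ^ (a + 6 * s)
cube-pow a s _ _ refl refl = begin
  2 ^ a * (2 ^ t * (2 ^ t * 2 ^ t))
    ≡⟨ cong (2 ^ a *_) (trans (cong (2 ^ t *_) (sym (ℕₚ.^-distribˡ-+-* 2 t t))) (sym (ℕₚ.^-distribˡ-+-* 2 t (t + t)))) ⟩
  2 ^ a * 2 ^ (t + (t + t)) ≡⟨ ℕₚ.^-distribˡ-+-* 2 a (t + (t + t)) ⟨
  2 ^ (a + (t + (t + t)))
    ≡⟨ cong (λ k → 2 ^ (a + k)) (solveℕ 1 (λ s → s ⊕ s ⊕ (s ⊕ s ⊕ (s ⊕ s)) ⊜ conℕ 6 ⊗ s) refl s) ⟩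
  2 ^ (a + 6 * s) ∎
  where
  open ≡-Reasoning
  t = s + s

12+6s≤ : ∀ E → 12 + 6 * (E + 6) ≤ 2 ^ (E + 6)
12+6s≤ zero    = toWitness {a? = 48 ≤? 64} _
12+6s≤ (suc E) = begin
  12 + 6 * (suc E + 6)
    ≡⟨ solveℕ 1 (λ E → conℕ 12 ⊕ conℕ 6 ⊗ (conℕ 1 ⊕ E ⊕ conℕ 6) ⊜ conℕ 12 ⊕ conℕ 6 ⊗ (E ⊕ conℕ 6) ⊕ conℕ 6) refl E ⟩
  12 + 6 * (E + 6) + 6 ≤⟨ ℕₚ.+-mono-≤ (12+6s≤ E) (ℕₚ.≤-trans (ℕₚ.m≤n+m 6 E) (n≤2^n (E + 6))) ⟩
  2 ^ (E + 6) + 2 ^ (E + 6) ≡⟨ cong (2 ^ (E + 6) +_) (ℕₚ.+-identityʳ (2 ^ (E + 6))) ⟨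
  2 ^ (suc E + 6) ∎
  where open ℕₚ.≤-Reasoning

-- With B = 2^x all sizes are powers of two, and the condition `room` becomes an inequality between
-- exponents.
gap-from : ∀ I → 1 ≤ I → ∀ x l → (∀ L → L ≡ suc l → 4096 * (L * (L * L)) ≡ 2 ^ x) →
  x * (I * (I + I + 5)) ≤ suc l → 7 + I ≤ suc l → ∀ m → m ≤ I → Σ ℕ λ K → Gap m I K
gap-from I 1≤I x l cube exponent 7+I≤ m m≤I = (2 ^ x) ^ I ,
  gap l I (2 ^ x) ((2 ^ x) ^ I) 1≤I (cube (suc l) refl) refl room 96I≤ m m≤I
  where
  open ℕₚ.≤-Reasoning
  room : ((2 ^ x) ^ I) ^ (I + I + 5) ≤ 2 ^ suc l
  room = begin
    ((2 ^ x) ^ I) ^ (I + I + 5) ≡⟨ ℕₚ.^-*-assoc (2 ^ x) I (I + I + 5) ⟩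
    (2 ^ x) ^ (I * (I + I + 5)) ≡⟨ ℕₚ.^-*-assoc 2 x (I * (I + I + 5)) ⟩
    2 ^ (x * (I * (I + I + 5))) ≤⟨ ℕₚ.^-monoʳ-≤ 2 exponent ⟩
    2 ^ suc l ∎
  96I≤ : 96 * I ≤ 2 ^ suc l
  96I≤ = begin
    96 * I ≤⟨ ℕₚ.*-mono-≤ (toWitness {a? = 96 ≤? 128} _) (n≤2^n I) ⟩
    2 ^ 7 * 2 ^ I ≡⟨ ℕₚ.^-distribˡ-+-* 2 7 I ⟨
    2 ^ (7 + I) ≤⟨ ℕₚ.^-monoʳ-≤ 2 7+I≤ ⟩
    2 ^ suc l ∎

-- With L = 2^(2s), s = E + 6 and E = I (2I+5), the condition K^(2I+5) = (2¹² L³)^E ≤ 2^L reads (12 + 6s) E ≤ 2^(2s).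
gap-exists : ∀ I → 1 ≤ I → ∀ m → m ≤ I → Σ ℕ λ K → Gap m I K
gap-exists I 1≤I = gap-from I 1≤I (12 + 6 * s) (pred (2 ^ (s + s)))
  (λ L eq → cube-pow 12 s 4096 L refl (trans eq L≡))
  (subst ((12 + 6 * s) * E ≤_) (sym L≡) exponent) (subst (7 + I ≤_) (sym L≡) (ℕₚ.≤-trans 7+I≤ exponent))
  where
  E s : ℕ
  E = I * (I + I + 5)
  s = E + 6
  L≡ : suc (pred (2 ^ (s + s))) ≡ 2 ^ (s + s)
  L≡ = ℕₚ.suc-pred (2 ^ (s + s)) {{ℕₚ.m^n≢0 2 (s + s)}}
  exponent : (12 + 6 * s) * E ≤ 2 ^ (s + s)
  exponent = ℕₚ.≤-trans (ℕₚ.*-mono-≤ (12+6s≤ E) (ℕₚ.≤-trans (ℕₚ.m≤m+n E 6) (n≤2^n s)))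
    (ℕₚ.≤-reflexive (sym (ℕₚ.^-distribˡ-+-* 2 s s)))
  7+I≤ : 7 + I ≤ (12 + 6 * s) * E
  7+I≤ = begin
    7 + I ≤⟨ ℕₚ.+-monoˡ-≤ I (ℕₚ.*-monoʳ-≤ 7 1≤I) ⟩
    7 * I + I ≡⟨ solveℕ 1 (λ I → conℕ 7 ⊗ I ⊕ I ⊜ conℕ 8 ⊗ (I ⊗ conℕ 1)) refl I ⟩
    8 * (I * 1) ≤⟨ ℕₚ.*-mono-≤ {8} {12 + 6 * s} (ℕₚ.≤-trans (toWitness {a? = 8 ≤? 12} _) (ℕₚ.m≤m+n 12 _))
        (ℕₚ.*-monoʳ-≤ I (ℕₚ.≤-trans (toWitness {a? = 1 ≤? 5} _) (ℕₚ.m≤n+m 5 (I + I)))) ⟩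
    (12 + 6 * s) * E ∎
    where open ℕₚ.≤-Reasoning

-- Exponents tending to 2.

Separates : ℕ → Set
Separates m = Σ ℕ λ n → Σ (BoolFn n) λ F → Σ ℕ λ c → CertComplexity F c × m ≤ c ×
  -- The condition d < c^(2 - 1/(m+1)), raised to the power m + 1 to stay within natural numbers.
  (∀ d → d ^ suc m < c ^ (2 * suc m ∸ 1) → ¬ ApproxDegAtMost F d)

gap⇒separates : ∀ m I K p → p ≡ 2 * suc m ∸ 1 → (I + 5) * p ≡ (I + I) * suc m → Gap m I K → Separates m
gap⇒separates m I K p refl exps G = arity , F , c , cert , m≤c , λ d d< → hardF d (ℕₚ.≰⇒> (λ big → ℕₚ.<⇒≱ d< (begin
    c ^ p ≤⟨ ℕₚ.^-monoˡ-≤ p c≤ ⟩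
    (K ^ (I + 5)) ^ p ≡⟨ ℕₚ.^-*-assoc K (I + 5) p ⟩
    K ^ ((I + 5) * p) ≡⟨ cong (K ^_) exps ⟩
    K ^ ((I + I) * suc m) ≡⟨ ℕₚ.^-*-assoc K (I + I) (suc m) ⟨
    (K ^ (I + I)) ^ suc m ≤⟨ ℕₚ.^-monoˡ-≤ (suc m) big ⟩
    d ^ suc m ∎)))
  where
  open ℕₚ.≤-Reasoning
  open Gap G

-- From (I + 5)(2m + 1) = 2I (m + 1) follows I = 5 (2m + 1), the number of rounds for which K^(2I)
-- equals (K^(I+5))^(2 - 1/(m+1)).
exponents : ∀ m → (10 * m + 5 + 5) * (m + suc (m + 0)) ≡ (10 * m + 5 + (10 * m + 5)) * suc m
exponents = solveℕ 1 (λ m → (conℕ 10 ⊗ m ⊕ conℕ 5 ⊕ conℕ 5) ⊗ (m ⊕ (conℕ 1 ⊕ (m ⊕ conℕ 0)))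
  ⊜ (conℕ 10 ⊗ m ⊕ conℕ 5 ⊕ (conℕ 10 ⊗ m ⊕ conℕ 5)) ⊗ (conℕ 1 ⊕ m)) refl

separates : ∀ m → Separates m
separates m = gap⇒separates m (10 * m + 5) (proj₁ G) (m + suc (m + 0)) refl (exponents m) (proj₂ G)
  where
  G : Σ ℕ λ K → Gap m (10 * m + 5) K
  G = gap-exists (10 * m + 5) (ℕₚ.≤-trans (s≤s z≤n) (ℕₚ.m≤n+m 5 (10 * m))) m
    (ℕₚ.≤-trans (≤* m {10} (s≤s z≤n)) (ℕₚ.m≤m+n (10 * m) 5))

-- The exponent 2 - 1/(m+1) increases with m, so the k-th function of a single family also serves
-- every m ≤ k.
sharpen : ∀ m k c d → m ≤ k → d ^ suc m < c ^ (2 * suc m ∸ 1) → d ^ suc k < c ^ (2 * suc k ∸ 1)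
-- The exponent of c is positive, which the rewriting exposes as a successor; so the hypothesis puts
-- a natural number below 0.
sharpen m k 0       d m≤k h with subst (d ^ suc m <_) (cong (0 ^_) (ℕₚ.+-suc m (m + 0))) h
... | ()
sharpen m k (suc c) d m≤k h = ℕₚ.≰⇒> (λ le → ℕₚ.<⇒≱ (ℕₚ.^-monoˡ-< (suc k) h) (begin
  (C ^ (2 * suc m ∸ 1)) ^ suc k ≡⟨ ℕₚ.^-*-assoc C (2 * suc m ∸ 1) (suc k) ⟩
  C ^ ((2 * suc m ∸ 1) * suc k) ≤⟨ ℕₚ.^-monoʳ-≤ C exps ⟩
  C ^ ((2 * suc k ∸ 1) * suc m) ≡⟨ ℕₚ.^-*-assoc C (2 * suc k ∸ 1) (suc m) ⟨
  (C ^ (2 * suc k ∸ 1)) ^ suc m ≤⟨ ℕₚ.^-monoˡ-≤ (suc m) le ⟩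
  (d ^ suc k) ^ suc m ≡⟨ ℕₚ.^-*-assoc d (suc k) (suc m) ⟩
  d ^ (suc k * suc m) ≡⟨ cong (d ^_) (ℕₚ.*-comm (suc k) (suc m)) ⟩
  d ^ (suc m * suc k) ≡⟨ ℕₚ.^-*-assoc d (suc m) (suc k) ⟨
  (d ^ suc m) ^ suc k ∎))
  where
  open ℕₚ.≤-Reasoning
  C = suc c
  exps : (2 * suc m ∸ 1) * suc k ≤ (2 * suc k ∸ 1) * suc m
  exps = begin
    (2 * suc m ∸ 1) * suc k ≡⟨ solveℕ 2 (λ m k → (m ⊕ (conℕ 1 ⊕ m ⊕ conℕ 0)) ⊗ (conℕ 1 ⊕ k) ⊜ (conℕ 2 ⊗ m ⊗ k ⊕ m ⊕ k ⊕ conℕ 1) ⊕ m) refl m k ⟩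
    (2 * m * k + m + k + 1) + m ≤⟨ ℕₚ.+-monoʳ-≤ _ m≤k ⟩
    (2 * m * k + m + k + 1) + k ≡⟨ solveℕ 2 (λ m k → (conℕ 2 ⊗ m ⊗ k ⊕ m ⊕ k ⊕ conℕ 1) ⊕ k ⊜ (k ⊕ (conℕ 1 ⊕ k ⊕ conℕ 0)) ⊗ (conℕ 1 ⊕ m)) refl m k ⟩
    (2 * suc k ∸ 1) * suc m ∎

-- The o(1) of the k-th function is 1/(k+1), and its k guards make the certificate complexity at
-- least k. The thresholds are therefore B and m themselves.
theorem5p2 : Σ (ℕ → ℕ) λ n → Σ ((k : ℕ) → BoolFn (n k)) λ F → Σ (ℕ → ℕ) λ c →
    ((k : ℕ) → CertComplexity (F k) (c k))
    × ((B : ℕ) → Σ ℕ λ K → (k : ℕ) → K ≤ k → B ≤ c k)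
    × ((m : ℕ) → Σ ℕ λ K → (k : ℕ) → K ≤ k → (d : ℕ) →
    d ^ suc m < c k ^ (2 * suc m ∸ 1) → ¬ ApproxDegAtMost (F k) d)
theorem5p2 = (λ k → proj₁ (separates k)) , (λ k → proj₁ (proj₂ (separates k))) , (λ k → proj₁ (proj₂ (proj₂ (separates k)))) ,
  (λ k → proj₁ (proj₂ (proj₂ (proj₂ (separates k))))) ,
  (λ B → B , λ k B≤k → ℕₚ.≤-trans B≤k (proj₁ (proj₂ (proj₂ (proj₂ (proj₂ (separates k))))))) ,
  (λ m → m , λ k m≤k d h → proj₂ (proj₂ (proj₂ (proj₂ (proj₂ (separates k))))) d (sharpen m k _ d m≤k h))
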